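{- Let $l\ge 2$ and $k\ge 2l+1$. For any double-wedge pattern $\tau\in S_{2l}$ that is an involution avoiding $132$, $$I_{(\tau,2l+1,2l+2,\dots,k)}(x)=I_{12\dots k}(x),$$ where $(\tau,2l+1,\dots,k)\in S_k$ is the permutation obtained from $\tau$ by appending $2l+1,\dots,k$, and for a pattern $\rho$, $I_\rho(x)=\sum_{n\ge 0}I_\rho(n)x^n$ with $I_\rho(n)$ the number of involutions in $S_n$ avoiding both $132$ and $\rho$.
   Context: $S_n$ is the set of permutations of $\{1,\dots,n\}$, written in one-line notation. A permutation $\alpha\in S_n$ contains a pattern $\tau\in S_k$ if there are $1\le i_1<\dots<i_k\le n$ such that $(\alpha_{i_1},\dots,\alpha_{i_k})$ is order-isomorphic to $\tau$; otherwise it avoids $\tau$. An involution is a permutation equal to its own inverse; the empty permutation is counted for $n=0$. A permutation $\sigma\in S_m$ ($m\ge1$) is a wedge pattern if it can be written as a concatenation $\sigma=(\tau^1,\rho^1,\dots,\tau^r,\rho^r)$ such that each $\tau^i$ is nonempty, $(\tau^1,\tau^2,\dots,\tau^r)=(s+1,s+2,\dots,m)$ for some $s\ge 0$, and $(\rho^1,\dots,\rho^r)$ is a layered permutation of $1,\dots,s$ with layers $\rho^1,\dots,\rho^r$; that is, each $\rho^i$ is a (possibly empty) increasing sequence of consecutive integers and every entry of $\rho^i$ is larger than every entry of $\rho^{i'}$ whenever $i<i'$. For example $645783912$ and $456378129$ are wedge patterns. For a sequence $\sigma$, $\sigma+l$ denotes the sequence obtained by adding $l$ to every entry. A permutation $\tau\in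 S_{2l}$ is a double-wedge pattern if there is a wedge pattern $\sigma\in S_{l-1}$ such that $\tau=(\sigma^{ -1}+l,\,2l,\,\sigma,\,l)$ or $\tau=(\sigma+l,\,2l,\,\sigma^{ -1},\,l)$. -}

module Defs where

open import Data.Fin.Base as Fin using (Fin; toℕ; zero; suc; punchIn)
open import Data.Fin.Permutation
  using (Permutation′; _⟨$⟩ʳ_; _≈_; flip; id; insert; remove; insert-remove)
import Data.Fin.Properties as Fin
open import Data.List.Base
  using (List; []; _∷_; _++_; [_]; map; concat; length; lookup; filter; tabulate;
         applyUpTo; allFin; cartesianProductWith)
open import Data.List.Membership.Propositional.Properties using (∈-allFin)
import Data.List.Membership.Setoid as Membership
open import Data.List.Membership.Setoid.Properties using (∈-cartesianProductWith⁺; ∈-resp-≈)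
open import Data.List.Relation.Binary.Permutation.Propositional using (_↭_)
open import Data.List.Relation.Unary.All as All using (All)
open import Data.List.Relation.Unary.AllPairs as AllPairs using (AllPairs)
open import Data.List.Relation.Unary.Any using (here)
open import Data.List.Relation.Unary.Linked using (Linked)
open import Data.List.Relation.Unary.Unique.Propositional.Properties using (allFin⁺)
open import Data.List.Relation.Unary.Unique.Setoid using (Unique)
open import Data.List.Relation.Unary.Unique.Setoid.Properties using (cartesianProductWith⁺)
open import Data.Nat.Base using (ℕ; zero; suc; _+_; _*_; _∸_; _≤_; _<_)
import Data.Nat.Properties as ℕ
open import Data.Product.Base using (∃; ∃-syntax; _×_; _,_; proj₁; proj₂)
open import Data.Sum.Base using (_⊎_)
open import Data.Vec.Base as Vec using (Vec; []; _∷_)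
open import Function.Bundles using (_⇔_; mk⇔; Equivalence)
open import Level using (0ℓ)
open import Relation.Binary.Bundles using (Setoid)
open import Relation.Binary.PropositionalEquality
  using (_≡_; _≢_; refl; sym; trans; cong; setoid)
open import Relation.Nullary.Decidable using (Dec; map′; _×-dec_; _→-dec_; ¬?)
open import Relation.Nullary.Negation using (¬_)
open import Relation.Unary using (Pred; Decidable)

private
  variable
    n : ℕ

-- One-line notation, with entries in {1,…,n} (`Fin n` itself starts at 0).

oneLine : Permutation′ n → List ℕ
oneLine π = tabulate (λ i → suc (toℕ (π ⟨$⟩ʳ i)))

-- (a, a + 1, …, b); empty if b < a.

interval : ℕ → ℕ → List ℕ
interval a b = applyUpTo (a +_) (suc b ∸ a)

Involution : Permutation′ n → Set
Involution π = flip π ≈ π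

-- Patterns are sequences in one-line notation, so that they can be concatenated
-- and shifted directly.  `is` lists the positions i₁ < … < iₖ of the occurrence.

Occurrence : (ρ : List ℕ) → Permutation′ n → Vec (Fin n) (length ρ) → Set
Occurrence ρ α is =
  (∀ a b → a Fin.< b → Vec.lookup is a Fin.< Vec.lookup is b) ×
  (∀ a b → (lookup ρ a < lookup ρ b) ⇔
           (α ⟨$⟩ʳ Vec.lookup is a Fin.< α ⟨$⟩ʳ Vec.lookup is b))

Contains : List ℕ → Permutation′ n → Set
Contains ρ α = ∃ (Occurrence ρ α)

Avoids : List ℕ → Permutation′ n → Set
Avoids ρ α = ¬ Contains ρ α

p132 : List ℕ
p132 = 1 ∷ 3 ∷ 2 ∷ []

-- A block (τⁱ , ρⁱ) of a decomposition σ = (τ¹, ρ¹, …, τʳ, ρʳ).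

Block : Set
Block = List ℕ × List ℕ

IsLayered : ℕ → List (List ℕ) → Set
IsLayered s ρs =
  (concat ρs ↭ interval 1 s) ×
  All (Linked (λ x y → y ≡ suc x)) ρs ×
  AllPairs (λ ρ ρ′ → All (λ x → All (λ y → y < x) ρ′) ρ) ρs

IsWedge : (m : ℕ) → Permutation′ m → Set
IsWedge m σ =
  1 ≤ m ×
  (∃[ s ] ∃[ blocks ]
    (oneLine σ ≡ concat (map (λ (b : Block) → proj₁ b ++ proj₂ b) blocks)) ×
    All (λ b → proj₁ b ≢ []) blocks ×
    (concat (map proj₁ blocks) ≡ interval (s + 1) m) ×
    IsLayered s (map proj₂ blocks))

_⊹_ : List ℕ → ℕ → List ℕ
xs ⊹ l = map (_+ l) xs

IsDoubleWedge : (l : ℕ) → Permutation′ (2 * l) → Set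
IsDoubleWedge l τ =
  ∃[ σ ] IsWedge (l ∸ 1) σ ×
    ((oneLine τ ≡ (oneLine (flip σ) ⊹ l) ++ [ 2 * l ] ++ oneLine σ ++ [ l ]) ⊎
     (oneLine τ ≡ (oneLine σ ⊹ l) ++ [ 2 * l ] ++ oneLine (flip σ) ++ [ l ]))

private
  anyVec? : ∀ k {P : Pred (Vec (Fin n) k) 0ℓ} → Decidable P → Dec (∃ P)
  anyVec? zero    P? = map′ ([] ,_) (λ { ([] , p) → p }) (P? [])
  anyVec? (suc k) P? =
    map′ (λ (x , v , p) → (x ∷ v) , p) (λ { (x ∷ v , p) → x , v , p })
         (Fin.any? (λ x → anyVec? k (λ v → P? (x ∷ v))))

  _⇔-dec_ : ∀ {A B : Set} → Dec A → Dec B → Dec (A ⇔ B)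
  A? ⇔-dec B? =
    map′ (λ (f , g) → mk⇔ f g) (λ e → Equivalence.to e , Equivalence.from e)
         ((A? →-dec B?) ×-dec (B? →-dec A?))

involution? : Decidable (Involution {n})
involution? π = Fin.all? (λ i → (flip π ⟨$⟩ʳ i) Fin.≟ (π ⟨$⟩ʳ i))

avoids? : ∀ ρ → Decidable (Avoids {n} ρ)
avoids? ρ α = ¬? (anyVec? (length ρ) λ is →
  Fin.all? (λ a → Fin.all? (λ b →
    (a Fin.<? b) →-dec (Vec.lookup is a Fin.<? Vec.lookup is b)))
  ×-dec
  Fin.all? (λ a → Fin.all? (λ b →
    (lookup ρ a ℕ.<? lookup ρ b) ⇔-dec
    (α ⟨$⟩ʳ Vec.lookup is a Fin.<? α ⟨$⟩ʳ Vec.lookup is b))))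

-- Sₙ, enumerated by the image of the first element; by the two lemmas below
-- every permutation occurs exactly once up to _≈_.

permutations : ∀ n → List (Permutation′ n)
permutations zero    = [ id ]
permutations (suc n) = cartesianProductWith (insert zero) (allFin (suc n)) (permutations n)

permSetoid : ℕ → Setoid 0ℓ 0ℓ
permSetoid n = record
  { Carrier       = Permutation′ n
  ; _≈_           = _≈_
  ; isEquivalence = record
    { refl  = λ _ → refl
    ; sym   = λ p i → sym (p i)
    ; trans = λ p q i → trans (p i) (q i)
    }
  }

private
  insert-cong : ∀ {i j} {π ρ : Permutation′ n} → i ≡ j → π ≈ ρ →
                insert zero i π ≈ insert zero j ρ
  insert-cong         refl π≈ρ zero    = refl
  insert-cong {j = j} refl π≈ρ (suc k) = cong (punchIn j) (π≈ρ k)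

  insert-injective : ∀ {i j} {π ρ : Permutation′ n} →
                     insert zero i π ≈ insert zero j ρ → i ≡ j × π ≈ ρ
  insert-injective eq with refl ← eq zero =
    refl , λ k → Fin.punchIn-injective _ _ _ (eq (suc k))

permutations-complete : (π : Permutation′ n) → Membership._∈_ (permSetoid n) π (permutations n)
permutations-complete {zero}  π = here λ ()
permutations-complete {suc n} π =
  ∈-resp-≈ (permSetoid (suc n)) {x = insert zero _ (remove zero π)} {y = π}
    (insert-remove zero π)
    (∈-cartesianProductWith⁺ (setoid (Fin (suc n))) (permSetoid n) (permSetoid (suc n))
      (λ {_} {_} {π} {ρ} → insert-cong {π = π} {ρ})
      (∈-allFin (π ⟨$⟩ʳ zero)) (permutations-complete (remove zero π)))

permutations-unique : ∀ n → Unique (permSetoid n) (permutations n)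
permutations-unique zero    = All.[] AllPairs.∷ AllPairs.[]
permutations-unique (suc n) =
  cartesianProductWith⁺ (setoid (Fin (suc n))) (permSetoid n) (permSetoid (suc n))
    (insert zero) (λ {_} {_} {π} {ρ} → insert-injective {π = π} {ρ})
    (allFin⁺ (suc n)) (permutations-unique n)

-- Iρ(n); the generating function Σ Iρ(n) xⁿ is its coefficient sequence
-- `I ρ : ℕ → ℕ`, and equality of formal power series is pointwise equality.

I : List ℕ → ℕ → ℕ
I ρ n = length (filter (λ π → involution? π ×-dec avoids? p132 π ×-dec avoids? ρ π)
                       (permutations n))

{-# OPTIONS --safe #-}
module Submission where

-- A 132-avoiding permutation is empty or a skew sum (β , n) ⊖ γ, so it is a binary tree node β γ, and containment of
-- patterns becomes embedding of order structures. Counting the trees that avoid r = node A (node B leaf) by their root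
-- gives, by inclusion and exclusion, F_r = 1 + x (F_A F_r + F_r F_b − F_A F_b) with b the pattern node B leaf. The series
-- F_{12…m} satisfies the same equation, so every pattern of size m built from the empty tree by the operations
-- node A leaf and node A (node B leaf) has the series F_{12…m}. This covers the wedge patterns, their inverses and the
-- double-wedge patterns.
--
-- A nonempty 132-avoiding involution is (δ , n) with δ an involution, or (β , n) ⊖ δ ⊖ (β⁻¹ , j) with δ an involution.
-- Hence I_{(ρ,k)} = 1 + x I_ρ + x² F_ρ(x²) I_{(ρ,k)} for an involution ρ, and I_τ = 1 + x I_τ + x² F_σ(x²) I_τ for the
-- double-wedge pattern τ of σ. It remains to see that I_{12…2l} also satisfies the last equation, which is an identity
-- between Chebyshev polynomials.

open import Defs
open import Algebra.Bundles using (CommutativeRing)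
open import Algebra.Consequences.Setoid using (comm∧idˡ⇒id; comm∧distrʳ⇒distr)
import Algebra.Properties.AbelianGroup as AbelianGroupProperties
import Algebra.Properties.Ring as RingProperties
import Algebra.Properties.Semiring.Mult.TCOptimised as SemiringMult
import Algebra.Solver.Ring as RingSolver
open import Algebra.Solver.Ring.AlmostCommutativeRing using (_-Raw-AlmostCommutative⟶_; fromCommutativeRing)
open import Data.Bool.Base using (Bool; true; false; T; not; if_then_else_)
open import Data.Empty using (⊥; ⊥-elim)
open import Data.Fin.Base as Fin using (Fin; zero; suc; toℕ; inject₁; splitAt; join)
open import Data.Fin.Permutation as Perm
  using (Permutation′; _⟨$⟩ʳ_; _⟨$⟩ˡ_; flip; permutation; inverseˡ; inverseʳ)
import Data.Fin.Properties as Fin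
open import Data.Integer.Base as ℤ using (ℤ; 0ℤ; 1ℤ)
import Data.Integer.Properties as ℤ
open import Data.List.Base
  using (List; []; _∷_; _++_; [_]; length; lookup; tabulate; map; concat; filter; cartesianProduct; initLast; _∷ʳ′_)
open import Data.List.Membership.Propositional using (_∈_; find)
open import Data.List.Membership.Propositional.Properties
  using (∈-lookup; ∈-++⁺ˡ; ∈-++⁺ʳ; ∈-++⁻; ∈-map⁺; ∈-map⁻; ∈-concat⁻′; ∈-cartesianProduct⁺; ∈-cartesianProduct⁻;
         ∈-filter⁺; ∈-filter⁻; ∈-tabulate⁻; ∈-applyUpTo⁻; ∈-∃++)
open import Data.List.Properties
  using (length-++; length-tabulate; lookup-tabulate; map-tabulate; length-applyUpTo; ++-assoc; ++-identityʳ)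
open import Data.List.Relation.Binary.Permutation.Propositional.Properties using (∈-resp-↭)
open import Data.List.Relation.Unary.All as All using (All; []; _∷_)
open import Data.List.Relation.Unary.AllPairs as AllPairs using (AllPairs; []; _∷_)
import Data.List.Relation.Unary.AllPairs.Properties as AllPairs
open import Data.List.Relation.Unary.Any using (here; there)
import Data.List.Relation.Unary.Linked as Linked
open import Data.List.Relation.Unary.Linked.Properties using (Linked⇒AllPairs)
open import Data.List.Relation.Unary.Unique.Propositional using (Unique)
import Data.List.Relation.Unary.Unique.Propositional.Properties as Unique
open import Data.Maybe.Base as Maybe using (Maybe)
open import Data.Nat.Base as ℕ using (ℕ; zero; suc; _≤_; _<_; _∸_; s≤s; z≤n)
open import Data.Nat.Induction using (<-rec)
import Data.Nat.Properties as ℕ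
open import Data.Product.Base using (Σ; ∃; _×_; _,_; proj₁; proj₂; uncurry)
open import Data.Sum.Base using (_⊎_; inj₁; inj₂; [_,_]′; swap; assocʳ; assocˡ) renaming (map to map⊎)
open import Data.Sum.Properties using (inj₁-injective; inj₂-injective; swap-involutive)
open import Data.Unit.Base using (⊤; tt)
import Data.Vec.Base as Vec
open import Data.Vec.Properties using (lookup∘tabulate)
open import Function.Base using (_∘_; id)
open import Function.Bundles using (mk⇔; Equivalence)
open import Level using (0ℓ)
open import Relation.Binary.Bundles using (Setoid)
open import Relation.Binary.Definitions using (tri<; tri≈; tri>)
open import Relation.Binary.PropositionalEquality as ≡ using (_≡_)
import Relation.Binary.Reasoning.Setoid as SetoidReasoning
open import Relation.Nullary.Decidable using (Dec; yes; no; map′; _×-dec_; dec⇒maybe; does)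
open import Relation.Nullary.Negation using (¬_)

-- Everything rests on how a pattern embeds in a skew sum. A pattern that ends in its maximum is
-- dragged by that point into one summand, so `(A ⊕ 𝟙) ⊖ (B ⊕ 𝟙)` either lies inside one summand or
-- is split in exactly one way. This is why the building operations put `leaf` or `node B leaf` on
-- the right, and not an arbitrary tree. The resulting equation is linear in F_r with coefficients
-- given by the series of A and b, so by induction only sizes matter.
--
-- In (β , n) ⊖ δ ⊖ (β⁻¹ , j) the outer summands mirror each other: A occurs in β exactly when A⁻¹
-- occurs in β⁻¹. Hence `node A (snoc (inv A))` occurs as soon as A occurs in β, and the argument x²
-- records that β is counted twice.
--
-- The even length enters through Chebyshev factorizations. Write F_{12...m}(x²) = p_{m-1}/p_m and
-- I_{12...m} = q_m/p_m. Then p_{2l} = p_l² - x² p_{l-1}² is a difference of squares, and q_{2l} =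
-- p_{l-1}(p_l + x p_{l-1}) shares a factor with it. What is left is p_{l-1}/(p_l - x p_{l-1}), the
-- solution of the equation for I_τ.

-- Integers as coefficients in a commutative ring.

module ℤ-Morphism (R : CommutativeRing 0ℓ 0ℓ) where
  open import Data.Integer.Base using (+_; -[1+_])
  open CommutativeRing R hiding (zero)
  open RingProperties ring using (-‿+-comm; -0#≈0#; -‿involutive; -‿distribˡ-*; -‿distribʳ-*)
  open SemiringMult semiring using (1+×; ×-homo-+; ×1-homo-*) renaming (_×_ to _×′_)
  open SetoidReasoning setoid

  -- With this form of multiples, `fromℤ` sends 0 and 1 to `0#` and `1#` by computation, so
  -- constants of solver expressions match those in the goals directly.
  fromℤ : ℤ → Carrier
  fromℤ (+ n)    = n ×′ 1#
  fromℤ -[1+ n ] = - (suc n ×′ 1#)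

  fromℤ-neg : ∀ i → fromℤ (ℤ.- i) ≈ - fromℤ i
  fromℤ-neg (+ zero)  = sym -0#≈0#
  fromℤ-neg (+ suc n) = refl
  fromℤ-neg -[1+ n ]  = sym (-‿involutive _)

  +-cancel-middle : ∀ a b c → a - b ≈ (c + a) - (c + b)
  +-cancel-middle a b c = sym (begin
    (c + a) - (c + b)       ≈⟨ +-cong (+-comm c a) (sym (-‿+-comm c b)) ⟩
    (a + c) + (- c + - b)   ≈⟨ +-assoc a c _ ⟩
    a + (c + (- c + - b))   ≈⟨ +-congˡ (+-assoc c _ _) ⟨
    a + ((c - c) + - b)     ≈⟨ +-congˡ (+-congʳ (-‿inverseʳ c)) ⟩
    a + (0# + - b)          ≈⟨ +-congˡ (+-identityˡ _) ⟩
    a - b                   ∎)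

  fromℤ-⊖ : ∀ m n → fromℤ (m ℤ.⊖ n) ≈ m ×′ 1# - n ×′ 1#
  fromℤ-⊖ m zero = trans (reflexive (≡.cong fromℤ (ℤ.⊖-≥ {m} {0} ℕ.z≤n)))
                         (sym (trans (+-congˡ -0#≈0#) (+-identityʳ _)))
  fromℤ-⊖ zero (suc n) = sym (+-identityˡ _)
  fromℤ-⊖ (suc m) (suc n) = begin
    fromℤ (suc m ℤ.⊖ suc n)                  ≡⟨ ≡.cong fromℤ (ℤ.[1+m]⊖[1+n]≡m⊖n m n) ⟩
    fromℤ (m ℤ.⊖ n)                          ≈⟨ fromℤ-⊖ m n ⟩
    m ×′ 1# - n ×′ 1#                        ≈⟨ +-cancel-middle _ _ 1# ⟩
    (1# + m ×′ 1#) - (1# + n ×′ 1#)          ≈⟨ +-cong (1+× m 1#) (-‿cong (1+× n 1#)) ⟨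
    suc m ×′ 1# - suc n ×′ 1#                ∎

  fromℤ-+ : ∀ i j → fromℤ (i ℤ.+ j) ≈ fromℤ i + fromℤ j
  fromℤ-+ (+ m)    (+ n)    = ×-homo-+ 1# m n
  fromℤ-+ (+ m)    -[1+ n ] = fromℤ-⊖ m (suc n)
  fromℤ-+ -[1+ m ] (+ n)    = trans (fromℤ-⊖ n (suc m)) (+-comm _ _)
  fromℤ-+ -[1+ m ] -[1+ n ] = begin
    - (suc (suc (m ℕ.+ n)) ×′ 1#)     ≡⟨ ≡.cong (λ k → - (suc k ×′ 1#)) (ℕ.+-suc m n) ⟨
    - ((suc m ℕ.+ suc n) ×′ 1#)       ≈⟨ -‿cong (×-homo-+ 1# (suc m) (suc n)) ⟩
    - (suc m ×′ 1# + suc n ×′ 1#)     ≈⟨ -‿+-comm _ _ ⟨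
    - (suc m ×′ 1#) - suc n ×′ 1#     ∎

  fromℤ-+* : ∀ m j → fromℤ (+ m ℤ.* j) ≈ fromℤ (+ m) * fromℤ j
  fromℤ-+* m (+ n) = begin
    fromℤ (+ m ℤ.* + n)   ≡⟨ ≡.cong fromℤ (ℤ.pos-* m n) ⟨
    (m ℕ.* n) ×′ 1#        ≈⟨ ×1-homo-* m n ⟩
    m ×′ 1# * n ×′ 1#       ∎
  fromℤ-+* m -[1+ n ] = begin
    fromℤ (+ m ℤ.* -[1+ n ])       ≡⟨ ≡.cong fromℤ (ℤ.neg-distribʳ-* (+ m) (+ suc n)) ⟨
    fromℤ (ℤ.- (+ m ℤ.* + suc n))  ≈⟨ fromℤ-neg (+ m ℤ.* + suc n) ⟩
    - fromℤ (+ m ℤ.* + suc n)      ≈⟨ -‿cong (fromℤ-+* m (+ suc n)) ⟩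
    - (m ×′ 1# * suc n ×′ 1#)        ≈⟨ -‿distribʳ-* _ _ ⟩
    m ×′ 1# * - (suc n ×′ 1#)        ∎

  fromℤ-* : ∀ i j → fromℤ (i ℤ.* j) ≈ fromℤ i * fromℤ j
  fromℤ-* (+ m)    j = fromℤ-+* m j
  fromℤ-* -[1+ m ] j = begin
    fromℤ (-[1+ m ] ℤ.* j)          ≡⟨ ≡.cong fromℤ (ℤ.neg-distribˡ-* (+ suc m) j) ⟨
    fromℤ (ℤ.- (+ suc m ℤ.* j))     ≈⟨ fromℤ-neg (+ suc m ℤ.* j) ⟩
    - fromℤ (+ suc m ℤ.* j)         ≈⟨ -‿cong (fromℤ-+* (suc m) j) ⟩
    - (suc m ×′ 1# * fromℤ j)        ≈⟨ -‿distribˡ-* _ _ ⟩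
    - (suc m ×′ 1#) * fromℤ j        ∎

  hom : CommutativeRing.rawRing ℤ.+-*-commutativeRing -Raw-AlmostCommutative⟶ fromCommutativeRing R
  hom = record
    { ⟦_⟧    = fromℤ
    ; +-homo = fromℤ-+
    ; *-homo = fromℤ-*
    ; -‿homo = fromℤ-neg
    ; 0-homo = refl
    ; 1-homo = refl
    }

-- Continued-fraction recurrences and Chebyshev identities.

module ContinuedFraction (R : CommutativeRing 0ℓ 0ℓ) where
  open import Data.Integer.Base using (+_; -[1+_])
  open CommutativeRing R hiding (zero)
  open SetoidReasoning setoid
  open ℤ-Morphism R using (fromℤ; hom)

  -- Coefficients are compared as integers, where equality is decidable; in the ring itself it need
  -- not be.
  constants-equal? : ∀ m n → Maybe (fromℤ m ≈ fromℤ n)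
  constants-equal? m n = Maybe.map (λ { ≡.refl → refl }) (dec⇒maybe (m ℤ.≟ n))

  open RingSolver (CommutativeRing.rawRing ℤ.+-*-commutativeRing) (fromCommutativeRing R) hom constants-equal?
    using (solve; _:=_; _:+_; _:*_; _:-_; con; Polynomial)

  private
    :1 : ∀ {n} → Polynomial n
    :1 = con (+ 1)

  by-difference : ∀ {a b c} → a - b ≈ c → c ≈ 0# → a ≈ b
  by-difference {a} {b} {c} a-b≈c c≈0 = begin
    a           ≈⟨ solve 2 (λ a b → a := (a :- b) :+ b) refl a b ⟩
    (a - b) + b ≈⟨ +-congʳ (trans a-b≈c c≈0) ⟩
    0# + b      ≈⟨ +-identityˡ b ⟩
    b           ∎

  -- An equation is proved by exhibiting the difference of its sides as a combination of differences known to vanish.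
  combination₁ : ∀ {a a′ u} → a ≈ a′ → u * (a - a′) ≈ 0#
  combination₁ {a} {a′} {u} p = trans (*-congˡ (trans (+-congʳ p) (-‿inverseʳ a′))) (zeroʳ u)

  combination₂ : ∀ {a a′ b b′ u v} → a ≈ a′ → b ≈ b′ → u * (a - a′) + v * (b - b′) ≈ 0#
  combination₂ p q = trans (+-cong (combination₁ p) (combination₁ q)) (+-identityˡ 0#)

  combination₃ : ∀ {a a′ b b′ c c′ u v w} → a ≈ a′ → b ≈ b′ → c ≈ c′ →
                 u * (a - a′) + v * (b - b′) + w * (c - c′) ≈ 0#
  combination₃ p q r = trans (+-cong (combination₂ p q) (combination₁ r)) (+-identityˡ 0#)

  -- Two constructors per step, so that `p` and `q` unfold at `double (suc l)`.
  double : ℕ → ℕ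
  double zero    = zero
  double (suc n) = suc (suc (double n))

  -- Division is replaced by cancellation of factors of the form `1 - x w`. For power series these
  -- are the invertible series with constant term 1.
  module Expansion
    (x : Carrier) (1-xw-cancel : ∀ w {a b} → (1# - x * w) * a ≈ (1# - x * w) * b → a ≈ b)
    where

    module _
      (F : ℕ → Carrier) (F₀ : F 0 ≈ 0#)
      (Fₛ : ∀ m → F (suc m) ≈ 1# + x * (F m * F (suc m)))
      where

      -- Passing from (a , t + 1) to (a + 1 , t) multiplies the identity by F (a + 1) / F (t + 1).
      F-split : ∀ a t → F (suc (a ℕ.+ t)) + x * (F a * F t)
                      ≈ 1# + x * (F a * F (suc (a ℕ.+ t)) + F (suc (a ℕ.+ t)) * F t)
      F-split zero t = by-difference
        (solve 4 (λ x Z T G →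
            ((G :+ x :* (Z :* T)) :- (:1 :+ x :* (Z :* G :+ G :* T)))
            := (:1 :* (G :- (:1 :+ x :* (T :* G)))
                :+ (x :* T :- x :* G) :* (Z :- con (+ 0))))
          refl x (F 0) (F t) (F (suc t)))
        (combination₂ (Fₛ t) F₀)
      F-split (suc a) t = by-difference
        (solve 6 (λ x A T f g G →
            ((G :+ x :* (g :* T)) :- (:1 :+ x :* (g :* G :+ G :* T)))
            := (g :* (:1 :- x :* T)) :* ((G :+ x :* (A :* f)) :- (:1 :+ x :* (A :* G :+ G :* f)))
               :+ (:1 :- G :* (:1 :- x :* T)) :* (g :- (:1 :+ x :* (A :* g)))
               :+ (x :* (g :* G) :- x :* (A :* g)) :* (f :- (:1 :+ x :* (T :* f))))
          refl x (F a) (F t) (F (suc t)) (F (suc a)) (F (suc (suc a ℕ.+ t))))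
        (combination₃
          (≡.subst
            (λ n → F (suc n) + x * (F a * F (suc t)) ≈ 1# + x * (F a * F (suc n) + F (suc n) * F (suc t)))
            (ℕ.+-suc a t) (F-split a (suc t)))
          (Fₛ a) (Fₛ t))

      -- Collecting the terms in `s` leaves `(1 - x (F a + F t)) s = 1 - x F a F t`, whose left
      -- factor cancels. The equation is the one obtained from inclusion and exclusion at the root.
      F-split-unique : ∀ a t s → s + x * (F a * F t) ≈ 1# + x * (F a * s + s * F t) →
                       s ≈ F (suc (a ℕ.+ t))
      F-split-unique a t s eq = 1-xw-cancel (F a + F t) (by-difference
        (solve 5 (λ x A T s G →
            ((:1 :- x :* (A :+ T)) :* s :- (:1 :- x :* (A :+ T)) :* G)
            := (:1 :* ((s :+ x :* (A :* T)) :- (:1 :+ x :* (A :* s :+ s :* T)))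
               :+ con -[1+ 0 ] :* ((G :+ x :* (A :* T)) :- (:1 :+ x :* (A :* G :+ G :* T)))))
          refl x (F a) (F t) s (F (suc (a ℕ.+ t))))
        (combination₂ eq (F-split a t)))

      F-step-unique : ∀ m s → s ≈ 1# + x * (F m * s) → s ≈ F (suc m)
      F-step-unique m s eq = 1-xw-cancel (F m) (by-difference
        (solve 4 (λ x A s G →
            ((:1 :- x :* A) :* s :- (:1 :- x :* A) :* G)
            := (:1 :* (s :- (:1 :+ x :* (A :* s))) :+ con -[1+ 0 ] :* (G :- (:1 :+ x :* (A :* G)))))
          refl x (F m) s (F (suc m)))
        (combination₂ eq (Fₛ m)))

    module _
      (f : ℕ → Carrier) (f₀ : f 0 ≈ 0#)
      (fₛ : ∀ m → f (suc m) ≈ 1# + x * x * (f m * f (suc m)))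
      where

      -- p m is a rescaled Chebyshev polynomial of the second kind: f m = p (m − 1) / p m.
      p : ℕ → Carrier
      p zero          = 1#
      p (suc zero)    = 1#
      p (suc (suc m)) = p (suc m) - x * x * p m

      -- Numerators of `i` over the denominators `p`: by `i-p-q`, `i m` is the quotient of `q m` by
      -- `p m`.
      q : ℕ → Carrier
      q zero    = 0#
      q (suc m) = p m + x * q m

      -- The quotient formula for `f m`, substituted in the recursion of `p` and freed of division.
      -- It exhibits `p` as a product of factors `1 - x w`, which is what makes `p-cancel` work.
      p-step : ∀ m → p (suc m) ≈ (1# - x * (x * f m)) * p m
      p-step zero = by-difference
        (solve 2 (λ x f → (:1 :- (:1 :- x :* (x :* f)) :* :1)
            := ((x :* x) :* (f :- con (+ 0))))
          refl x (f 0))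
        (combination₁ f₀)
      p-step (suc m) = by-difference
        (solve 5 (λ x f f′ p p′ →
            ((p′ :- x :* x :* p) :- (:1 :- x :* (x :* f′)) :* p′)
            := ((x :* x :* f′) :* (p′ :- (:1 :- x :* (x :* f)) :* p)
                :+ (x :* x :* p) :* (f′ :- (:1 :+ x :* x :* (f :* f′)))))
          refl x (f m) (f (suc m)) (p m) (p (suc m)))
        (combination₂ (p-step m) (fₛ m))

      p-cancel : ∀ m {a b} → p m * a ≈ p m * b → a ≈ b
      p-cancel zero {a} {b} eq = trans (sym (*-identityˡ a)) (trans eq (*-identityˡ b))
      p-cancel (suc m) {a} {b} eq = p-cancel m (1-xw-cancel (x * f m) (begin
        (1# - x * (x * f m)) * (p m * a) ≈⟨ *-assoc _ _ _ ⟨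
        (1# - x * (x * f m)) * p m * a   ≈⟨ *-congʳ (p-step m) ⟨
        p (suc m) * a                    ≈⟨ eq ⟩
        p (suc m) * b                    ≈⟨ *-congʳ (p-step m) ⟩
        (1# - x * (x * f m)) * p m * b   ≈⟨ *-assoc _ _ _ ⟩
        (1# - x * (x * f m)) * (p m * b) ∎))

      -- Both are instances of the Chebyshev addition formula `p (a + b) = p a p b - x² p (a - 1) p
      -- (b - 1)`, with `a = b` and with `a = b + 1`. The recursion of `p` links neighbouring
      -- indices, so the two parities are proved together.
      p-even : ∀ l → p (suc (suc (double l))) ≈ p (suc l) * p (suc l) - x * x * (p l * p l)
      p-odd  : ∀ l → p (suc (suc (suc (double l)))) ≈ p (suc (suc l)) * p (suc l) - x * x * (p (suc l) * p l)

      p-even zero    = solve 1 (λ x → (:1 :- x :* x :* :1) := (:1 :* :1 :- x :* x :* (:1 :* :1))) refl x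
      p-even (suc l) = by-difference
        (solve 5 (λ x a b u v →
            ((u :- x :* x :* v) :- ((b :- x :* x :* a) :* (b :- x :* x :* a) :- x :* x :* (b :* b)))
            := (:1 :* (u :- ((b :- x :* x :* a) :* b :- x :* x :* (b :* a)))
                :+ (con (+ 0) :- x :* x) :* (v :- (b :* b :- x :* x :* (a :* a)))))
          refl x (p l) (p (suc l)) (p (suc (suc (suc (double l))))) (p (suc (suc (double l)))))
        (combination₂ (p-odd l) (p-even l))

      p-odd zero    = solve 1 (λ x → ((:1 :- x :* x :* :1) :- x :* x :* :1)
                                   := ((:1 :- x :* x :* :1) :* :1 :- x :* x :* (:1 :* :1))) refl x
      p-odd (suc l) = by-difference
        (solve 5 (λ x a b u v →
            (let c = b :- x :* x :* a in
             (u :- x :* x :* v) :- ((c :- x :* x :* b) :* c :- x :* x :* (c :* b)))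
            := (let c = b :- x :* x :* a in
                :1 :* (u :- (c :* c :- x :* x :* (b :* b)))
                :+ (con (+ 0) :- x :* x) :* (v :- (c :* b :- x :* x :* (b :* a)))))
          refl x (p l) (p (suc l)) (p (double (suc (suc l)))) (p (suc (suc (suc (double l))))))
        (combination₂ (p-even (suc l)) (p-odd l))

      -- The factor `p (suc l) + x * p l` also divides the difference of squares in `p-even`; this
      -- is the factor that cancels in `i-even-unique`.
      q-even : ∀ l → q (suc (suc (double l))) ≈ p l * (p (suc l) + x * p l)
      q-odd  : ∀ l → q (suc (suc (suc (double l)))) ≈ p (suc l) * (p (suc l) + x * p l)

      q-even zero    = solve 1 (λ x → (:1 :+ x :* (:1 :+ x :* con (+ 0))) := (:1 :* (:1 :+ x :* :1))) refl x
      q-even (suc l) = by-difference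
        (solve 5 (λ x a b u v →
            ((u :+ x :* v) :- b :* ((b :- x :* x :* a) :+ x :* b))
            := (:1 :* (u :- ((b :- x :* x :* a) :* b :- x :* x :* (b :* a)))
                :+ x :* (v :- b :* (b :+ x :* a))))
          refl x (p l) (p (suc l)) (p (suc (suc (suc (double l))))) (q (suc (suc (suc (double l))))))
        (combination₂ (p-odd l) (q-odd l))

      q-odd l = by-difference
        (solve 5 (λ x a b u v →
            ((u :+ x :* v) :- b :* (b :+ x :* a))
            := (:1 :* (u :- (b :* b :- x :* x :* (a :* a)))
                :+ x :* (v :- a :* (b :+ x :* a))))
          refl x (p l) (p (suc l)) (p (suc (suc (double l)))) (q (suc (suc (double l)))))
        (combination₂ (p-even l) (q-even l))

      module _
        (i : ℕ → Carrier) (i₀ : i 0 ≈ 0#)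
        (iₛ : ∀ m → i (suc m) ≈ 1# + x * i m + x * x * (f m * i (suc m)))
        where

        -- The recursion of `i` reads `(1 - x² f m) i (m + 1) = 1 + x i m`. Multiplied by `p m`, its
        -- left side becomes `i (m + 1) p (m + 1)` by `p-step`.
        i-p-q : ∀ m → i m * p m ≈ q m
        i-p-q zero    = trans (*-identityʳ (i 0)) i₀
        i-p-q (suc m) = by-difference
          (solve 7 (λ x f i i′ p p′ q →
              (i′ :* p′ :- (p :+ x :* q))
              := (i′ :* (p′ :- (:1 :- x :* (x :* f)) :* p)
                  :+ p :* (i′ :- (:1 :+ x :* i :+ x :* x :* (f :* i′)))
                  :+ x :* (i :* p :- q)))
            refl x (f m) (i m) (i (suc m)) (p m) (p (suc m)) (q m))
          (combination₃ (p-step m) (iₛ m) (i-p-q m))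

        i-step-unique : ∀ m s → s ≈ 1# + x * i m + x * x * (f m * s) → s ≈ i (suc m)
        i-step-unique m s eq = 1-xw-cancel (x * f m) (by-difference
          (solve 5 (λ x f i s G →
              ((:1 :- x :* (x :* f)) :* s :- (:1 :- x :* (x :* f)) :* G)
              := (:1 :* (s :- (:1 :+ x :* i :+ x :* x :* (f :* s)))
                 :+ con -[1+ 0 ] :* (G :- (:1 :+ x :* i :+ x :* x :* (f :* G)))))
            refl x (f m) (i m) s (i (suc m)))
          (combination₂ eq (iₛ m)))

        -- Multiplying the equation by `p l` gives `(p (suc l) - x p l) s = p l`. A further
        -- multiplication by `p (suc l) + x p l` produces the denominator of `p-even` on the left
        -- and the numerator of `q-even` on the right.
        i-even-unique : ∀ l s → s ≈ 1# + x * s + x * x * (f l * s) → s ≈ i (suc (suc (double l)))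
        i-even-unique l s eq = p-cancel l (p-cancel m (begin
            p m * (p l * s)                              ≈⟨ *-congʳ (p-even l) ⟩
            (p (suc l) * p (suc l) - x * x * (p l * p l)) * (p l * s) ≈⟨ by-difference
              (solve 5 (λ x f a b s →
                  ((b :* b :- x :* x :* (a :* a)) :* (a :* s) :- a :* (a :* (b :+ x :* a)))
                  := ((a :* (b :+ x :* a) :* s) :* (b :- (:1 :- x :* (x :* f)) :* a)
                      :+ (a :* (b :+ x :* a) :* a) :* (s :- (:1 :+ x :* s :+ x :* x :* (f :* s)))))
                refl x (f l) (p l) (p (suc l)) s)
              (combination₂ (p-step l) eq) ⟩
            p l * (p l * (p (suc l) + x * p l))          ≈⟨ *-congˡ (trans (i-p-q m) (q-even l)) ⟨
            p l * (i m * p m)                            ≈⟨ solve 3 (λ a b c → a :* (b :* c) := c :* (a :* b))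
                                                              refl (p l) (i m) (p m) ⟩
            p m * (p l * i m)                            ∎))
          where m = suc (suc (double l))

-- Formal power series with integer coefficients.

module FormalPowerSeries where
  open import Data.Integer.Base using (ℤ; 0ℤ; 1ℤ; _+_; _*_; -_; _-_)
  open import Data.Integer.Tactic.RingSolver using (solve-∀)
  open import Relation.Binary.PropositionalEquality

  Series : Set
  Series = ℕ → ℤ

  infixl 6 _+ˢ_
  infixl 7 _*ˢ_

  0ˢ 1ˢ X : Series
  0ˢ n = 0ℤ

  1ˢ zero    = 1ℤ
  1ˢ (suc n) = 0ℤ

  X zero    = 0ℤ
  X (suc n) = 1ˢ n

  -- The Cauchy product recurses on the tail of the left factor. The product `⊛` of graded lists has
  -- the same recursion, so `∑-⊛` is a direct induction.
  _+ˢ_ _*ˢ_ : Series → Series → Series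
  (f +ˢ g) n = f n + g n

  (f *ˢ g) zero    = f 0 * g 0
  (f *ˢ g) (suc n) = f 0 * g (suc n) + (f ∘ suc *ˢ g) n

  -ˢ_ : Series → Series
  (-ˢ f) n = - f n

  -- A coefficient of a product only sees smaller or equal indices. The bound lets the strong
  -- induction in `1-Xw-cancel` rewrite under a product.
  *ˢ-cong-≤ : ∀ n {f f′ g g′} → (∀ {m} → m ≤ n → f m ≡ f′ m) → (∀ {m} → m ≤ n → g m ≡ g′ m) →
              (f *ˢ g) n ≡ (f′ *ˢ g′) n
  *ˢ-cong-≤ zero    p q = cong₂ _*_ (p z≤n) (q z≤n)
  *ˢ-cong-≤ (suc n) p q = cong₂ _+_ (cong₂ _*_ (p z≤n) (q ℕ.≤-refl))
    (*ˢ-cong-≤ n (λ m≤n → p (s≤s m≤n)) (λ m≤n → q (ℕ.m≤n⇒m≤1+n m≤n)))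

  *ˢ-cong : ∀ {f f′ g g′} → f ≗ f′ → g ≗ g′ → f *ˢ g ≗ f′ *ˢ g′
  *ˢ-cong p q n = *ˢ-cong-≤ n (λ {m} _ → p m) (λ {m} _ → q m)

  *ˢ-zeroˡ : ∀ f → 0ˢ *ˢ f ≗ 0ˢ
  *ˢ-zeroˡ f zero    = refl
  *ˢ-zeroˡ f (suc n) = trans (cong (0ℤ * f (suc n) +_) (*ˢ-zeroˡ f n)) refl

  *ˢ-identityˡ : ∀ f → 1ˢ *ˢ f ≗ f
  *ˢ-identityˡ f zero    = ℤ.*-identityˡ (f 0)
  *ˢ-identityˡ f (suc n) = trans (cong₂ _+_ (ℤ.*-identityˡ (f (suc n))) (*ˢ-zeroˡ f n)) (ℤ.+-identityʳ _)

  *ˢ-distribʳ : ∀ h f g → (f +ˢ g) *ˢ h ≗ f *ˢ h +ˢ g *ˢ h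
  *ˢ-distribʳ h f g zero    = ℤ.*-distribʳ-+ (h 0) (f 0) (g 0)
  *ˢ-distribʳ h f g (suc n) = trans
    (cong ((f 0 + g 0) * h (suc n) +_) (*ˢ-distribʳ h (f ∘ suc) (g ∘ suc) n))
    (lemma (f 0) (g 0) (h (suc n)) ((f ∘ suc *ˢ h) n) ((g ∘ suc *ˢ h) n))
    where
    lemma : ∀ a b c u v → (a + b) * c + (u + v) ≡ (a * c + u) + (b * c + v)
    lemma = solve-∀

  *ˢ-sucʳ : ∀ f g n → (f *ˢ g) (suc n) ≡ (f *ˢ (g ∘ suc)) n + f (suc n) * g 0
  *ˢ-sucʳ f g zero    = refl
  *ˢ-sucʳ f g (suc n) = trans
    (cong (f 0 * g (suc (suc n)) +_) (*ˢ-sucʳ (f ∘ suc) g n))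
    (sym (ℤ.+-assoc (f 0 * g (suc (suc n))) ((f ∘ suc *ˢ (g ∘ suc)) n) (f (suc (suc n)) * g 0)))

  *ˢ-comm : ∀ f g → f *ˢ g ≗ g *ˢ f
  *ˢ-comm f g zero    = ℤ.*-comm (f 0) (g 0)
  *ˢ-comm f g (suc n) = trans (*ˢ-sucʳ f g n) (trans (ℤ.+-comm ((f *ˢ (g ∘ suc)) n) (f (suc n) * g 0))
    (cong₂ _+_ (ℤ.*-comm (f (suc n)) (g 0)) (*ˢ-comm f (g ∘ suc) n)))

  *ˢ-scaleˡ : ∀ c f g n → ((λ m → c * f m) *ˢ g) n ≡ c * (f *ˢ g) n
  *ˢ-scaleˡ c f g zero    = ℤ.*-assoc c (f 0) (g 0)
  *ˢ-scaleˡ c f g (suc n) = trans (cong (c * f 0 * g (suc n) +_) (*ˢ-scaleˡ c (f ∘ suc) g n))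
    (lemma c (f 0) (g (suc n)) ((f ∘ suc *ˢ g) n))
    where
    lemma : ∀ c a b u → c * a * b + c * u ≡ c * (a * b + u)
    lemma = solve-∀

  *ˢ-assoc : ∀ f g h → (f *ˢ g) *ˢ h ≗ f *ˢ (g *ˢ h)
  *ˢ-assoc f g h zero    = ℤ.*-assoc (f 0) (g 0) (h 0)
  *ˢ-assoc f g h (suc n) = trans
    (cong (f 0 * g 0 * h (suc n) +_) (trans (*ˢ-distribʳ h (λ m → f 0 * g (suc m)) (f ∘ suc *ˢ g) n)
      (cong₂ _+_ (*ˢ-scaleˡ (f 0) (g ∘ suc) h n) (*ˢ-assoc (f ∘ suc) g h n))))
    (lemma (f 0) (g 0) (h (suc n)) ((g ∘ suc *ˢ h) n) ((f ∘ suc *ˢ (g *ˢ h)) n))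
    where
    lemma : ∀ a b c u v → a * b * c + (a * u + v) ≡ a * (b * c + u) + v
    lemma = solve-∀

  seriesRing : CommutativeRing 0ℓ 0ℓ
  seriesRing = record
    { Carrier = Series
    ; _≈_ = _≗_
    ; _+_ = _+ˢ_
    ; _*_ = _*ˢ_
    ; -_ = -ˢ_
    ; 0# = 0ˢ
    ; 1# = 1ˢ
    ; isCommutativeRing = record
      { isRing = record
        { +-isAbelianGroup = record
          { isGroup = record
            { isMonoid = record
              { isSemigroup = record
                { isMagma = record
                  { isEquivalence = Setoid.isEquivalence setoid′
                  ; ∙-cong = λ p q n → cong₂ _+_ (p n) (q n)
                  }
                ; assoc = λ f g h n → ℤ.+-assoc (f n) (g n) (h n)
                }
              ; identity = (λ f n → ℤ.+-identityˡ (f n)) , (λ f n → ℤ.+-identityʳ (f n))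
              }
            ; inverse = (λ f n → ℤ.+-inverseˡ (f n)) , (λ f n → ℤ.+-inverseʳ (f n))
            ; ⁻¹-cong = λ p n → cong -_ (p n)
            }
          ; comm = λ f g n → ℤ.+-comm (f n) (g n)
          }
        ; *-cong = *ˢ-cong
        ; *-assoc = *ˢ-assoc
        ; *-identity = comm∧idˡ⇒id setoid′ *ˢ-comm *ˢ-identityˡ
        ; distrib = comm∧distrʳ⇒distr setoid′ (λ p q n → cong₂ _+_ (p n) (q n)) *ˢ-comm *ˢ-distribʳ
        }
      ; *-comm = *ˢ-comm
      }
    }
    where
    setoid′ = ℕ →-setoid ℤ

  X*-zero : ∀ f → (X *ˢ f) 0 ≡ 0ℤ
  X*-zero f = ℤ.*-zeroˡ (f 0)

  X*-suc : ∀ f n → (X *ˢ f) (suc n) ≡ f n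
  X*-suc f n = trans (cong₂ _+_ (ℤ.*-zeroˡ (f (suc n))) (*ˢ-identityˡ f n)) (ℤ.+-identityˡ (f n))

  -- Multiplication by `X` shifts, so the coefficient of `X w a` at `n` depends only on coefficients
  -- of `a` below `n`. These agree with those of `b` by induction, and the remaining terms `a n` and
  -- `b n` must be equal.
  1-Xw-cancel : ∀ w {a b} → (1ˢ +ˢ -ˢ (X *ˢ w)) *ˢ a ≗ (1ˢ +ˢ -ˢ (X *ˢ w)) *ˢ b → a ≗ b
  1-Xw-cancel w {a} {b} eq = <-rec (λ n → a n ≡ b n) step
    where
    open CommutativeRing seriesRing using (distribʳ; *-identityˡ; *-assoc; +-cong; -‿cong)
    open RingProperties (CommutativeRing.ring seriesRing) using (-‿distribˡ-*)
    expand : ∀ c n → ((1ˢ +ˢ -ˢ (X *ˢ w)) *ˢ c) n ≡ c n - (X *ˢ (w *ˢ c)) n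
    expand c n = trans (distribʳ c 1ˢ (-ˢ (X *ˢ w)) n) (cong₂ _+_ (*-identityˡ c n)
      (trans (sym (-‿distribˡ-* (X *ˢ w) c n)) (cong -_ (*-assoc X w c n))))
    shifted : ∀ n → (∀ {m} → m < n → a m ≡ b m) → (X *ˢ (w *ˢ a)) n ≡ (X *ˢ (w *ˢ b)) n
    shifted zero    ih = trans (X*-zero (w *ˢ a)) (sym (X*-zero (w *ˢ b)))
    shifted (suc n) ih = trans (X*-suc (w *ˢ a) n) (trans
      (*ˢ-cong-≤ n {g = a} (λ _ → refl) (λ m≤n → ih (s≤s m≤n))) (sym (X*-suc (w *ˢ b) n)))
    open AbelianGroupProperties ℤ.+-0-abelianGroup using () renaming (∙-cancelʳ to +-cancelʳ)
    step : ∀ n → (∀ {m} → m < n → a m ≡ b m) → a n ≡ b n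
    step n ih = +-cancelʳ (- (X *ˢ (w *ˢ b)) n) (a n) (b n) (begin
      a n - (X *ˢ (w *ˢ b)) n ≡⟨ cong (λ z → a n - z) (shifted n ih) ⟨
      a n - (X *ˢ (w *ˢ a)) n ≡⟨ expand a n ⟨
      _                       ≡⟨ eq n ⟩
      _                       ≡⟨ expand b n ⟩
      b n - (X *ˢ (w *ˢ b)) n ∎)
      where open ≡-Reasoning

  -- f(x) ↦ f(x²)
  stretch : Series → Series
  stretch f zero          = f 0
  stretch f (suc zero)    = 0ℤ
  stretch f (suc (suc n)) = stretch (f ∘ suc) n

  stretch-cong : ∀ {f g} → f ≗ g → stretch f ≗ stretch g
  stretch-cong p zero          = p 0
  stretch-cong p (suc zero)    = refl
  stretch-cong p (suc (suc n)) = stretch-cong (p ∘ suc) n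

  stretch-+ : ∀ f g → stretch (f +ˢ g) ≗ stretch f +ˢ stretch g
  stretch-+ f g zero          = refl
  stretch-+ f g (suc zero)    = refl
  stretch-+ f g (suc (suc n)) = stretch-+ (f ∘ suc) (g ∘ suc) n

  stretch-scale : ∀ c f n → stretch (λ m → c * f m) n ≡ c * stretch f n
  stretch-scale c f zero          = refl
  stretch-scale c f (suc zero)    = sym (ℤ.*-zeroʳ c)
  stretch-scale c f (suc (suc n)) = stretch-scale c (f ∘ suc) n

  stretch-* : ∀ f g → stretch (f *ˢ g) ≗ stretch f *ˢ stretch g
  stretch-* f g zero          = refl
  stretch-* f g (suc zero)    = sym (trans (cong (_+ 0ℤ * g 0) (ℤ.*-zeroʳ (f 0))) refl)
  stretch-* f g (suc (suc n)) = begin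
    stretch (λ m → f 0 * g (suc m) + (f ∘ suc *ˢ g) m) n
      ≡⟨ stretch-+ (λ m → f 0 * g (suc m)) (f ∘ suc *ˢ g) n ⟩
    stretch (λ m → f 0 * g (suc m)) n + stretch (f ∘ suc *ˢ g) n
      ≡⟨ cong₂ _+_ (stretch-scale (f 0) (g ∘ suc) n) (stretch-* (f ∘ suc) g n) ⟩
    f 0 * stretch (g ∘ suc) n + (stretch (f ∘ suc) *ˢ stretch g) n
      -- The product of stretched series advances two places, and passes the vanishing coefficient
      -- of `stretch f` at 1.
      ≡⟨ cong (f 0 * stretch (g ∘ suc) n +_) (ℤ.+-identityˡ _) ⟨
    f 0 * stretch (g ∘ suc) n + (0ℤ + (stretch (f ∘ suc) *ˢ stretch g) n)
      ≡⟨ cong (λ z → f 0 * stretch (g ∘ suc) n + (z + (stretch (f ∘ suc) *ˢ stretch g) n)) (ℤ.*-zeroˡ (stretch g (suc n))) ⟨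
    (stretch f *ˢ stretch g) (suc (suc n)) ∎
    where open ≡-Reasoning

  stretch-0 : stretch 0ˢ ≗ 0ˢ
  stretch-0 zero          = refl
  stretch-0 (suc zero)    = refl
  stretch-0 (suc (suc n)) = stretch-0 n

  stretch-1 : stretch 1ˢ ≗ 1ˢ
  stretch-1 zero          = refl
  stretch-1 (suc zero)    = refl
  stretch-1 (suc (suc n)) = stretch-0 n

  stretch-X : stretch X ≗ X *ˢ X
  stretch-X zero          = refl
  stretch-X (suc zero)    = refl
  stretch-X (suc (suc n)) = trans (stretch-1 n) (sym (X*-suc X (suc n)))

open import Data.Fin.Permutation using (_≈_)
open import Data.Integer.Tactic.RingSolver using (solve-∀)
open import Data.Nat.Base using (_+_; _*_)
open import Relation.Binary.PropositionalEquality hiding ([_])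

-- Pairs of orders, direct and skew sums, and embeddings.

module OrderStructures where
  -- A permutation up to isomorphism: a set of points with the order of positions and the order of values.

  record BiOrder : Set₁ where
    field
      Point : Set
      _<ₚ_ : Point → Point → Set
      _<ᵥ_ : Point → Point → Set

  open BiOrder public

  infix 4 _↪_ _≅_

  private
    variable
      A B C D X Y : BiOrder

  -- Strict monotonicity suffices: between linear orders it implies injectivity and reflection of
  -- the order, so these maps are the occurrences of a pattern.
  record _↪_ (A B : BiOrder) : Set where
    constructor emb
    field
      fun : Point A → Point B
      mono-p : ∀ {a a′} → _<ₚ_ A a a′ → _<ₚ_ B (fun a) (fun a′)
      mono-v : ∀ {a a′} → _<ᵥ_ A a a′ → _<ᵥ_ B (fun a) (fun a′)

  open _↪_ public

  record _≅_ (A B : BiOrder) : Set where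
    field
      to : A ↪ B
      from : B ↪ A
      from-to : ∀ a → fun from (fun to a) ≡ a
      to-from : ∀ b → fun to (fun from b) ≡ b

  open _≅_ public

  ↪-id : A ↪ A
  ↪-id = emb id id id

  infixr 9 _∘↪_
  _∘↪_ : B ↪ C → A ↪ B → A ↪ C
  g ∘↪ f = emb (fun g ∘ fun f) (mono-p g ∘ mono-p f) (mono-v g ∘ mono-v f)

  ≅-refl : A ≅ A
  ≅-refl = record { to = ↪-id ; from = ↪-id ; from-to = λ _ → refl ; to-from = λ _ → refl }

  ≅-sym : A ≅ B → B ≅ A
  ≅-sym e = record { to = from e ; from = to e ; from-to = to-from e ; to-from = from-to e }

  ≅-trans : A ≅ B → B ≅ C → A ≅ C
  ≅-trans e f = record
    { to = to f ∘↪ to e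
    ; from = from e ∘↪ from f
    ; from-to = λ a → trans (cong (fun (from e)) (from-to f _)) (from-to e a)
    ; to-from = λ c → trans (cong (fun (to f)) (to-from e _)) (to-from f c)
    }

  inverse : BiOrder → BiOrder
  inverse A = record { Point = Point A ; _<ₚ_ = _<ᵥ_ A ; _<ᵥ_ = _<ₚ_ A }

  ↪-inverse : A ↪ B → inverse A ↪ inverse B
  ↪-inverse f = emb (fun f) (mono-v f) (mono-p f)

  ≅-inverse : A ≅ B → inverse A ≅ inverse B
  ≅-inverse e = record
    { to = ↪-inverse (to e) ; from = ↪-inverse (from e) ; from-to = from-to e ; to-from = to-from e }

  -- The order on a disjoint union in which the left summand comes first (b = true) or last (b = false).

  lex : Bool → {P Q : Set} → (P → P → Set) → (Q → Q → Set) → P ⊎ Q → P ⊎ Q → Set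
  lex b R S (inj₁ p) (inj₁ p′) = R p p′
  lex b R S (inj₁ p) (inj₂ q)  = T b
  lex b R S (inj₂ q) (inj₁ p)  = T (not b)
  lex b R S (inj₂ q) (inj₂ q′) = S q q′

  infixr 6 _⊕_ _⊖_

  glue : Bool → BiOrder → BiOrder → BiOrder
  glue b A B = record
    { Point = Point A ⊎ Point B
    ; _<ₚ_ = lex true (_<ₚ_ A) (_<ₚ_ B)
    ; _<ᵥ_ = lex b (_<ᵥ_ A) (_<ᵥ_ B)
    }

  _⊕_ _⊖_ : BiOrder → BiOrder → BiOrder
  _⊕_ = glue true
  _⊖_ = glue false

  ∅ 𝟙 : BiOrder
  ∅ = record { Point = ⊥ ; _<ₚ_ = λ _ _ → ⊥ ; _<ᵥ_ = λ _ _ → ⊥ }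
  𝟙 = record { Point = ⊤ ; _<ₚ_ = λ _ _ → ⊥ ; _<ᵥ_ = λ _ _ → ⊥ }

  lex-map : ∀ b {P Q P′ Q′ : Set} {R : P → P → Set} {S : Q → Q → Set} {R′ : P′ → P′ → Set} {S′ : Q′ → Q′ → Set}
            (f : P → P′) (g : Q → Q′) →
            (∀ {p p′} → R p p′ → R′ (f p) (f p′)) → (∀ {q q′} → S q q′ → S′ (g q) (g q′)) →
            ∀ u v → lex b R S u v → lex b R′ S′ (map⊎ f g u) (map⊎ f g v)
  lex-map b f g F G (inj₁ _) (inj₁ _) r = F r
  lex-map b f g F G (inj₁ _) (inj₂ _) r = r
  lex-map b f g F G (inj₂ _) (inj₁ _) r = r
  lex-map b f g F G (inj₂ _) (inj₂ _) r = G r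

  glue-↪ : ∀ b → A ↪ C → B ↪ D → glue b A B ↪ glue b C D
  glue-↪ b f g = emb (map⊎ (fun f) (fun g))
    (λ {u} {v} → lex-map true (fun f) (fun g) (mono-p f) (mono-p g) u v)
    (λ {u} {v} → lex-map b (fun f) (fun g) (mono-v f) (mono-v g) u v)

  glue-≅ : ∀ b → A ≅ C → B ≅ D → glue b A B ≅ glue b C D
  glue-≅ b e f = record
    { to = glue-↪ b (to e) (to f)
    ; from = glue-↪ b (from e) (from f)
    ; from-to = λ { (inj₁ a) → cong inj₁ (from-to e a) ; (inj₂ a) → cong inj₂ (from-to f a) }
    ; to-from = λ { (inj₁ a) → cong inj₁ (to-from e a) ; (inj₂ a) → cong inj₂ (to-from f a) }
    }

  glue-identityʳ : ∀ b → glue b A ∅ ≅ A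
  glue-identityʳ b = record
    { to = emb (λ { (inj₁ a) → a })
        (λ { {inj₁ _} {inj₁ _} r → r }) (λ { {inj₁ _} {inj₁ _} r → r })
    ; from = emb inj₁ id id
    ; from-to = λ { (inj₁ a) → refl }
    ; to-from = λ _ → refl
    }

  glue-identityˡ : ∀ b → glue b ∅ A ≅ A
  glue-identityˡ b = record
    { to = emb (λ { (inj₂ a) → a })
        (λ { {inj₂ _} {inj₂ _} r → r }) (λ { {inj₂ _} {inj₂ _} r → r })
    ; from = emb inj₂ id id
    ; from-to = λ { (inj₂ a) → refl }
    ; to-from = λ _ → refl
    }

  module _ (b : Bool) {P Q R : Set} {S : P → P → Set} {U : Q → Q → Set} {V : R → R → Set} where

    lex-assocʳ : ∀ u v → lex b (lex b S U) V u v → lex b S (lex b U V) (assocʳ u) (assocʳ v)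
    lex-assocʳ (inj₁ (inj₁ _)) (inj₁ (inj₁ _)) r = r
    lex-assocʳ (inj₁ (inj₁ _)) (inj₁ (inj₂ _)) r = r
    lex-assocʳ (inj₁ (inj₁ _)) (inj₂ _)        r = r
    lex-assocʳ (inj₁ (inj₂ _)) (inj₁ (inj₁ _)) r = r
    lex-assocʳ (inj₁ (inj₂ _)) (inj₁ (inj₂ _)) r = r
    lex-assocʳ (inj₁ (inj₂ _)) (inj₂ _)        r = r
    lex-assocʳ (inj₂ _)        (inj₁ (inj₁ _)) r = r
    lex-assocʳ (inj₂ _)        (inj₁ (inj₂ _)) r = r
    lex-assocʳ (inj₂ _)        (inj₂ _)        r = r

    lex-assocˡ : ∀ u v → lex b S (lex b U V) u v → lex b (lex b S U) V (assocˡ u) (assocˡ v)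
    lex-assocˡ (inj₁ _)        (inj₁ _)        r = r
    lex-assocˡ (inj₁ _)        (inj₂ (inj₁ _)) r = r
    lex-assocˡ (inj₁ _)        (inj₂ (inj₂ _)) r = r
    lex-assocˡ (inj₂ (inj₁ _)) (inj₁ _)        r = r
    lex-assocˡ (inj₂ (inj₁ _)) (inj₂ (inj₁ _)) r = r
    lex-assocˡ (inj₂ (inj₁ _)) (inj₂ (inj₂ _)) r = r
    lex-assocˡ (inj₂ (inj₂ _)) (inj₁ _)        r = r
    lex-assocˡ (inj₂ (inj₂ _)) (inj₂ (inj₁ _)) r = r
    lex-assocˡ (inj₂ (inj₂ _)) (inj₂ (inj₂ _)) r = r

  glue-assoc : ∀ b → glue b (glue b A B) C ≅ glue b A (glue b B C)
  glue-assoc b = record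
    { to = emb assocʳ (λ {u} {v} → lex-assocʳ true u v) (λ {u} {v} → lex-assocʳ b u v)
    ; from = emb assocˡ (λ {u} {v} → lex-assocˡ true u v) (λ {u} {v} → lex-assocˡ b u v)
    ; from-to = λ { (inj₁ (inj₁ _)) → refl ; (inj₁ (inj₂ _)) → refl ; (inj₂ _) → refl }
    ; to-from = λ { (inj₁ _) → refl ; (inj₂ (inj₁ _)) → refl ; (inj₂ (inj₂ _)) → refl }
    }

  lex-swap : ∀ b {P Q : Set} {R : P → P → Set} {S : Q → Q → Set} u v →
             lex b R S u v → lex (not b) S R (swap u) (swap v)
  lex-swap b     (inj₁ _) (inj₁ _) r = r
  lex-swap true  (inj₁ _) (inj₂ _) r = r
  lex-swap false (inj₂ _) (inj₁ _) r = r
  lex-swap b     (inj₂ _) (inj₂ _) r = r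

  inverse-⊖ : inverse (A ⊖ B) ≅ inverse B ⊖ inverse A
  inverse-⊖ = record
    { to = emb swap (λ {u} {v} → lex-swap false u v) (λ {u} {v} → lex-swap true u v)
    ; from = emb swap (λ {u} {v} → lex-swap true u v) (λ {u} {v} → lex-swap false u v)
    ; from-to = λ { (inj₁ _) → refl ; (inj₂ _) → refl }
    ; to-from = λ { (inj₁ _) → refl ; (inj₂ _) → refl }
    }

  inl↪ : ∀ b → A ↪ glue b A B
  inl↪ b = emb inj₁ id id

  inr↪ : ∀ b → B ↪ glue b A B
  inr↪ b = emb inj₂ id id

  corestrictˡ : ∀ {b} (f : A ↪ glue b X Y) → (∀ a → Σ (Point X) λ x → fun f a ≡ inj₁ x) → A ↪ X
  corestrictˡ {A = A} {X = X} {Y = Y} {b} f left = emb (proj₁ ∘ left)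
    (λ {a} {a′} r → subst₂ (lex true (_<ₚ_ X) (_<ₚ_ Y)) (proj₂ (left a)) (proj₂ (left a′)) (mono-p f r))
    (λ {a} {a′} r → subst₂ (lex b (_<ᵥ_ X) (_<ᵥ_ Y)) (proj₂ (left a)) (proj₂ (left a′)) (mono-v f r))

  corestrictʳ : ∀ {b} (f : A ↪ glue b X Y) → (∀ a → Σ (Point Y) λ y → fun f a ≡ inj₂ y) → A ↪ Y
  corestrictʳ {A = A} {X = X} {Y = Y} {b} f right = emb (proj₁ ∘ right)
    (λ {a} {a′} r → subst₂ (lex true (_<ₚ_ X) (_<ₚ_ Y)) (proj₂ (right a)) (proj₂ (right a′)) (mono-p f r))
    (λ {a} {a′} r → subst₂ (lex b (_<ᵥ_ X) (_<ᵥ_ Y)) (proj₂ (right a)) (proj₂ (right a′)) (mono-v f r))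

  left-of : ∀ {P Q : Set} {R : P → P → Set} {S : Q → Q → Set} {x} u →
            lex true R S u (inj₁ x) → Σ P λ p → u ≡ inj₁ p
  left-of (inj₁ p) _ = p , refl

  below-right : ∀ {P Q : Set} {R : P → P → Set} {S : Q → Q → Set} {y} u →
                lex false R S u (inj₂ y) → Σ Q λ q → u ≡ inj₂ q
  below-right (inj₂ q) _ = q , refl

  data Side (f : (A ⊕ 𝟙) ↪ (X ⊖ Y)) : Set where
    inˡ : (∀ a → Σ (Point X) λ x → fun f a ≡ inj₁ x) → Side f
    inʳ : (∀ a → Σ (Point Y) λ y → fun f a ≡ inj₂ y) → Side f

  -- The last point of A ⊕ 𝟙 is above and to the right of all others, so the summand containing it contains them all.
  side : (f : (A ⊕ 𝟙) ↪ (X ⊖ Y)) → Side f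
  side {X = X} {Y} f with fun f (inj₂ tt) in eq
  ... | inj₁ x = inˡ λ
    { (inj₁ a)  → left-of _ (subst (lex true (_<ₚ_ X) (_<ₚ_ Y) (fun f (inj₁ a))) eq (mono-p f {inj₁ a} {inj₂ tt} tt))
    ; (inj₂ tt) → x , eq }
  ... | inj₂ y = inʳ λ
    { (inj₁ a)  → below-right _ (subst (lex false (_<ᵥ_ X) (_<ᵥ_ Y) (fun f (inj₁ a))) eq (mono-v f {inj₁ a} {inj₂ tt} tt))
    ; (inj₂ tt) → y , eq }

  ⊕𝟙-↪-⊖ : (A ⊕ 𝟙) ↪ (X ⊖ Y) → ((A ⊕ 𝟙) ↪ X) ⊎ ((A ⊕ 𝟙) ↪ Y)
  ⊕𝟙-↪-⊖ f with side f
  ... | inˡ l = inj₁ (corestrictˡ f l)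
  ... | inʳ r = inj₂ (corestrictʳ f r)

  not-top : ∀ {P : Set} {R : P → P → Set} u → lex true R (λ (_ _ : ⊤) → ⊥) (inj₂ tt) u → ⊥
  not-top (inj₁ _) ()
  not-top (inj₂ _) ()

  -- The adjoined point is last and highest, so it cannot be the image of a point with another one
  -- after it or above it.
  avoid-top : (∀ a → Σ (Point A) λ a′ → _<ₚ_ A a a′ ⊎ _<ᵥ_ A a a′) → A ↪ (X ⊕ 𝟙) → A ↪ X
  avoid-top {A = A} {X = X} not-max f = corestrictˡ f left
    where
    left : ∀ a → Σ (Point X) λ x → fun f a ≡ inj₁ x
    left a with fun f a in eq
    ... | inj₁ x  = x , refl
    ... | inj₂ tt with not-max a
    ...   | a′ , inj₁ p = ⊥-elim (not-top (fun f a′)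
            (subst (λ u → lex true (_<ₚ_ X) _ u (fun f a′)) eq (mono-p f p)))
    ...   | a′ , inj₂ p = ⊥-elim (not-top (fun f a′)
            (subst (λ u → lex true (_<ᵥ_ X) _ u (fun f a′)) eq (mono-v f p)))

  ⊕𝟙-↪-⊕𝟙 : (A ⊕ 𝟙) ↪ (X ⊕ 𝟙) → A ↪ X
  ⊕𝟙-↪-⊕𝟙 {A = A} {X = X} f = corestrictˡ (f ∘↪ inl↪ true) left
    where
    left : ∀ a → Σ (Point X) λ x → fun f (inj₁ a) ≡ inj₁ x
    left a with fun f (inj₁ a) in eq
    ... | inj₁ x  = x , refl
    ... | inj₂ tt = ⊥-elim (not-top (fun f (inj₂ tt))
            (subst (λ u → lex true (_<ₚ_ X) _ u (fun f (inj₂ tt))) eq (mono-p f {inj₁ a} {inj₂ tt} tt)))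

  -- By `side`, each of the two summands goes wholly into `X` or wholly into `Y`. The first in `Y`
  -- with the second in `X` would reverse positions, so three cases survive.
  ⊖-↪-⊖ : ((A ⊕ 𝟙) ⊖ (B ⊕ 𝟙)) ↪ (X ⊖ Y) →
    (((A ⊕ 𝟙) ⊖ (B ⊕ 𝟙)) ↪ X) ⊎ (((A ⊕ 𝟙) ⊖ (B ⊕ 𝟙)) ↪ Y) ⊎ ((A ⊕ 𝟙) ↪ X) × ((B ⊕ 𝟙) ↪ Y)
  ⊖-↪-⊖ {A = A} {B = B} {X = X} {Y = Y} f with side (f ∘↪ inl↪ false) | side (f ∘↪ inr↪ false)
  ... | inˡ l | inˡ l′ = inj₁ (corestrictˡ f λ { (inj₁ a) → l a ; (inj₂ b) → l′ b })
  ... | inʳ r | inʳ r′ = inj₂ (inj₁ (corestrictʳ f λ { (inj₁ a) → r a ; (inj₂ b) → r′ b }))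
  ... | inˡ l | inʳ r′ = inj₂ (inj₂ (corestrictˡ (f ∘↪ inl↪ false) l , corestrictʳ (f ∘↪ inr↪ false) r′))
  ... | inʳ r | inˡ l′ = ⊥-elim (subst₂ (lex true (_<ₚ_ X) (_<ₚ_ Y)) (proj₂ (r (inj₂ tt))) (proj₂ (l′ (inj₂ tt)))
                           (mono-p f {inj₁ (inj₂ tt)} {inj₂ (inj₂ tt)} tt))

  ⊖-↪-⊕𝟙 : ((A ⊕ 𝟙) ⊖ (B ⊕ 𝟙)) ↪ (X ⊕ 𝟙) → ((A ⊕ 𝟙) ⊖ (B ⊕ 𝟙)) ↪ X
  -- Points of the first summand precede the maximum of the second; points of the second lie below
  -- the maximum of the first.
  ⊖-↪-⊕𝟙 = avoid-top λ { (inj₁ a) → inj₂ (inj₂ tt) , inj₁ tt ; (inj₂ b) → inj₁ (inj₂ tt) , inj₂ tt }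

open OrderStructures

-- Binary trees for 132-avoiding permutations.

module Trees where
  -- A 132-avoiding permutation is empty or of the form (β , n , γ) with every entry of β above every entry of γ.

  data Tree : Set where
    leaf : Tree
    node : Tree → Tree → Tree

  ⟦_⟧ : Tree → BiOrder
  ⟦ leaf ⟧     = ∅
  ⟦ node β γ ⟧ = (⟦ β ⟧ ⊕ 𝟙) ⊖ ⟦ γ ⟧

  size : Tree → ℕ
  size leaf       = 0
  size (node β γ) = suc (size β + size γ)

  snoc : Tree → Tree
  snoc β = node β leaf

  infixr 6 _⊝_

  -- The skew sum. The right spine of a tree lists its skew summands `β ⊕ 𝟙`, and skew sums
  -- concatenate these lists.
  _⊝_ : Tree → Tree → Tree
  leaf     ⊝ u = u
  node β γ ⊝ u = node β (γ ⊝ u)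

  -- Inversion of a permutation reverses the order of the skew summands and inverts each of them.
  inv : Tree → Tree
  inv leaf       = leaf
  inv (node β γ) = inv γ ⊝ snoc (inv β)

  ⊝-identityʳ : ∀ t → t ⊝ leaf ≡ t
  ⊝-identityʳ leaf       = refl
  ⊝-identityʳ (node β γ) = cong (node β) (⊝-identityʳ γ)

  ⊝-assoc : ∀ t u v → (t ⊝ u) ⊝ v ≡ t ⊝ (u ⊝ v)
  ⊝-assoc leaf       u v = refl
  ⊝-assoc (node β γ) u v = cong (node β) (⊝-assoc γ u v)

  inv-⊝ : ∀ t u → inv (t ⊝ u) ≡ inv u ⊝ inv t
  inv-⊝ leaf       u = sym (⊝-identityʳ (inv u))
  inv-⊝ (node β γ) u = trans (cong (_⊝ snoc (inv β)) (inv-⊝ γ u)) (⊝-assoc (inv u) (inv γ) (snoc (inv β)))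

  inv-involutive : ∀ t → inv (inv t) ≡ t
  inv-involutive leaf       = refl
  inv-involutive (node β γ) = trans (inv-⊝ (inv γ) (snoc (inv β)))
    (cong₂ node (inv-involutive β) (inv-involutive γ))

  ⟦⊝⟧ : ∀ t u → ⟦ t ⊝ u ⟧ ≅ ⟦ t ⟧ ⊖ ⟦ u ⟧
  ⟦⊝⟧ leaf       u = ≅-sym (glue-identityˡ false)
  ⟦⊝⟧ (node β γ) u = ≅-trans (glue-≅ false ≅-refl (⟦⊝⟧ γ u)) (≅-sym (glue-assoc false))

  ⟦snoc⟧ : ∀ t → ⟦ snoc t ⟧ ≅ ⟦ t ⟧ ⊕ 𝟙
  ⟦snoc⟧ t = glue-identityʳ false

  ⟦inv⟧ : ∀ t → ⟦ inv t ⟧ ≅ inverse ⟦ t ⟧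
  ⟦inv⟧ leaf       = ≅-refl
  ⟦inv⟧ (node β γ) =
    ≅-trans (⟦⊝⟧ (inv γ) (snoc (inv β)))
    (≅-trans (glue-≅ false (⟦inv⟧ γ) (≅-trans (⟦snoc⟧ (inv β)) (glue-≅ true (⟦inv⟧ β) ≅-refl)))
    (≅-sym inverse-⊖))

  infix 4 _≼_

  -- A record, so that the two trees can be inferred from the type; they cannot be recovered from
  -- `⟦_⟧`, which computes.
  record _≼_ (ρ t : Tree) : Set where
    constructor embed
    field embedding : ⟦ ρ ⟧ ↪ ⟦ t ⟧

  open _≼_ public

  private
    variable
      A B C ρ t u : Tree

  ≼-trans : A ≼ B → B ≼ C → A ≼ C
  ≼-trans (embed f) (embed g) = embed (g ∘↪ f)

  ≼-inv : ρ ≼ t → inv ρ ≼ inv t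
  ≼-inv {ρ} {t} (embed f) = embed (from (⟦inv⟧ t) ∘↪ ↪-inverse f ∘↪ to (⟦inv⟧ ρ))

  ≼-inv⁻ : inv ρ ≼ inv t → ρ ≼ t
  ≼-inv⁻ {ρ} {t} f = subst₂ _≼_ (inv-involutive ρ) (inv-involutive t) (≼-inv f)

  leaf-≼ : ∀ t → leaf ≼ t
  leaf-≼ t = embed (emb (λ ()) (λ {a} → ⊥-elim a) (λ {a} → ⊥-elim a))

  node-⋠-leaf : ¬ node A B ≼ leaf
  node-⋠-leaf (embed f) = fun f (inj₁ (inj₂ tt))

  ≼-left : A ≼ node A B
  ≼-left = embed (inl↪ false ∘↪ inl↪ true)

  ≼-right : B ≼ node A B
  ≼-right = embed (inr↪ false)

  ≼-⊝ˡ : ∀ t u → t ≼ t ⊝ u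
  ≼-⊝ˡ t u = embed (from (⟦⊝⟧ t u) ∘↪ inl↪ false)

  ≼-⊝ʳ : ∀ t u → u ≼ t ⊝ u
  ≼-⊝ʳ t u = embed (from (⟦⊝⟧ t u) ∘↪ inr↪ false)

  node-≼-node : A ≼ t → B ≼ u → node A B ≼ node t u
  node-≼-node (embed f) (embed g) = embed (glue-↪ false (glue-↪ true f ↪-id) g)

  snoc-≼-⊖⁻ : ∀ A {X Y} → ⟦ snoc A ⟧ ↪ X ⊖ Y → (⟦ snoc A ⟧ ↪ X) ⊎ (⟦ snoc A ⟧ ↪ Y)
  snoc-≼-⊖⁻ A f = map⊎ (_∘↪ to (⟦snoc⟧ A)) (_∘↪ to (⟦snoc⟧ A)) (⊕𝟙-↪-⊖ (f ∘↪ from (⟦snoc⟧ A)))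

  snoc-≼-⊕𝟙⁻ : ∀ A {X} → ⟦ snoc A ⟧ ↪ X ⊕ 𝟙 → ⟦ A ⟧ ↪ X
  snoc-≼-⊕𝟙⁻ A f = ⊕𝟙-↪-⊕𝟙 (f ∘↪ from (⟦snoc⟧ A))

  snoc-≼-node⁻ : snoc A ≼ node t u → A ≼ t ⊎ snoc A ≼ u
  snoc-≼-node⁻ {A} (embed f) = map⊎ (embed ∘ snoc-≼-⊕𝟙⁻ A) embed (snoc-≼-⊖⁻ A f)

  snoc-≼-⊝⁻ : ∀ t u → snoc A ≼ t ⊝ u → snoc A ≼ t ⊎ snoc A ≼ u
  snoc-≼-⊝⁻ {A} t u (embed f) = map⊎ embed embed (snoc-≼-⊖⁻ A (to (⟦⊝⟧ t u) ∘↪ f))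

  snoc-≼-snoc⁻ : snoc A ≼ snoc t → A ≼ t
  snoc-≼-snoc⁻ f with snoc-≼-node⁻ f
  ... | inj₁ g = g
  ... | inj₂ g = ⊥-elim (node-⋠-leaf g)

  ⟦node-snoc⟧ : ∀ A B → ⟦ node A (snoc B) ⟧ ≅ (⟦ A ⟧ ⊕ 𝟙) ⊖ (⟦ B ⟧ ⊕ 𝟙)
  ⟦node-snoc⟧ A B = glue-≅ false ≅-refl (⟦snoc⟧ B)

  node-snoc-≼-⊖⁻ : ∀ A B {X Y} → ⟦ node A (snoc B) ⟧ ↪ X ⊖ Y →
    (⟦ node A (snoc B) ⟧ ↪ X) ⊎ (⟦ node A (snoc B) ⟧ ↪ Y) ⊎ (⟦ snoc A ⟧ ↪ X) × (⟦ snoc B ⟧ ↪ Y)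
  node-snoc-≼-⊖⁻ A B f =
    map⊎ (_∘↪ to (⟦node-snoc⟧ A B)) (map⊎ (_∘↪ to (⟦node-snoc⟧ A B))
      λ (g , h) → g ∘↪ to (⟦snoc⟧ A) , h ∘↪ to (⟦snoc⟧ B))
    (⊖-↪-⊖ (f ∘↪ from (⟦node-snoc⟧ A B)))

  node-snoc-≼-⊕𝟙⁻ : ∀ A B {X} → ⟦ node A (snoc B) ⟧ ↪ X ⊕ 𝟙 → ⟦ node A (snoc B) ⟧ ↪ X
  node-snoc-≼-⊕𝟙⁻ A B f = ⊖-↪-⊕𝟙 (f ∘↪ from (⟦node-snoc⟧ A B)) ∘↪ to (⟦node-snoc⟧ A B)

  -- In the split case `A ⊕ 𝟙` embeds in `t ⊕ 𝟙`; its maximum may take the root of the target, so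
  -- what remains is that `A` fits in `t`.
  node-snoc-≼-node⁻ : node A (snoc B) ≼ node t u →
    node A (snoc B) ≼ t ⊎ node A (snoc B) ≼ u ⊎ A ≼ t × snoc B ≼ u
  node-snoc-≼-node⁻ {A} {B} (embed f) = map⊎ (embed ∘ node-snoc-≼-⊕𝟙⁻ A B)
    (map⊎ embed λ (g , h) → embed (snoc-≼-⊕𝟙⁻ A g) , embed h) (node-snoc-≼-⊖⁻ A B f)

  node-snoc-≼-⊝⁻ : ∀ t u → node A (snoc B) ≼ t ⊝ u →
    node A (snoc B) ≼ t ⊎ node A (snoc B) ≼ u ⊎ snoc A ≼ t × snoc B ≼ u
  node-snoc-≼-⊝⁻ {A} {B} t u (embed f) = map⊎ embed (map⊎ embed λ (g , h) → embed g , embed h)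
    (node-snoc-≼-⊖⁻ A B (to (⟦⊝⟧ t u) ∘↪ f))

  node-snoc-≼-snoc⁻ : node A (snoc B) ≼ snoc t → node A (snoc B) ≼ t
  node-snoc-≼-snoc⁻ f with node-snoc-≼-node⁻ f
  ... | inj₁ g              = g
  ... | inj₂ (inj₁ g)       = ⊥-elim (node-⋠-leaf g)
  ... | inj₂ (inj₂ (_ , g)) = ⊥-elim (node-⋠-leaf g)

  -- The 132-avoiding involution (β , n , δ , β⁻¹ , j), where the layers are shifted suitably.
  wrap : Tree → Tree → Tree
  wrap β δ = node β (δ ⊝ snoc (inv β))

  wrap-≽ : ∀ β δ → δ ≼ wrap β δ
  wrap-≽ β δ = ≼-trans (≼-⊝ˡ δ (snoc (inv β))) ≼-right

  snoc-≼-wrap⁺ : ∀ β δ → A ≼ β → snoc A ≼ wrap β δ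
  snoc-≼-wrap⁺ β δ f = node-≼-node f (leaf-≼ (δ ⊝ snoc (inv β)))

  -- The pattern lies in one of the summands `β ⊕ 𝟙`, `δ` and `inv β ⊕ 𝟙`. As `A` is its own
  -- inverse, the first and the last impose the same condition on `β`.
  snoc-≼-wrap⁻ : ∀ β δ → inv A ≡ A → snoc A ≼ wrap β δ → A ≼ β ⊎ snoc A ≼ δ
  snoc-≼-wrap⁻ β δ A-inv f with snoc-≼-node⁻ f
  ... | inj₁ g = inj₁ g
  ... | inj₂ g with snoc-≼-⊝⁻ δ (snoc (inv β)) g
  ...   | inj₁ h = inj₂ h
  ...   | inj₂ h = inj₁ (≼-inv⁻ (subst (_≼ inv β) (sym A-inv) (snoc-≼-snoc⁻ h)))

  -- One occurrence of `A` in `β` serves twice: its inverse is an occurrence of `inv A` in the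
  -- mirror summand.
  node-snoc-≼-wrap⁺ : ∀ β δ → A ≼ β → node A (snoc (inv A)) ≼ wrap β δ
  node-snoc-≼-wrap⁺ β δ f =
    node-≼-node f (≼-trans (node-≼-node (≼-inv f) (leaf-≼ leaf)) (≼-⊝ʳ δ (snoc (inv β))))

  -- An occurrence that is not inside `δ` places `A` in `β` or `inv A` in `inv β`, and inversion
  -- carries the latter back to `β`.
  node-snoc-≼-wrap⁻ : ∀ β δ → node A (snoc (inv A)) ≼ wrap β δ → A ≼ β ⊎ node A (snoc (inv A)) ≼ δ
  node-snoc-≼-wrap⁻ β δ f with node-snoc-≼-node⁻ f
  ... | inj₁ g              = inj₁ (≼-trans ≼-left g)
  ... | inj₂ (inj₂ (g , _)) = inj₁ g
  ... | inj₂ (inj₁ g) with node-snoc-≼-⊝⁻ δ (snoc (inv β)) g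
  ...   | inj₁ h              = inj₂ h
  ...   | inj₂ (inj₂ (_ , h)) = inj₁ (≼-inv⁻ (snoc-≼-snoc⁻ h))
  ...   | inj₂ (inj₁ h)       = inj₁ (≼-inv⁻ (≼-trans ≼-left (≼-trans ≼-right (node-snoc-≼-snoc⁻ h))))

  inv-wrap : ∀ β δ → inv δ ≡ δ → inv (wrap β δ) ≡ wrap β δ
  inv-wrap β δ δ-inv = trans (cong (_⊝ snoc (inv β)) (inv-⊝ δ (snoc (inv β))))
    (cong₂ (λ b d → node b (d ⊝ snoc (inv β))) (inv-involutive β) δ-inv)

  -- The decomposition at the last skew summand, which inversion exchanges with the first one.
  data Last : Tree → Set where
    empty : Last leaf
    last  : ∀ δ ε → Last (δ ⊝ snoc ε)

  last-view : ∀ t → Last t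
  last-view leaf = empty
  last-view (node β γ) with last-view γ
  ... | empty    = last leaf β
  ... | last δ ε = last (node β δ) ε

  node-injective : ∀ {β γ β′ γ′} → node β γ ≡ node β′ γ′ → β ≡ β′ × γ ≡ γ′
  node-injective refl = refl , refl

  ⊝-snoc-injective : ∀ δ δ′ {ε ε′} → δ ⊝ snoc ε ≡ δ′ ⊝ snoc ε′ → δ ≡ δ′ × ε ≡ ε′
  ⊝-snoc-injective leaf leaf refl = refl , refl
  ⊝-snoc-injective leaf (node _ leaf) ()
  ⊝-snoc-injective leaf (node _ (node _ _)) ()
  ⊝-snoc-injective (node _ leaf) leaf ()
  ⊝-snoc-injective (node _ (node _ _)) leaf ()
  ⊝-snoc-injective (node β δ) (node β′ δ′) eq with node-injective eq
  ... | refl , eq′ with ⊝-snoc-injective δ δ′ eq′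
  ...   | refl , refl = refl , refl

  -- A single skew summand must be inverse to itself. With several, the last is the inverse of the
  -- first, and the middle part is fixed.
  involution-cases : ∀ t → inv t ≡ t →
    t ≡ leaf ⊎ (∃ λ β → t ≡ snoc β × inv β ≡ β) ⊎ (∃ λ β → ∃ λ δ → t ≡ wrap β δ × inv δ ≡ δ)
  involution-cases leaf       _  = inj₁ refl
  involution-cases (node β γ) eq with last-view γ
  ... | empty    = inj₂ (inj₁ (β , refl , proj₁ (node-injective eq)))
  ... | last δ ε = inj₂ (inj₂ (β , δ , cong (λ z → node β (δ ⊝ snoc z)) (sym (proj₂ halves)) , proj₁ halves))
    where
    unfolded : node (inv ε) (inv δ ⊝ snoc (inv β)) ≡ node β (δ ⊝ snoc ε)
    unfolded = trans (cong (_⊝ snoc (inv β)) (sym (inv-⊝ δ (snoc ε)))) eq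
    halves : inv δ ≡ δ × inv β ≡ ε
    halves = ⊝-snoc-injective (inv δ) δ (proj₂ (node-injective unfolded))

  size-⊝ : ∀ t u → size (t ⊝ u) ≡ size t + size u
  size-⊝ leaf       u = refl
  size-⊝ (node β γ) u = cong suc (trans (cong (size β +_) (size-⊝ γ u)) (sym (ℕ.+-assoc (size β) _ _)))

  size-inv : ∀ t → size (inv t) ≡ size t
  size-inv leaf       = refl
  size-inv (node β γ) = trans (size-⊝ (inv γ) (snoc (inv β)))
    (trans (cong₂ _+_ (size-inv γ) (cong suc (trans (ℕ.+-identityʳ _) (size-inv β))))
    (trans (ℕ.+-suc (size γ) (size β)) (cong suc (ℕ.+-comm (size γ) (size β)))))

  Connex : {P : Set} → (P → P → Set) → Set
  Connex {P} R = (p q : P) → R p q ⊎ p ≡ q ⊎ R q p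

  lex-connex : ∀ b {P Q : Set} {R : P → P → Set} {S : Q → Q → Set} → Connex R → Connex S → Connex (lex b R S)
  lex-connex b f g (inj₁ p) (inj₁ q) = map⊎ id (map⊎ (cong inj₁) id) (f p q)
  lex-connex b f g (inj₂ p) (inj₂ q) = map⊎ id (map⊎ (cong inj₂) id) (g p q)
  lex-connex true  f g (inj₁ p) (inj₂ q) = inj₁ tt
  lex-connex false f g (inj₁ p) (inj₂ q) = inj₂ (inj₂ tt)
  lex-connex true  f g (inj₂ p) (inj₁ q) = inj₂ (inj₂ tt)
  lex-connex false f g (inj₂ p) (inj₁ q) = inj₁ tt

  connexᵥ : ∀ t → Connex (_<ᵥ_ ⟦ t ⟧)
  connexᵥ (node β γ) = lex-connex false (lex-connex true (connexᵥ β) λ _ _ → inj₂ (inj₁ refl)) (connexᵥ γ)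

  module Apex (A B : BiOrder) where

    N : BiOrder
    N = (A ⊕ 𝟙) ⊖ B

    apex : Point N
    apex = inj₁ (inj₂ tt)

    apex-max : ∀ u → _<ᵥ_ N u apex ⊎ u ≡ apex
    apex-max (inj₁ (inj₁ _)) = inj₁ tt
    apex-max (inj₁ (inj₂ _)) = inj₂ refl
    apex-max (inj₂ _)        = inj₁ tt

    apex-top : ∀ u → ¬ _<ᵥ_ N apex u
    apex-top (inj₁ (inj₁ _)) ()
    apex-top (inj₁ (inj₂ _)) ()
    apex-top (inj₂ _)        ()

    before-apex : ∀ u → _<ₚ_ N u apex → Σ (Point A) λ x → u ≡ inj₁ (inj₁ x)
    before-apex (inj₁ (inj₁ x)) _ = x , refl

    after-apex : ∀ u → _<ₚ_ N apex u → Σ (Point B) λ x → u ≡ inj₂ x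
    after-apex (inj₁ (inj₁ _)) ()
    after-apex (inj₁ (inj₂ _)) ()
    after-apex (inj₂ x)        _ = x , refl

  -- An isomorphism preserves the greatest value, hence also the points before it and the points
  -- after it. This makes the decomposition of a tree unique.
  module Restrict (A B A′ B′ : BiOrder) (e : (A ⊕ 𝟙) ⊖ B ≅ (A′ ⊕ 𝟙) ⊖ B′) where

    open Apex A B using (N; apex; apex-top)
    open Apex A′ B′ using (apex-max; before-apex; after-apex) renaming (N to N′; apex to apex′)

    apex-↦-apex : fun (to e) apex ≡ apex′
    apex-↦-apex with apex-max (fun (to e) apex)
    ... | inj₂ eq = eq
    ... | inj₁ r  = ⊥-elim (apex-top (fun (from e) apex′)
        (subst (λ u → _<ᵥ_ N u (fun (from e) apex′)) (from-to e apex) (mono-v (from e) r)))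

    on-left : ∀ x → Σ (Point A′) λ y → fun (to e) (inj₁ (inj₁ x)) ≡ inj₁ (inj₁ y)
    on-left x = before-apex _
      (subst (_<ₚ_ N′ (fun (to e) (inj₁ (inj₁ x)))) apex-↦-apex (mono-p (to e) {inj₁ (inj₁ x)} {apex} tt))

    on-right : ∀ x → Σ (Point B′) λ y → fun (to e) (inj₂ x) ≡ inj₂ y
    on-right x = after-apex _
      (subst (λ u → _<ₚ_ N′ u (fun (to e) (inj₂ x))) apex-↦-apex (mono-p (to e) {apex} {inj₂ x} tt))

    restrictˡ : A ↪ A′
    restrictˡ = emb (proj₁ ∘ on-left)
      (λ {a} {b} r → subst₂ (_<ₚ_ N′) (proj₂ (on-left a)) (proj₂ (on-left b)) (mono-p (to e) r))
      (λ {a} {b} r → subst₂ (_<ᵥ_ N′) (proj₂ (on-left a)) (proj₂ (on-left b)) (mono-v (to e) r))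

    restrictʳ : B ↪ B′
    restrictʳ = emb (proj₁ ∘ on-right)
      (λ {a} {b} r → subst₂ (_<ₚ_ N′) (proj₂ (on-right a)) (proj₂ (on-right b)) (mono-p (to e) r))
      (λ {a} {b} r → subst₂ (_<ᵥ_ N′) (proj₂ (on-right a)) (proj₂ (on-right b)) (mono-v (to e) r))

  module _ (A B A′ B′ : BiOrder) (e : (A ⊕ 𝟙) ⊖ B ≅ (A′ ⊕ 𝟙) ⊖ B′) where

    private
      module F = Restrict A B A′ B′ e
      module G = Restrict A′ B′ A B (≅-sym e)

    restrictˡ-inverse : ∀ x → fun G.restrictˡ (fun F.restrictˡ x) ≡ x
    restrictˡ-inverse x = inj₁-injective (inj₁-injective (trans (sym (proj₂ (G.on-left _)))
      (trans (cong (fun (from e)) (sym (proj₂ (F.on-left x)))) (from-to e (inj₁ (inj₁ x))))))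

    restrictʳ-inverse : ∀ x → fun G.restrictʳ (fun F.restrictʳ x) ≡ x
    restrictʳ-inverse x = inj₂-injective (trans (sym (proj₂ (G.on-right _)))
      (trans (cong (fun (from e)) (sym (proj₂ (F.on-right x)))) (from-to e (inj₂ x))))

  module _ (A B A′ B′ : BiOrder) (e : (A ⊕ 𝟙) ⊖ B ≅ (A′ ⊕ 𝟙) ⊖ B′) where

    private
      module F = Restrict A B A′ B′ e
      module G = Restrict A′ B′ A B (≅-sym e)

    restrict-≅ˡ : A ≅ A′
    restrict-≅ˡ = record
      { to = F.restrictˡ ; from = G.restrictˡ
      ; from-to = restrictˡ-inverse A B A′ B′ e ; to-from = restrictˡ-inverse A′ B′ A B (≅-sym e) }

    restrict-≅ʳ : B ≅ B′
    restrict-≅ʳ = record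
      { to = F.restrictʳ ; from = G.restrictʳ
      ; from-to = restrictʳ-inverse A B A′ B′ e ; to-from = restrictʳ-inverse A′ B′ A B (≅-sym e) }

  ≅⇒≡ : ∀ t t′ → ⟦ t ⟧ ≅ ⟦ t′ ⟧ → t ≡ t′
  ≅⇒≡ leaf       leaf         e = refl
  ≅⇒≡ leaf       (node β′ γ′) e = ⊥-elim (fun (from e) (inj₁ (inj₂ tt)))
  ≅⇒≡ (node β γ) leaf         e = ⊥-elim (fun (to e) (inj₁ (inj₂ tt)))
  ≅⇒≡ (node β γ) (node β′ γ′) e = cong₂ node 
    (≅⇒≡ β β′ (restrict-≅ˡ ⟦ β ⟧ ⟦ γ ⟧ ⟦ β′ ⟧ ⟦ γ′ ⟧ e)) (≅⇒≡ γ γ′ (restrict-≅ʳ ⟦ β ⟧ ⟦ γ ⟧ ⟦ β′ ⟧ ⟦ γ′ ⟧ e))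

  record 132-Triple (A : BiOrder) : Set where
    constructor triple
    field
      {a b c} : Point A
      a<ₚb : _<ₚ_ A a b
      b<ₚc : _<ₚ_ A b c
      a<ᵥc : _<ᵥ_ A a c
      c<ᵥb : _<ᵥ_ A c b

  132-map : ∀ {A B} → A ↪ B → 132-Triple A → 132-Triple B
  132-map f (triple p q r s) = triple (mono-p f p) (mono-p f q) (mono-v f r) (mono-v f s)

  132-⊕𝟙 : ∀ {A} → 132-Triple (A ⊕ 𝟙) → 132-Triple A
  132-⊕𝟙 (triple {inj₁ a} {inj₁ b} {inj₁ c} p q r s) = triple p q r s
  132-⊕𝟙 (triple {b = inj₂ tt} {inj₁ c} p () r s)
  132-⊕𝟙 (triple {b = inj₂ tt} {inj₂ tt} p () r s)
  132-⊕𝟙 (triple {b = inj₁ b} {inj₂ tt} p q r ())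
  132-⊕𝟙 (triple {inj₂ tt} {inj₁ b} () q r s)

  132-⊖ : ∀ {A B} → 132-Triple (A ⊖ B) → 132-Triple A ⊎ 132-Triple B
  132-⊖ (triple {inj₁ a} {inj₁ b} {inj₁ c} p q r s) = inj₁ (triple p q r s)
  132-⊖ (triple {inj₂ a} {inj₂ b} {inj₂ c} p q r s) = inj₂ (triple p q r s)
  132-⊖ (triple {inj₁ a} {inj₂ b} {inj₁ c} p () r s)
  132-⊖ (triple {inj₁ a} {_} {inj₂ c} p q () s)
  132-⊖ (triple {inj₂ a} {inj₁ b} () q r s)
  132-⊖ (triple {inj₂ a} {inj₂ b} {inj₁ c} p () r s)

  tree-avoids-132 : ∀ t → ¬ 132-Triple ⟦ t ⟧
  tree-avoids-132 leaf (triple {()} _ _ _ _)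
  tree-avoids-132 (node β γ) x with 132-⊖ x
  ... | inj₁ y = tree-avoids-132 β (132-⊕𝟙 y)
  ... | inj₂ y = tree-avoids-132 γ y

  -- An isomorphism of `R` with the chain of `n` elements. Enumerating one set by position and by
  -- value yields a permutation.
  record Enumeration (n : ℕ) {P : Set} (R : P → P → Set) : Set where
    field
      at         : Fin n → P
      index      : P → Fin n
      at-index   : ∀ p → at (index p) ≡ p
      index-at   : ∀ i → index (at i) ≡ i
      at-mono    : ∀ {i j} → i Fin.< j → R (at i) (at j)
      index-mono : ∀ {p q} → R p q → index p Fin.< index q

  open Enumeration public

  module _ {m n : ℕ} {P Q : Set} {R : P → P → Set} {S : Q → Q → Set}
           (d : Enumeration m R) (e : Enumeration n S) where

    private
      ↑ : P ⊎ Q → Fin m ⊎ Fin n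
      ↑ = map⊎ (index d) (index e)
      ↓ : Fin m ⊎ Fin n → P ⊎ Q
      ↓ = map⊎ (at d) (at e)

      join-mono : ∀ u v → lex true R S u v → join m n (↑ u) Fin.< join m n (↑ v)
      join-mono (inj₁ p) (inj₁ q) r = subst₂ ℕ._<_ (sym (Fin.toℕ-↑ˡ _ n)) (sym (Fin.toℕ-↑ˡ _ n)) (index-mono d r)
      join-mono (inj₁ p) (inj₂ q) r = subst₂ ℕ._<_ (sym (Fin.toℕ-↑ˡ _ n)) (sym (Fin.toℕ-↑ʳ m _))
        (ℕ.≤-trans (Fin.toℕ<n (index d p)) (ℕ.m≤m+n m _))
      join-mono (inj₂ p) (inj₂ q) r = subst₂ ℕ._<_ (sym (Fin.toℕ-↑ʳ m _)) (sym (Fin.toℕ-↑ʳ m _))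
        (ℕ.+-monoʳ-< m (index-mono e r))

      lex-mono : ∀ u v → join m n u Fin.< join m n v → lex true R S (↓ u) (↓ v)
      lex-mono (inj₁ i) (inj₁ j) r = at-mono d (subst₂ ℕ._<_ (Fin.toℕ-↑ˡ i n) (Fin.toℕ-↑ˡ j n) r)
      lex-mono (inj₁ i) (inj₂ j) r = tt
      lex-mono (inj₂ i) (inj₁ j) r = ℕ.<-irrefl refl (ℕ.<-trans (ℕ.≤-<-trans (ℕ.m≤m+n m (toℕ i))
        (subst₂ ℕ._<_ (Fin.toℕ-↑ʳ m i) (Fin.toℕ-↑ˡ j n) r)) (Fin.toℕ<n j))
      lex-mono (inj₂ i) (inj₂ j) r = at-mono e (ℕ.+-cancelˡ-< m _ _ (subst₂ ℕ._<_ (Fin.toℕ-↑ʳ m i) (Fin.toℕ-↑ʳ m j) r))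

      ↓-↑ : ∀ u → ↓ (↑ u) ≡ u
      ↓-↑ (inj₁ p) = cong inj₁ (at-index d p)
      ↓-↑ (inj₂ q) = cong inj₂ (at-index e q)

      ↑-↓ : ∀ u → ↑ (↓ u) ≡ u
      ↑-↓ (inj₁ p) = cong inj₁ (index-at d p)
      ↑-↓ (inj₂ q) = cong inj₂ (index-at e q)

    lex-enumeration : Enumeration (m + n) (lex true R S)
    lex-enumeration = record
      { at         = ↓ ∘ splitAt m
      ; index      = join m n ∘ ↑
      ; at-index   = λ u → trans (cong ↓ (Fin.splitAt-join m n (↑ u))) (↓-↑ u)
      ; index-at   = λ i → trans (cong (join m n) (↑-↓ (splitAt m i))) (Fin.join-splitAt m n i)
      ; at-mono    = λ {i} {j} i<j → lex-mono (splitAt m i) (splitAt m j)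
          (subst₂ Fin._<_ (sym (Fin.join-splitAt m n i)) (sym (Fin.join-splitAt m n j)) i<j)
      ; index-mono = λ {u} {v} → join-mono u v
      }

  swap-enumeration : ∀ {n} {P Q : Set} {R : P → P → Set} {S : Q → Q → Set} →
                     Enumeration n (lex true S R) → Enumeration n (lex false R S)
  swap-enumeration {R = R} {S} e = record
    { at         = swap ∘ at e
    ; index      = index e ∘ swap
    ; at-index   = λ u → trans (cong swap (at-index e (swap u))) (swap-involutive u)
    ; index-at   = λ i → trans (cong (index e) (swap-involutive (at e i))) (index-at e i)
    ; at-mono    = λ {i} {j} i<j → lex-swap true (at e i) (at e j) (at-mono e i<j)
    ; index-mono = λ {u} {v} r → index-mono e (lex-swap false u v r)
    }

  enumeration-∅ : Enumeration 0 (_<ₚ_ ∅)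
  enumeration-∅ = record
    { at = λ () ; index = λ () ; at-index = λ () ; index-at = λ ()
    ; at-mono = λ { {()} } ; index-mono = λ () }

  enumeration-𝟙 : Enumeration 1 (_<ₚ_ 𝟙)
  enumeration-𝟙 = record
    { at = λ _ → tt ; index = λ _ → zero ; at-index = λ _ → refl ; index-at = λ { zero → refl }
    ; at-mono = λ { {zero} {zero} () } ; index-mono = λ () }

  enumerateₚ : ∀ t → Enumeration (size t) (_<ₚ_ ⟦ t ⟧)
  enumerateₚ leaf       = enumeration-∅
  enumerateₚ (node β γ) = subst (λ k → Enumeration k (_<ₚ_ ⟦ node β γ ⟧))
    (cong (_+ size γ) (ℕ.+-comm (size β) 1))
    (lex-enumeration (lex-enumeration (enumerateₚ β) enumeration-𝟙) (enumerateₚ γ))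

  enumerateᵥ : ∀ t → Enumeration (size t) (_<ᵥ_ ⟦ t ⟧)
  enumerateᵥ leaf       = enumeration-∅
  enumerateᵥ (node β γ) = subst (λ k → Enumeration k (_<ᵥ_ ⟦ node β γ ⟧))
    (trans (ℕ.+-comm (size γ) (size β + 1)) (cong (_+ size γ) (ℕ.+-comm (size β) 1)))
    (swap-enumeration (lex-enumeration (enumerateᵥ γ) (lex-enumeration (enumerateᵥ β) enumeration-𝟙)))

open Trees

-- Passing between permutations, one-line notation and trees.

module Permutations where
  private
    variable
      n : ℕ

  ofPerm : Permutation′ n → BiOrder
  ofPerm {n} π = record
    { Point = Fin n ; _<ₚ_ = Fin._<_ ; _<ᵥ_ = λ i j → (π ⟨$⟩ʳ i) Fin.< (π ⟨$⟩ʳ j) }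

  ofPerm-flip : (π : Permutation′ n) → ofPerm (flip π) ≅ inverse (ofPerm π)
  ofPerm-flip π = record
    { to      = emb (π ⟨$⟩ˡ_) (subst₂ Fin._<_ (sym (inverseʳ π)) (sym (inverseʳ π))) id
    ; from    = emb (π ⟨$⟩ʳ_) id (subst₂ Fin._<_ (sym (inverseˡ π)) (sym (inverseˡ π)))
    ; from-to = λ _ → inverseʳ π
    ; to-from = λ _ → inverseˡ π
    }

  monotone-inflationary : (f : Fin n → Fin n) → (∀ {i j} → i Fin.< j → f i Fin.< f j) → ∀ i → toℕ i ℕ.≤ toℕ (f i)
  monotone-inflationary f mono i = go (toℕ i) i refl
    where
    go : ∀ k i → toℕ i ≡ k → k ℕ.≤ toℕ (f i)
    go zero    i       eq = z≤n
    go (suc k) (suc i) eq = ℕ.≤-<-trans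
      (go k (inject₁ i) (trans (Fin.toℕ-inject₁ i) (ℕ.suc-injective eq)))
      (mono (s≤s (ℕ.≤-reflexive (Fin.toℕ-inject₁ i))))

  -- An increasing self-map of a finite chain never goes below the identity; applied to `f` and to
  -- its inverse, this leaves only equality.
  monotone-inverse⇒id : (f g : Fin n → Fin n) →
    (∀ {i j} → i Fin.< j → f i Fin.< f j) → (∀ {i j} → i Fin.< j → g i Fin.< g j) →
    (∀ i → g (f i) ≡ i) → ∀ i → f i ≡ i
  monotone-inverse⇒id f g f-mono g-mono gf i = Fin.toℕ-injective (ℕ.≤-antisym
    (subst (λ j → toℕ (f i) ℕ.≤ toℕ j) (gf i) (monotone-inflationary g g-mono (f i)))
    (monotone-inflationary f f-mono i))

  -- Rigidity of finite chains is used twice: on positions it makes the isomorphism the identity,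
  -- and on values it then makes `ρ` after the inverse of `π` the identity.
  ofPerm-injective : (π ρ : Permutation′ n) → ofPerm π ≅ ofPerm ρ → π ≈ ρ
  ofPerm-injective π ρ e i = begin
    π ⟨$⟩ʳ i                     ≡⟨ h-id (π ⟨$⟩ʳ i) ⟨
    ρ ⟨$⟩ʳ (π ⟨$⟩ˡ (π ⟨$⟩ʳ i))   ≡⟨ cong (ρ ⟨$⟩ʳ_) (inverseˡ π) ⟩
    ρ ⟨$⟩ʳ i                     ∎
    where
    open ≡-Reasoning
    to-id : ∀ i → fun (to e) i ≡ i
    to-id = monotone-inverse⇒id (fun (to e)) (fun (from e)) (mono-p (to e)) (mono-p (from e)) (from-to e)
    from-id : ∀ i → fun (from e) i ≡ i
    from-id i = trans (cong (fun (from e)) (sym (to-id i))) (from-to e i)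
    h-id : ∀ i → ρ ⟨$⟩ʳ (π ⟨$⟩ˡ i) ≡ i
    h-id = monotone-inverse⇒id (λ i → ρ ⟨$⟩ʳ (π ⟨$⟩ˡ i)) (λ i → π ⟨$⟩ʳ (ρ ⟨$⟩ˡ i))
      (λ i<j → subst₂ (λ a b → (ρ ⟨$⟩ʳ a) Fin.< (ρ ⟨$⟩ʳ b)) (to-id _) (to-id _)
        (mono-v (to e) (subst₂ Fin._<_ (sym (inverseʳ π)) (sym (inverseʳ π)) i<j)))
      (λ i<j → subst₂ (λ a b → (π ⟨$⟩ʳ a) Fin.< (π ⟨$⟩ʳ b)) (from-id _) (from-id _)
        (mono-v (from e) (subst₂ Fin._<_ (sym (inverseʳ ρ)) (sym (inverseʳ ρ)) i<j)))
      (λ i → trans (cong (π ⟨$⟩ʳ_) (inverseˡ ρ)) (inverseʳ π))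

  opaque
    realize : ∀ t → Σ (Permutation′ (size t)) λ π → ofPerm π ≅ ⟦ t ⟧
    realize t = π , record
      { to      = emb (at p) (at-mono p)
          (λ {i} {j} r → subst₂ (_<ᵥ_ ⟦ t ⟧) (at-index v (at p i)) (at-index v (at p j)) (at-mono v r))
      ; from    = emb (index p) (index-mono p)
          (λ {x} {y} r → subst₂ (λ a b → index v a Fin.< index v b)
            (sym (at-index p x)) (sym (at-index p y)) (index-mono v r))
      ; from-to = index-at p
      ; to-from = at-index p
      }
      where
      p : Enumeration (size t) (_<ₚ_ ⟦ t ⟧)
      p = enumerateₚ t
      v : Enumeration (size t) (_<ᵥ_ ⟦ t ⟧)
      v = enumerateᵥ t
      π : Permutation′ (size t)
      π = permutation (λ i → index v (at p i)) (λ j → index p (at v j))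
        (λ j → trans (cong (index v) (at-index p (at v j))) (index-at v j))
        (λ i → trans (cong (index p) (at-index v (at p i))) (index-at p i))

  size-≅ : (π : Permutation′ n) (t : Tree) → ofPerm π ≅ ⟦ t ⟧ → n ≡ size t
  size-≅ π t e = Perm.↔⇒≡ (permutation (index (enumerateₚ t) ∘ fun (to e)) (fun (from e) ∘ at (enumerateₚ t))
    (λ i → trans (cong (index (enumerateₚ t)) (to-from e _)) (index-at (enumerateₚ t) i))
    (λ i → trans (cong (fun (from e)) (at-index (enumerateₚ t) _)) (from-to e i)))

  ofList : List ℕ → BiOrder
  ofList xs = record
    { Point = Fin (length xs) ; _<ₚ_ = Fin._<_ ; _<ᵥ_ = λ i j → lookup xs i ℕ.< lookup xs j }

  ofPerm≅ofList : (π : Permutation′ n) (f : Fin n → ℕ) →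
    (∀ {i j} → (π ⟨$⟩ʳ i) Fin.< (π ⟨$⟩ʳ j) → f i ℕ.< f j) →
    (∀ {i j} → f i ℕ.< f j → (π ⟨$⟩ʳ i) Fin.< (π ⟨$⟩ʳ j)) →
    ofPerm π ≅ ofList (tabulate f)
  ofPerm≅ofList π f mono mono⁻ = record
    { to      = emb forth (λ {i} {j} → subst₂ ℕ._<_ (sym (Fin.toℕ-cast (sym len) i)) (sym (Fin.toℕ-cast (sym len) j)))
        (λ {i} {j} r → subst₂ ℕ._<_ (sym (lookup-tabulate f i)) (sym (lookup-tabulate f j)) (mono r))
    ; from    = emb back (λ {i} {j} → subst₂ ℕ._<_ (sym (Fin.toℕ-cast len i)) (sym (Fin.toℕ-cast len j)))
        (λ {i} {j} r → mono⁻ (subst₂ ℕ._<_ (lookup-back i) (lookup-back j) r))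
    ; from-to = Fin.cast-involutive len (sym len)
    ; to-from = forth-back
    }
    where
    len = length-tabulate f
    forth = Fin.cast (sym len)
    back = Fin.cast len
    forth-back : ∀ i → forth (back i) ≡ i
    forth-back = Fin.cast-involutive (sym len) len
    lookup-back : ∀ i → lookup (tabulate f) i ≡ f (back i)
    lookup-back i = trans (cong (lookup (tabulate f)) (sym (forth-back i))) (lookup-tabulate f (back i))

  ofPerm≅ofList-oneLine : (π : Permutation′ n) → ofPerm π ≅ ofList (oneLine π)
  ofPerm≅ofList-oneLine π = ofPerm≅ofList π _ s≤s ℕ.s≤s⁻¹

  inˡ++ : ∀ (xs ys : List ℕ) → Fin (length xs) → Fin (length (xs ++ ys))
  inˡ++ (x ∷ xs) ys zero    = zero
  inˡ++ (x ∷ xs) ys (suc i) = suc (inˡ++ xs ys i)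

  inʳ++ : ∀ (xs ys : List ℕ) → Fin (length ys) → Fin (length (xs ++ ys))
  inʳ++ []       ys i = i
  inʳ++ (x ∷ xs) ys i = suc (inʳ++ xs ys i)

  in++ : ∀ (xs ys : List ℕ) → Fin (length xs) ⊎ Fin (length ys) → Fin (length (xs ++ ys))
  in++ xs ys = [ inˡ++ xs ys , inʳ++ xs ys ]′

  split++ : ∀ (xs ys : List ℕ) → Fin (length (xs ++ ys)) → Fin (length xs) ⊎ Fin (length ys)
  split++ []       ys i       = inj₂ i
  split++ (x ∷ xs) ys zero    = inj₁ zero
  split++ (x ∷ xs) ys (suc i) = map⊎ suc id (split++ xs ys i)

  split-in++ : ∀ (xs ys : List ℕ) u → split++ xs ys (in++ xs ys u) ≡ u
  split-in++ (x ∷ xs) ys (inj₁ zero)    = refl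
  split-in++ (x ∷ xs) ys (inj₁ (suc i)) = cong (map⊎ suc id) (split-in++ xs ys (inj₁ i))
  split-in++ []       ys (inj₂ j)       = refl
  split-in++ (x ∷ xs) ys (inj₂ j)       = cong (map⊎ suc id) (split-in++ xs ys (inj₂ j))

  in-split++ : ∀ (xs ys : List ℕ) i → in++ xs ys (split++ xs ys i) ≡ i
  in-split++ []       ys i       = refl
  in-split++ (x ∷ xs) ys zero    = refl
  in-split++ (x ∷ xs) ys (suc i) with split++ xs ys i | in-split++ xs ys i
  ... | inj₁ j | eq = cong suc eq
  ... | inj₂ j | eq = cong suc eq

  in++-mono : ∀ (xs ys : List ℕ) u v → lex true Fin._<_ Fin._<_ u v → in++ xs ys u Fin.< in++ xs ys v
  in++-mono (x ∷ xs) ys (inj₁ zero)    (inj₁ (suc j)) r       = s≤s z≤n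
  in++-mono (x ∷ xs) ys (inj₁ (suc i)) (inj₁ (suc j)) (s≤s r) = s≤s (in++-mono xs ys (inj₁ i) (inj₁ j) r)
  in++-mono (x ∷ xs) ys (inj₁ zero)    (inj₂ j)       r       = s≤s z≤n
  in++-mono (x ∷ xs) ys (inj₁ (suc i)) (inj₂ j)       r       = s≤s (in++-mono xs ys (inj₁ i) (inj₂ j) r)
  in++-mono []       ys (inj₂ i)       (inj₂ j)       r       = r
  in++-mono (x ∷ xs) ys (inj₂ i)       (inj₂ j)       r       = s≤s (in++-mono xs ys (inj₂ i) (inj₂ j) r)

  split++-mono : ∀ (xs ys : List ℕ) i j → i Fin.< j → lex true Fin._<_ Fin._<_ (split++ xs ys i) (split++ xs ys j)
  split++-mono []       ys i       j       r       = r
  split++-mono (x ∷ xs) ys zero    (suc j) r       with split++ xs ys j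
  ... | inj₁ _ = s≤s z≤n
  ... | inj₂ _ = tt
  split++-mono (x ∷ xs) ys (suc i) (suc j) (s≤s r) with split++ xs ys i | split++ xs ys j | split++-mono xs ys i j r
  ... | inj₁ _ | inj₁ _ | q = s≤s q
  ... | inj₁ _ | inj₂ _ | q = q
  ... | inj₂ _ | inj₂ _ | q = q

  lookup-in++ˡ : ∀ xs ys i → lookup (xs ++ ys) (inˡ++ xs ys i) ≡ lookup xs i
  lookup-in++ˡ (x ∷ xs) ys zero    = refl
  lookup-in++ˡ (x ∷ xs) ys (suc i) = lookup-in++ˡ xs ys i

  lookup-in++ʳ : ∀ xs ys i → lookup (xs ++ ys) (inʳ++ xs ys i) ≡ lookup ys i
  lookup-in++ʳ []       ys i = refl
  lookup-in++ʳ (x ∷ xs) ys i = lookup-in++ʳ xs ys i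

  infix 4 _≪_

  _≪_ : List ℕ → List ℕ → Set
  xs ≪ ys = ∀ {x y} → x ∈ xs → y ∈ ys → x ℕ.< y

  module _ (b : Bool) (xs ys : List ℕ)
           (cross : ∀ i j → T b × lookup xs i ℕ.< lookup ys j ⊎ T (not b) × lookup ys j ℕ.< lookup xs i) where

    private
      values : Fin (length xs) ⊎ Fin (length ys) → ℕ
      values = [ lookup xs , lookup ys ]′

      lookup-in++ : ∀ u → lookup (xs ++ ys) (in++ xs ys u) ≡ values u
      lookup-in++ (inj₁ i) = lookup-in++ˡ xs ys i
      lookup-in++ (inj₂ j) = lookup-in++ʳ xs ys j

      lookup-split++ : ∀ i → lookup (xs ++ ys) i ≡ values (split++ xs ys i)
      lookup-split++ i = trans (cong (lookup (xs ++ ys)) (sym (in-split++ xs ys i))) (lookup-in++ (split++ xs ys i))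

      Lex : Fin (length xs) ⊎ Fin (length ys) → Fin (length xs) ⊎ Fin (length ys) → Set
      Lex = lex b (_<ᵥ_ (ofList xs)) (_<ᵥ_ (ofList ys))

      T-contradiction : ∀ {b} → T b → ¬ T (not b)
      T-contradiction {true} _ ()

      values⇒lex : ∀ u v → values u ℕ.< values v → Lex u v
      values⇒lex (inj₁ i) (inj₁ j) r = r
      values⇒lex (inj₂ i) (inj₂ j) r = r
      values⇒lex (inj₁ i) (inj₂ j) r with cross i j
      ... | inj₁ (p , _) = p
      ... | inj₂ (_ , q) = ⊥-elim (ℕ.<-asym q r)
      values⇒lex (inj₂ j) (inj₁ i) r with cross i j
      ... | inj₁ (_ , q) = ⊥-elim (ℕ.<-asym q r)
      ... | inj₂ (p , _) = p

      lex⇒values : ∀ u v → Lex u v → values u ℕ.< values v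
      lex⇒values (inj₁ i) (inj₁ j) r = r
      lex⇒values (inj₂ i) (inj₂ j) r = r
      lex⇒values (inj₁ i) (inj₂ j) r with cross i j
      ... | inj₁ (_ , q) = q
      ... | inj₂ (p , _) = ⊥-elim (T-contradiction {b} r p)
      lex⇒values (inj₂ j) (inj₁ i) r with cross i j
      ... | inj₁ (p , _) = ⊥-elim (T-contradiction {b} p r)
      ... | inj₂ (_ , q) = q

    ofList-++ : ofList (xs ++ ys) ≅ glue b (ofList xs) (ofList ys)
    ofList-++ = record
      { to      = emb (split++ xs ys) (λ {i} {j} → split++-mono xs ys i j)
          (λ {i} {j} r → values⇒lex (split++ xs ys i) (split++ xs ys j) (subst₂ ℕ._<_ (lookup-split++ i) (lookup-split++ j) r))
      ; from    = emb (in++ xs ys) (λ {u} {v} → in++-mono xs ys u v)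
          (λ {u} {v} r → subst₂ ℕ._<_ (sym (lookup-in++ u)) (sym (lookup-in++ v)) (lex⇒values u v r))
      ; from-to = in-split++ xs ys
      ; to-from = split-in++ xs ys
      }

  ofList-++-⊕ : ∀ xs ys → xs ≪ ys → ofList (xs ++ ys) ≅ ofList xs ⊕ ofList ys
  ofList-++-⊕ xs ys p = ofList-++ true xs ys λ i j → inj₁ (tt , p (∈-lookup i) (∈-lookup j))

  ofList-++-⊖ : ∀ xs ys → ys ≪ xs → ofList (xs ++ ys) ≅ ofList xs ⊖ ofList ys
  ofList-++-⊖ xs ys p = ofList-++ false xs ys λ i j → inj₂ (tt , p (∈-lookup j) (∈-lookup i))

  ofList-[x] : ∀ x → ofList [ x ] ≅ 𝟙
  ofList-[x] x = record
    { to      = emb (λ _ → tt) (λ { {zero} {zero} () }) (λ { {zero} {zero} r → ℕ.<-irrefl refl r })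
    ; from    = emb (λ _ → zero) (λ ()) (λ ())
    ; from-to = λ { zero → refl }
    ; to-from = λ _ → refl
    }

  ofList-snoc : ∀ {t} xs m → xs ≪ [ m ] → ofList xs ≅ ⟦ t ⟧ → ofList (xs ++ [ m ]) ≅ ⟦ t ⟧ ⊕ 𝟙
  ofList-snoc xs m p e = ≅-trans (ofList-++-⊕ xs [ m ] p) (glue-≅ true e (ofList-[x] m))

  ofList-node : ∀ {β γ} ys m zs → ys ≪ [ m ] → zs ≪ ys → zs ≪ [ m ] →
    ofList ys ≅ ⟦ β ⟧ → ofList zs ≅ ⟦ γ ⟧ → ofList ((ys ++ [ m ]) ++ zs) ≅ ⟦ node β γ ⟧
  ofList-node {β} ys m zs p q r d e = ≅-trans
    (ofList-++-⊖ (ys ++ [ m ]) zs zs≪)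
    (glue-≅ false (ofList-snoc {β} ys m p d) e)
    where
    zs≪ : zs ≪ ys ++ [ m ]
    zs≪ z∈ x∈ = [ q z∈ , r z∈ ]′ (∈-++⁻ ys x∈)

  Contains⇒↪ : ∀ {ρ} {α : Permutation′ n} → Contains ρ α → ofList ρ ↪ ofPerm α
  Contains⇒↪ (is , pos , val) = emb (Vec.lookup is) (pos _ _) (Equivalence.to (val _ _))

  -- `Occurrence` asks for an equivalence of value comparisons. Its backward half follows because
  -- any two values of the pattern are comparable.
  ↪⇒Contains : ∀ ρ {α : Permutation′ n} → Connex (_<ᵥ_ (ofList ρ)) → ofList ρ ↪ ofPerm α → Contains ρ α
  ↪⇒Contains ρ {α} connex f = Vec.tabulate (fun f)
    , (λ a b a<b → subst₂ Fin._<_ (sym (lookup∘tabulate (fun f) a)) (sym (lookup∘tabulate (fun f) b)) (mono-p f a<b))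
    , λ a b → mk⇔
        (λ r → subst₂ (_<ᵥ_ (ofPerm α)) (sym (lookup∘tabulate (fun f) a)) (sym (lookup∘tabulate (fun f) b)) (mono-v f r))
        (λ r → reflect a b (subst₂ (_<ᵥ_ (ofPerm α)) (lookup∘tabulate (fun f) a) (lookup∘tabulate (fun f) b) r))
    where
    reflect : ∀ a b → _<ᵥ_ (ofPerm α) (fun f a) (fun f b) → lookup ρ a ℕ.< lookup ρ b
    reflect a b r with connex a b
    ... | inj₁ a<b         = a<b
    ... | inj₂ (inj₁ refl) = ⊥-elim (ℕ.<-irrefl refl r)
    ... | inj₂ (inj₂ b<a)  = ⊥-elim (ℕ.<-asym r (mono-v f b<a))

  ofList-connex : ∀ {ρ t} → ofList ρ ≅ ⟦ t ⟧ → Connex (_<ᵥ_ (ofList ρ))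
  ofList-connex {ρ} {t} e a b with connexᵥ t (fun (to e) a) (fun (to e) b)
  ... | inj₁ r         = inj₁ (subst₂ (_<ᵥ_ (ofList ρ)) (from-to e a) (from-to e b) (mono-v (from e) r))
  ... | inj₂ (inj₁ eq) = inj₂ (inj₁ (trans (sym (from-to e a)) (trans (cong (fun (from e)) eq) (from-to e b))))
  ... | inj₂ (inj₂ r)  = inj₂ (inj₂ (subst₂ (_<ᵥ_ (ofList ρ)) (from-to e b) (from-to e a) (mono-v (from e) r)))

  Contains⇒≼ : ∀ {ρ r t} {α : Permutation′ n} → ofList ρ ≅ ⟦ r ⟧ → ofPerm α ≅ ⟦ t ⟧ → Contains ρ α → r ≼ t
  Contains⇒≼ {ρ = ρ} {α = α} d e c = embed (to e ∘↪ Contains⇒↪ {ρ = ρ} {α} c ∘↪ from d)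

  ≼⇒Contains : ∀ {ρ r t} {α : Permutation′ n} → ofList ρ ≅ ⟦ r ⟧ → ofPerm α ≅ ⟦ t ⟧ → r ≼ t → Contains ρ α
  ≼⇒Contains {ρ = ρ} {r} {α = α} d e (embed f) = ↪⇒Contains ρ {α} (ofList-connex {ρ} {r} d) (from e ∘↪ f ∘↪ to d)

  Contains-132⇒triple : (α : Permutation′ n) → Contains p132 α → 132-Triple (ofPerm α)
  Contains-132⇒triple α c = 132-map (Contains⇒↪ {ρ = p132} {α} c)
    (triple {a = zero} {suc zero} {suc (suc zero)} (s≤s z≤n) (s≤s (s≤s z≤n)) (s≤s (s≤s z≤n)) (s≤s (s≤s (s≤s z≤n))))

  triple⇒Contains-132 : (α : Permutation′ n) → 132-Triple (ofPerm α) → Contains p132 α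
  triple⇒Contains-132 α (triple {a} {b} {c} p q r s) = ↪⇒Contains p132 {α} connex (emb g
    (λ { {zero} {zero} () ; {zero} {suc zero} _ → p ; {zero} {suc (suc zero)} _ → Fin.<-trans p q
       ; {suc zero} {zero} () ; {suc zero} {suc zero} (s≤s ()) ; {suc zero} {suc (suc zero)} _ → q
       ; {suc (suc zero)} {zero} () ; {suc (suc zero)} {suc zero} (s≤s ())
       ; {suc (suc zero)} {suc (suc zero)} (s≤s (s≤s ())) })
    (λ { {zero} {zero} (s≤s ()) ; {zero} {suc zero} _ → ℕ.<-trans r s ; {zero} {suc (suc zero)} _ → r
       ; {suc zero} {zero} (s≤s ()) ; {suc zero} {suc zero} (s≤s (s≤s (s≤s ()))) ; {suc zero} {suc (suc zero)} (s≤s (s≤s ()))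
       ; {suc (suc zero)} {zero} (s≤s ()) ; {suc (suc zero)} {suc zero} _ → s
       ; {suc (suc zero)} {suc (suc zero)} (s≤s (s≤s ())) }))
    where
    g : Fin 3 → Fin _
    g zero             = a
    g (suc zero)       = b
    g (suc (suc zero)) = c
    connex : Connex (_<ᵥ_ (ofList p132))
    connex zero             zero             = inj₂ (inj₁ refl)
    connex zero             (suc zero)       = inj₁ (s≤s (s≤s z≤n))
    connex zero             (suc (suc zero)) = inj₁ (s≤s (s≤s z≤n))
    connex (suc zero)       zero             = inj₂ (inj₂ (s≤s (s≤s z≤n)))
    connex (suc zero)       (suc zero)       = inj₂ (inj₁ refl)
    connex (suc zero)       (suc (suc zero)) = inj₂ (inj₂ (s≤s (s≤s (s≤s z≤n))))
    connex (suc (suc zero)) zero             = inj₂ (inj₂ (s≤s (s≤s z≤n)))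
    connex (suc (suc zero)) (suc zero)       = inj₁ (s≤s (s≤s (s≤s z≤n)))
    connex (suc (suc zero)) (suc (suc zero)) = inj₂ (inj₁ refl)

  record MaxSplit (xs : List ℕ) : Set where
    constructor maxSplit
    field
      before after : List ℕ
      max : ℕ
      split-eq : xs ≡ (before ++ [ max ]) ++ after
      before< : before ≪ [ max ]
      after< : after ≪ [ max ]

  max-split : ∀ x xs → Unique (x ∷ xs) → MaxSplit (x ∷ xs)
  max-split x []        _ = maxSplit [] [] x refl (λ ()) (λ ())
  max-split x (y ∷ xs) (x≢ ∷ u) with max-split y xs u
  ... | maxSplit ys zs m eq ys< zs< with ℕ.<-cmp x m
  ...   | tri< x<m _ _ = maxSplit (x ∷ ys) zs m (cong (x ∷_) eq)
            (λ { (here refl) (here refl) → x<m ; (there p) q → ys< p q }) zs<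
  ...   | tri≈ _ refl _ = ⊥-elim (All.lookup x≢ (subst (x ∈_) (sym eq) (∈-++⁺ˡ (∈-++⁺ʳ ys (here refl)))) refl)
  ...   | tri> _ _ m<x = maxSplit [] (y ∷ xs) x refl (λ ())
            (λ { p (here refl) → rest (subst (_ ∈_) eq p) })
    where
    rest : ∀ {z} → z ∈ (ys ++ [ m ]) ++ zs → z ℕ.< x
    rest p with ∈-++⁻ (ys ++ [ m ]) p
    ... | inj₂ q = ℕ.<-trans (zs< q (here refl)) m<x
    ... | inj₁ q with ∈-++⁻ ys q
    ...   | inj₁ q′          = ℕ.<-trans (ys< q′ (here refl)) m<x
    ...   | inj₂ (here refl) = m<x

  ∈⇒index : ∀ {x : ℕ} {xs} → x ∈ xs → Σ (Fin (length xs)) λ i → lookup xs i ≡ x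
  ∈⇒index (here refl) = zero , refl
  ∈⇒index (there p) with ∈⇒index p
  ... | i , eq = suc i , eq

  ofList-inˡ : ∀ xs ys → ofList xs ↪ ofList (xs ++ ys)
  ofList-inˡ xs ys = emb (inˡ++ xs ys) (λ {i} {j} → in++-mono xs ys (inj₁ i) (inj₁ j))
    (subst₂ ℕ._<_ (sym (lookup-in++ˡ xs ys _)) (sym (lookup-in++ˡ xs ys _)))

  ofList-inʳ : ∀ xs ys → ofList ys ↪ ofList (xs ++ ys)
  ofList-inʳ xs ys = emb (inʳ++ xs ys) (λ {i} {j} → in++-mono xs ys (inj₂ i) (inj₂ j))
    (subst₂ ℕ._<_ (sym (lookup-in++ʳ xs ys _)) (sym (lookup-in++ʳ xs ys _)))

  AllPairs-++⁻ : ∀ {A : Set} {R : A → A → Set} xs {ys} → AllPairs R (xs ++ ys) →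
                 AllPairs R xs × AllPairs R ys × (∀ {x y} → x ∈ xs → y ∈ ys → R x y)
  AllPairs-++⁻ []       u        = [] , u , λ ()
  AllPairs-++⁻ (x ∷ xs) (x≢ ∷ u) with AllPairs-++⁻ xs u
  ... | uxs , uys , cross = (All.tabulate (λ p → All.lookup x≢ (∈-++⁺ˡ p)) ∷ uxs) , uys ,
    λ { (here refl) q → All.lookup x≢ (∈-++⁺ʳ xs q) ; (there p) q → cross p q }

  -- An increasing pair y < z on the two sides of the maximum m would make y m z a 132.
  below-max : ∀ ys m zs → Unique ((ys ++ [ m ]) ++ zs) → ys ≪ [ m ] → zs ≪ [ m ] →
    ¬ 132-Triple (ofList ((ys ++ [ m ]) ++ zs)) → zs ≪ ys
  below-max ys m zs u ys< zs< avoids {z} {y} z∈ y∈ with ℕ.<-cmp z y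
  ... | tri< z<y _ _  = z<y
  ... | tri≈ _ refl _ = ⊥-elim (proj₂ (proj₂ (AllPairs-++⁻ (ys ++ [ m ]) u)) (∈-++⁺ˡ y∈) z∈ refl)
  ... | tri> _ _ y<z with ∈⇒index y∈ | ∈⇒index z∈
  ...   | i , refl | k , refl = ⊥-elim (avoids (triple
            {a = inˡ++ ym zs (inˡ++ ys [ m ] i)} {inˡ++ ym zs (inʳ++ ys [ m ] zero)} {inʳ++ ym zs k}
            (in++-mono ym zs (inj₁ _) (inj₁ _) (in++-mono ys [ m ] (inj₁ i) (inj₂ zero) tt))
            (in++-mono ym zs (inj₁ (inʳ++ ys [ m ] zero)) (inj₂ k) tt)
            (subst₂ ℕ._<_ (sym (trans (lookup-in++ˡ ym zs _) (lookup-in++ˡ ys [ m ] i))) (sym (lookup-in++ʳ ym zs k)) y<z)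
            (subst₂ ℕ._<_ (sym (lookup-in++ʳ ym zs k)) (sym (trans (lookup-in++ˡ ym zs _) (lookup-in++ʳ ys [ m ] zero)))
              (zs< z∈ (here refl)))))
    where ym = ys ++ [ m ]

  ofList-[] : ofList [] ≅ ∅
  ofList-[] = record
    { to = emb (λ ()) (λ { {()} }) (λ { {()} }) ; from = emb (λ ()) (λ ()) (λ ()) ; from-to = λ () ; to-from = λ () }

  -- The parts before and after the maximum become the subtrees. They are not structurally smaller
  -- than `xs`, so `k` bounds the recursion.
  parse : ∀ k xs → length xs ℕ.≤ k → Unique xs → ¬ 132-Triple (ofList xs) → Σ Tree λ t → ofList xs ≅ ⟦ t ⟧
  parse k       []       _         _ _  = leaf , ofList-[]
  parse (suc k) (x ∷ xs) (s≤s len) u avoids with max-split x xs u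
  ... | maxSplit ys zs m eq ys< zs<
    with parse k ys len-ys (proj₁ (AllPairs-++⁻ ys (proj₁ parts)))
           (avoids′ ∘ 132-map (ofList-inˡ (ys ++ [ m ]) zs ∘↪ ofList-inˡ ys [ m ]))
       | parse k zs len-zs (proj₁ (proj₂ parts)) (avoids′ ∘ 132-map (ofList-inʳ (ys ++ [ m ]) zs))
    where
    u′ : Unique ((ys ++ [ m ]) ++ zs)
    u′ = subst Unique eq u
    avoids′ : ¬ 132-Triple (ofList ((ys ++ [ m ]) ++ zs))
    avoids′ = subst (λ l → ¬ 132-Triple (ofList l)) eq avoids
    parts = AllPairs-++⁻ (ys ++ [ m ]) u′
    len-eq : length xs ≡ length ys + length zs
    len-eq = ℕ.suc-injective (trans (cong length eq) (trans (length-++ (ys ++ [ m ]))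
      (cong (_+ length zs) (trans (length-++ ys) (ℕ.+-comm (length ys) 1)))))
    len-ys = ℕ.≤-trans (subst (length ys ℕ.≤_) (sym len-eq) (ℕ.m≤m+n _ _)) len
    len-zs = ℕ.≤-trans (subst (length zs ℕ.≤_) (sym len-eq) (ℕ.m≤n+m _ _)) len
  ... | β , d | γ , e = node β γ , subst (λ l → ofList l ≅ ⟦ node β γ ⟧) (sym eq)
    (ofList-node {β} {γ} ys m zs ys< (below-max ys m zs (subst Unique eq u) ys< zs<
      (subst (λ l → ¬ 132-Triple (ofList l)) eq avoids)) zs< d e)

  oneLine-unique : (π : Permutation′ n) → Unique (oneLine π)
  oneLine-unique π = Unique.tabulate⁺ λ eq → trans (sym (inverseˡ π))
    (trans (cong (π ⟨$⟩ˡ_) (Fin.toℕ-injective (ℕ.suc-injective eq))) (inverseˡ π))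

  avoider⇒tree : (π : Permutation′ n) → Avoids p132 π → Σ Tree λ t → ofPerm π ≅ ⟦ t ⟧
  avoider⇒tree π avoids with parse (length (oneLine π)) (oneLine π) ℕ.≤-refl (oneLine-unique π)
    (avoids ∘ triple⇒Contains-132 π ∘ 132-map (from (ofPerm≅ofList-oneLine π)))
  ... | t , e = t , ≅-trans (ofPerm≅ofList-oneLine π) e

  tree⇒avoider : ∀ (π : Permutation′ n) t → ofPerm π ≅ ⟦ t ⟧ → Avoids p132 π
  tree⇒avoider π t e c = tree-avoids-132 t (132-map (to e) (Contains-132⇒triple π c))

  flip-tree : ∀ (π : Permutation′ n) t → ofPerm π ≅ ⟦ t ⟧ → ofPerm (flip π) ≅ ⟦ inv t ⟧
  flip-tree π t e = ≅-trans (ofPerm-flip π) (≅-trans (≅-inverse e) (≅-sym (⟦inv⟧ t)))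

  ≈⇒≅ : (π ρ : Permutation′ n) → π ≈ ρ → ofPerm π ≅ ofPerm ρ
  ≈⇒≅ π ρ eq = record
    { to      = emb id id (λ {i} {j} → subst₂ Fin._<_ (eq i) (eq j))
    ; from    = emb id id (λ {i} {j} → subst₂ Fin._<_ (sym (eq i)) (sym (eq j)))
    ; from-to = λ _ → refl
    ; to-from = λ _ → refl
    }

  involution⇒inv : ∀ (π : Permutation′ n) t → ofPerm π ≅ ⟦ t ⟧ → Involution π → inv t ≡ t
  involution⇒inv π t e i = ≅⇒≡ (inv t) t
    (≅-trans (≅-sym (flip-tree π t e)) (≅-trans (≈⇒≅ (flip π) π i) e))

  inv⇒involution : ∀ (π : Permutation′ n) t → ofPerm π ≅ ⟦ t ⟧ → inv t ≡ t → Involution π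
  inv⇒involution π t e eq = ofPerm-injective (flip π) π
    (≅-trans (flip-tree π t e) (subst (λ u → ⟦ u ⟧ ≅ ofPerm π) (sym eq) (≅-sym e)))

open Permutations

open FormalPowerSeries

-- Enumerating trees and self-inverse trees by size.

module Counting where
  private
    variable
      A B : Set

  ∑ : (A → ℤ) → List A → ℤ
  ∑ w []       = 0ℤ
  ∑ w (x ∷ xs) = w x ℤ.+ ∑ w xs

  ∑-cong : {v w : A → ℤ} → v ≗ w → ∀ xs → ∑ v xs ≡ ∑ w xs
  ∑-cong p []       = refl
  ∑-cong p (x ∷ xs) = cong₂ ℤ._+_ (p x) (∑-cong p xs)

  ∑-++ : ∀ (w : A → ℤ) xs ys → ∑ w (xs ++ ys) ≡ ∑ w xs ℤ.+ ∑ w ys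
  ∑-++ w []       ys = sym (ℤ.+-identityˡ _)
  ∑-++ w (x ∷ xs) ys = trans (cong (λ s → w x ℤ.+ s) (∑-++ w xs ys)) (sym (ℤ.+-assoc (w x) _ _))

  ∑-map : ∀ (w : B → ℤ) (f : A → B) xs → ∑ w (map f xs) ≡ ∑ (w ∘ f) xs
  ∑-map w f []       = refl
  ∑-map w f (x ∷ xs) = cong (λ s → w (f x) ℤ.+ s) (∑-map w f xs)

  ∑-+ : ∀ (v w : A → ℤ) xs → ∑ (λ x → v x ℤ.+ w x) xs ≡ ∑ v xs ℤ.+ ∑ w xs
  ∑-+ v w []       = refl
  ∑-+ v w (x ∷ xs) = trans (cong (λ s → v x ℤ.+ w x ℤ.+ s) (∑-+ v w xs)) (lemma (v x) (w x) (∑ v xs) (∑ w xs))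
    where
    lemma : ∀ a b c d → a ℤ.+ b ℤ.+ (c ℤ.+ d) ≡ a ℤ.+ c ℤ.+ (b ℤ.+ d)
    lemma = solve-∀

  ∑-scale : ∀ c (w : A → ℤ) xs → ∑ (λ x → c ℤ.* w x) xs ≡ c ℤ.* ∑ w xs
  ∑-scale c w []       = sym (ℤ.*-zeroʳ c)
  ∑-scale c w (x ∷ xs) = trans (cong (λ s → c ℤ.* w x ℤ.+ s) (∑-scale c w xs)) (sym (ℤ.*-distribˡ-+ c (w x) (∑ w xs)))

  ∑-cartesianProduct : ∀ (v : A → ℤ) (w : B → ℤ) xs ys →
    ∑ (λ (x , y) → v x ℤ.* w y) (cartesianProduct xs ys) ≡ ∑ v xs ℤ.* ∑ w ys
  ∑-cartesianProduct v w []       ys = refl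
  ∑-cartesianProduct v w (x ∷ xs) ys = trans (∑-++ _ (map (x ,_) ys) _)
    (trans (cong₂ ℤ._+_ (trans (∑-map _ (x ,_) ys) (∑-scale (v x) w ys)) (∑-cartesianProduct v w xs ys))
    (sym (ℤ.*-distribʳ-+ (∑ w ys) (v x) (∑ v xs))))

  -- The Cauchy product of graded families lists the pairs of given total degree.

  infixl 7 _⊛_

  _⊛_ : (ℕ → List A) → (ℕ → List B) → ℕ → List (A × B)
  (f ⊛ g) zero    = cartesianProduct (f 0) (g 0)
  (f ⊛ g) (suc n) = cartesianProduct (f 0) (g (suc n)) ++ (f ∘ suc ⊛ g) n

  ⊛-cong-≤ : ∀ n {f f′ : ℕ → List A} {g g′ : ℕ → List B} →
    (∀ {m} → m ≤ n → f m ≡ f′ m) → (∀ {m} → m ≤ n → g m ≡ g′ m) → (f ⊛ g) n ≡ (f′ ⊛ g′) n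
  ⊛-cong-≤ zero    p q = cong₂ cartesianProduct (p z≤n) (q z≤n)
  ⊛-cong-≤ (suc n) p q = cong₂ _++_ (cong₂ cartesianProduct (p z≤n) (q ℕ.≤-refl))
    (⊛-cong-≤ n (λ m≤n → p (s≤s m≤n)) (λ m≤n → q (ℕ.m≤n⇒m≤1+n m≤n)))

  ∑-⊛ : ∀ (v : A → ℤ) (w : B → ℤ) f g → ∑ (λ (x , y) → v x ℤ.* w y) ∘ (f ⊛ g) ≗ (∑ v ∘ f) *ˢ (∑ w ∘ g)
  ∑-⊛ v w f g zero    = ∑-cartesianProduct v w (f 0) (g 0)
  ∑-⊛ v w f g (suc n) = trans (∑-++ _ (cartesianProduct (f 0) (g (suc n))) _)
    (cong₂ ℤ._+_ (∑-cartesianProduct v w (f 0) (g (suc n))) (∑-⊛ v w (f ∘ suc) g n))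

  ∈-⊛⁺ : ∀ {f : ℕ → List A} {g : ℕ → List B} {x y} i j → x ∈ f i → y ∈ g j → (x , y) ∈ (f ⊛ g) (i + j)
  ∈-⊛⁺ zero    zero    p q = ∈-cartesianProduct⁺ p q
  ∈-⊛⁺ zero    (suc j) p q = ∈-++⁺ˡ (∈-cartesianProduct⁺ p q)
  ∈-⊛⁺ {f = f} {g} (suc i) j p q = ∈-++⁺ʳ (cartesianProduct (f 0) (g (suc (i + j)))) (∈-⊛⁺ {f = f ∘ suc} i j p q)

  ∈-⊛⁻ : ∀ (f : ℕ → List A) (g : ℕ → List B) n {x y} → (x , y) ∈ (f ⊛ g) n →
         ∃ λ i → ∃ λ j → i + j ≡ n × x ∈ f i × y ∈ g j
  ∈-⊛⁻ f g zero    p = 0 , 0 , refl , ∈-cartesianProduct⁻ (f 0) (g 0) p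
  ∈-⊛⁻ f g (suc n) p with ∈-++⁻ (cartesianProduct (f 0) (g (suc n))) p
  ... | inj₁ q = 0 , suc n , refl , ∈-cartesianProduct⁻ (f 0) (g (suc n)) q
  ... | inj₂ q with ∈-⊛⁻ (f ∘ suc) g n q
  ...   | i , j , eq , r = suc i , j , cong suc eq , r

  -- That an element determines its degree keeps the summands of `⊛` disjoint.
  Graded : (ℕ → List A) → Set
  Graded f = ∀ {x i j} → x ∈ f i → x ∈ f j → i ≡ j

  Unique-⊛ : ∀ (f : ℕ → List A) (g : ℕ → List B) n → Graded f →
    (∀ i → Unique (f i)) → (∀ i → Unique (g i)) → Unique ((f ⊛ g) n)
  Unique-⊛ f g zero    graded uf ug = Unique.cartesianProduct⁺ (uf 0) (ug 0)
  Unique-⊛ f g (suc n) graded uf ug = Unique.++⁺ (Unique.cartesianProduct⁺ (uf 0) (ug (suc n)))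
    (Unique-⊛ (f ∘ suc) g n (λ p q → ℕ.suc-injective (graded p q)) (uf ∘ suc) ug)
    λ (p , q) → disjoint p q
    where
    disjoint : ∀ {u} → u ∈ cartesianProduct (f 0) (g (suc n)) → ¬ u ∈ (f ∘ suc ⊛ g) n
    disjoint p q with ∈-⊛⁻ (f ∘ suc) g n q
    ... | i , _ , _ , r , _ with graded (proj₁ (∈-cartesianProduct⁻ (f 0) (g (suc n)) p)) r
    ...   | ()

  -- The counterpart of `stretch` for lists: in `wrap β δ` the tree `β` appears together with its
  -- inverse, so it contributes twice its size.
  stretchᴸ : (ℕ → List A) → ℕ → List A
  stretchᴸ f zero          = f 0
  stretchᴸ f (suc zero)    = []
  stretchᴸ f (suc (suc n)) = stretchᴸ (f ∘ suc) n

  ∑-stretch : ∀ (w : A → ℤ) f → ∑ w ∘ stretchᴸ f ≗ stretch (∑ w ∘ f)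
  ∑-stretch w f zero          = refl
  ∑-stretch w f (suc zero)    = refl
  ∑-stretch w f (suc (suc n)) = ∑-stretch w (f ∘ suc) n

  ∈-stretch⁺ : ∀ {f : ℕ → List A} {x} i → x ∈ f i → x ∈ stretchᴸ f (i + i)
  ∈-stretch⁺ zero    p = p
  ∈-stretch⁺ {f = f} {x} (suc i) p rewrite ℕ.+-suc i i = ∈-stretch⁺ {f = f ∘ suc} i p

  ∈-stretch⁻ : ∀ (f : ℕ → List A) n {x} → x ∈ stretchᴸ f n → ∃ λ i → i + i ≡ n × x ∈ f i
  ∈-stretch⁻ f zero          p = 0 , refl , p
  ∈-stretch⁻ f (suc (suc n)) p with ∈-stretch⁻ (f ∘ suc) n p
  ... | i , eq , q = suc i , cong suc (trans (ℕ.+-suc i i) (cong suc eq)) , q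

  Unique-stretch : ∀ (f : ℕ → List A) n → (∀ i → Unique (f i)) → Unique (stretchᴸ f n)
  Unique-stretch f zero          u = u 0
  Unique-stretch f (suc zero)    u = []
  Unique-stretch f (suc (suc n)) u = Unique-stretch (f ∘ suc) n (u ∘ suc)

  Graded-stretch : ∀ {f : ℕ → List A} → Graded f → Graded (stretchᴸ f)
  Graded-stretch {f = f} graded {x} {i} {j} p q with ∈-stretch⁻ f i p | ∈-stretch⁻ f j q
  ... | k , refl , p′ | l , refl , q′ with graded p′ q′
  ...   | refl = refl

  -- The first argument only bounds the recursion.

  treesBelow : ℕ → ℕ → List Tree
  treesBelow d       zero    = [ leaf ]
  treesBelow zero    (suc n) = []
  treesBelow (suc d) (suc n) = map (uncurry node) ((treesBelow d ⊛ treesBelow d) n)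

  treesBelow-stable : ∀ {d d′} n → n ≤ d → n ≤ d′ → treesBelow d n ≡ treesBelow d′ n
  treesBelow-stable zero    p q = refl
  treesBelow-stable (suc n) (s≤s p) (s≤s q) = cong (map (uncurry node))
    (⊛-cong-≤ n (λ m≤n → treesBelow-stable _ (ℕ.≤-trans m≤n p) (ℕ.≤-trans m≤n q))
                (λ m≤n → treesBelow-stable _ (ℕ.≤-trans m≤n p) (ℕ.≤-trans m≤n q)))

  ∈-treesBelow⁺ : ∀ {d} t → size t ≤ d → t ∈ treesBelow d (size t)
  ∈-treesBelow⁺ leaf       p       = here refl
  ∈-treesBelow⁺ {suc d} (node β γ) (s≤s p) = ∈-map⁺ (uncurry node)
    (∈-⊛⁺ {f = treesBelow d} (size β) (size γ)
      (∈-treesBelow⁺ β (ℕ.≤-trans (ℕ.m≤m+n _ _) p)) (∈-treesBelow⁺ γ (ℕ.≤-trans (ℕ.m≤n+m _ _) p)))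

  ∈-treesBelow⁻ : ∀ d n {t} → t ∈ treesBelow d n → size t ≡ n
  ∈-treesBelow⁻ zero    zero    (here refl) = refl
  ∈-treesBelow⁻ (suc d) zero    (here refl) = refl
  ∈-treesBelow⁻ (suc d) (suc n) p with ∈-map⁻ (uncurry node) p
  ... | (β , γ) , q , refl with ∈-⊛⁻ (treesBelow d) (treesBelow d) n q
  ...   | i , j , eq , r , s = cong suc (trans (cong₂ _+_ (∈-treesBelow⁻ d i r) (∈-treesBelow⁻ d j s)) eq)

  Graded-treesBelow : ∀ d → Graded (treesBelow d)
  Graded-treesBelow d {i = i} {j} p q = trans (sym (∈-treesBelow⁻ d i p)) (∈-treesBelow⁻ d j q)

  Unique-treesBelow : ∀ d n → Unique (treesBelow d n)
  Unique-treesBelow zero    zero    = [] ∷ []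
  Unique-treesBelow (suc d) zero    = [] ∷ []
  Unique-treesBelow zero    (suc n) = []
  Unique-treesBelow (suc d) (suc n) = Unique.map⁺ (λ eq → uncurry (cong₂ _,_) (node-injective eq))
    (Unique-⊛ (treesBelow d) (treesBelow d) n (Graded-treesBelow d) (Unique-treesBelow d) (Unique-treesBelow d))

  trees : ℕ → List Tree
  trees n = treesBelow n n

  ∈-trees⁻ : ∀ n {t} → t ∈ trees n → size t ≡ n
  ∈-trees⁻ n = ∈-treesBelow⁻ n n

  trees-suc : ∀ n → trees (suc n) ≡ map (uncurry node) ((trees ⊛ trees) n)
  trees-suc n = cong (map (uncurry node))
    (⊛-cong-≤ n (λ m≤n → treesBelow-stable _ m≤n ℕ.≤-refl) (λ m≤n → treesBelow-stable _ m≤n ℕ.≤-refl))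

  -- The clauses follow `involution-cases`, with the same bound on the recursion. A tree `wrap β δ`
  -- has two roots of its own, hence the step by two.
  involutionsBelow : ℕ → ℕ → List Tree
  involutionsBelow d       zero          = [ leaf ]
  involutionsBelow zero    (suc n)       = []
  involutionsBelow (suc d) (suc zero)    = map snoc (involutionsBelow d 0)
  involutionsBelow (suc d) (suc (suc n)) =
    map snoc (involutionsBelow d (suc n)) ++
    map (uncurry wrap) ((stretchᴸ trees ⊛ involutionsBelow d) n)

  involutionsBelow-stable : ∀ {d d′} n → n ≤ d → n ≤ d′ → involutionsBelow d n ≡ involutionsBelow d′ n
  involutionsBelow-stable zero          p       q       = refl
  involutionsBelow-stable (suc zero)    (s≤s p) (s≤s q) = cong (map snoc) (involutionsBelow-stable 0 p q)
  involutionsBelow-stable (suc (suc n)) (s≤s p) (s≤s q) = cong₂ _++_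
    (cong (map snoc) (involutionsBelow-stable (suc n) p q))
    (cong (map (uncurry wrap)) (⊛-cong-≤ n {f = stretchᴸ trees} (λ _ → refl) λ m≤n → involutionsBelow-stable _
      (ℕ.≤-trans (ℕ.m≤n⇒m≤1+n m≤n) p) (ℕ.≤-trans (ℕ.m≤n⇒m≤1+n m≤n) q)))

  size-wrap : ∀ β δ → size (wrap β δ) ≡ suc (suc ((size β + size β) + size δ))
  size-wrap β δ = cong suc (begin
    size β + size (δ ⊝ snoc (inv β))                 ≡⟨ cong (size β +_) (size-⊝ δ (snoc (inv β))) ⟩
    size β + (size δ + suc (size (inv β) + 0))       ≡⟨ cong (λ z → size β + (size δ + suc z))
                                                           (trans (ℕ.+-identityʳ _) (size-inv β)) ⟩
    size β + (size δ + suc (size β))                 ≡⟨ cong (size β +_) (ℕ.+-comm (size δ) (suc (size β))) ⟩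
    size β + (suc (size β) + size δ)                 ≡⟨ ℕ.+-suc (size β) (size β + size δ) ⟩
    suc (size β + (size β + size δ))                 ≡⟨ cong suc (ℕ.+-assoc (size β) (size β) (size δ)) ⟨
    suc ((size β + size β) + size δ)                 ∎)
    where open ≡-Reasoning

  ∈-snoc-part : ∀ d {n t} → t ∈ map snoc (involutionsBelow d n) → t ∈ involutionsBelow (suc d) (suc n)
  ∈-snoc-part d {zero}  p = p
  ∈-snoc-part d {suc n} p = ∈-++⁺ˡ p

  ∈-involutionsBelow⁺ : ∀ d t → size t ≤ d → inv t ≡ t → t ∈ involutionsBelow d (size t)
  ∈-involutionsBelow⁺ d t p eq with involution-cases t eq
  ∈-involutionsBelow⁺ d _ p eq | inj₁ refl = here refl
  ∈-involutionsBelow⁺ (suc d) _ (s≤s p) eq | inj₂ (inj₁ (β , refl , β-inv)) =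
    ∈-snoc-part d {size β + 0} (∈-map⁺ snoc (subst (λ n → β ∈ involutionsBelow d n) (sym (ℕ.+-identityʳ (size β)))
      (∈-involutionsBelow⁺ d β (subst (_≤ d) (ℕ.+-identityʳ (size β)) p) β-inv)))
  ∈-involutionsBelow⁺ (suc d) _ (s≤s p) eq | inj₂ (inj₂ (β , δ , refl , δ-inv)) =
    subst (λ n → wrap β δ ∈ involutionsBelow (suc d) n) (sym (size-wrap β δ))
      (∈-++⁺ʳ (map snoc (involutionsBelow d (suc ((size β + size β) + size δ)))) (∈-map⁺ (uncurry wrap)
        (∈-⊛⁺ {f = stretchᴸ trees} (size β + size β) (size δ)
          (∈-stretch⁺ {f = trees} (size β) (∈-treesBelow⁺ β ℕ.≤-refl))
          (∈-involutionsBelow⁺ d δ (ℕ.≤-trans (ℕ.m≤n+m (size δ) (suc (size β + size β)))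
            (subst (_≤ d) (ℕ.suc-injective (size-wrap β δ)) p)) δ-inv))))

  inv-snoc : ∀ {t} → inv t ≡ t → inv (snoc t) ≡ snoc t
  inv-snoc = cong snoc

  ∈-involutionsBelow⁻ : ∀ d n {t} → t ∈ involutionsBelow d n → size t ≡ n × inv t ≡ t
  ∈-involutionsBelow⁻ zero    zero          (here refl) = refl , refl
  ∈-involutionsBelow⁻ (suc d) zero          (here refl) = refl , refl
  ∈-involutionsBelow⁻ (suc d) (suc zero)    p with ∈-map⁻ snoc p
  ... | δ , q , refl with ∈-involutionsBelow⁻ d 0 q
  ...   | s , e = cong suc (trans (ℕ.+-identityʳ _) s) , inv-snoc e
  ∈-involutionsBelow⁻ (suc d) (suc (suc n)) p with ∈-++⁻ (map snoc (involutionsBelow d (suc n))) p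
  ... | inj₁ q with ∈-map⁻ snoc q
  ...   | δ , r , refl with ∈-involutionsBelow⁻ d (suc n) r
  ...     | s , e = cong suc (trans (ℕ.+-identityʳ _) s) , inv-snoc e
  ∈-involutionsBelow⁻ (suc d) (suc (suc n)) p | inj₂ q with ∈-map⁻ (uncurry wrap) q
  ... | (β , δ) , r , refl with ∈-⊛⁻ (stretchᴸ trees) (involutionsBelow d) n r
  ...   | i , j , refl , b , c with ∈-stretch⁻ trees i b | ∈-involutionsBelow⁻ d j c
  ...     | k , refl , b′ | s , e with ∈-trees⁻ k b′
  ...       | refl = trans (size-wrap β δ) (cong (λ z → suc (suc ((size β + size β) + z))) s) , inv-wrap β δ e

  wrap-injective : ∀ {β δ β′ δ′} → wrap β δ ≡ wrap β′ δ′ → (β , δ) ≡ (β′ , δ′)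
  wrap-injective {β} {δ} {β′} {δ′} eq with node-injective eq
  ... | refl , eq′ with ⊝-snoc-injective δ δ′ eq′
  ...   | refl , _ = refl

  snoc-injective : ∀ {t u} → snoc t ≡ snoc u → t ≡ u
  snoc-injective refl = refl

  snoc≢wrap : ∀ {t} β δ → snoc t ≢ wrap β δ
  snoc≢wrap β leaf       ()
  snoc≢wrap β (node _ _) ()

  Unique-involutionsBelow : ∀ d n → Unique (involutionsBelow d n)
  Unique-involutionsBelow zero    zero          = [] ∷ []
  Unique-involutionsBelow (suc d) zero          = [] ∷ []
  Unique-involutionsBelow zero    (suc n)       = []
  Unique-involutionsBelow (suc d) (suc zero)    = Unique.map⁺ snoc-injective (Unique-involutionsBelow d 0)
  Unique-involutionsBelow (suc d) (suc (suc n)) = Unique.++⁺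
    (Unique.map⁺ snoc-injective (Unique-involutionsBelow d (suc n)))
    (Unique.map⁺ wrap-injective (Unique-⊛ (stretchᴸ trees) (involutionsBelow d) n
      (Graded-stretch (λ {x} {i} {j} p q → trans (sym (∈-trees⁻ i p)) (∈-trees⁻ j q)))
      (λ i → Unique-stretch trees i λ j → Unique-treesBelow j j) (Unique-involutionsBelow d)))
    disjoint
    where
    disjoint : ∀ {t} → ¬ (t ∈ map snoc (involutionsBelow d (suc n)) ×
                          t ∈ map (uncurry wrap) ((stretchᴸ trees ⊛ involutionsBelow d) n))
    disjoint (p , q) with ∈-map⁻ snoc p | ∈-map⁻ (uncurry wrap) q
    ... | _ , _ , refl | (β , δ) , _ , eq = snoc≢wrap β δ eq

  involutions : ℕ → List Tree
  involutions n = involutionsBelow n n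

  involutions-suc² : ∀ n → involutions (suc (suc n)) ≡
    map snoc (involutions (suc n)) ++ map (uncurry wrap) ((stretchᴸ trees ⊛ involutions) n)
  involutions-suc² n = cong (λ l → map snoc (involutions (suc n)) ++ map (uncurry wrap) l)
    (⊛-cong-≤ n {f = stretchᴸ trees} (λ _ → refl) λ m≤n → involutionsBelow-stable _ (ℕ.m≤n⇒m≤1+n m≤n) ℕ.≤-refl)

  treeSeries involutionSeries : (Tree → ℤ) → Series
  treeSeries w       = ∑ w ∘ trees
  involutionSeries w = ∑ w ∘ involutions

  pairSeries : (Tree → Tree → ℤ) → Series
  pairSeries W = ∑ (uncurry W) ∘ (trees ⊛ trees)

  treeSeries-zero : ∀ w → treeSeries w 0 ≡ w leaf
  treeSeries-zero w = ℤ.+-identityʳ (w leaf)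

  treeSeries-suc : ∀ w n → treeSeries w (suc n) ≡ pairSeries (λ β γ → w (node β γ)) n
  treeSeries-suc w n = trans (cong (∑ w) (trees-suc n)) (∑-map w (uncurry node) ((trees ⊛ trees) n))

  X²*-suc² : ∀ f n → (X *ˢ X *ˢ f) (suc (suc n)) ≡ f n
  X²*-suc² f n = trans (*ˢ-assoc X X f (suc (suc n))) (trans (X*-suc (X *ˢ f) (suc n)) (X*-suc f n))

  -- The weights are kept general to serve two patterns: for `snoc A`, both `u` and `v` test `A`;
  -- for `node A (snoc (inv A))`, `v` tests `A` while `u` equals `w`.
  involutionSeries-equation : ∀ (u v w : Tree → ℤ) → w leaf ≡ 1ℤ →
    (∀ δ → w (snoc δ) ≡ u δ) → (∀ β δ → w (wrap β δ) ≡ v β ℤ.* w δ) →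
    involutionSeries w ≗
      1ˢ +ˢ X *ˢ involutionSeries u +ˢ X *ˢ X *ˢ (stretch (treeSeries v) *ˢ involutionSeries w)
  involutionSeries-equation u v w w-leaf w-snoc w-wrap zero =
    trans (ℤ.+-identityʳ (w leaf)) (trans w-leaf refl)
  involutionSeries-equation u v w w-leaf w-snoc w-wrap (suc zero) = begin
    ∑ w (map snoc [ leaf ])
      ≡⟨ cong (ℤ._+ 0ℤ) (w-snoc leaf) ⟩
    ∑ u [ leaf ]
      ≡⟨ lemma (∑ u [ leaf ]) ⟨
    0ℤ ℤ.+ ∑ u [ leaf ] ℤ.+ 0ℤ
      ≡⟨ cong₂ (λ a b → 0ℤ ℤ.+ a ℤ.+ b) (X*-suc (involutionSeries u) 0)
         (trans (*ˢ-assoc X X S 1) (trans (X*-suc (X *ˢ S) 0) (X*-zero S))) ⟨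
    _ ∎
    where
    open ≡-Reasoning
    S = stretch (treeSeries v) *ˢ involutionSeries w
    lemma : ∀ a → 0ℤ ℤ.+ a ℤ.+ 0ℤ ≡ a
    lemma = solve-∀
  involutionSeries-equation u v w w-leaf w-snoc w-wrap (suc (suc n)) = begin
    ∑ w (involutions (suc (suc n)))
      ≡⟨ cong (∑ w) (involutions-suc² n) ⟩
    ∑ w (map snoc (involutions (suc n)) ++ map (uncurry wrap) ((stretchᴸ trees ⊛ involutions) n))
      ≡⟨ ∑-++ w (map snoc (involutions (suc n))) _ ⟩
    ∑ w (map snoc (involutions (suc n))) ℤ.+ ∑ w (map (uncurry wrap) ((stretchᴸ trees ⊛ involutions) n))
      ≡⟨ cong₂ ℤ._+_ (trans (∑-map w snoc (involutions (suc n))) (∑-cong w-snoc (involutions (suc n))))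
         (trans (∑-map w (uncurry wrap) ((stretchᴸ trees ⊛ involutions) n))
           (trans (∑-cong (λ (β , δ) → w-wrap β δ) ((stretchᴸ trees ⊛ involutions) n))
           (trans (∑-⊛ v w (stretchᴸ trees) involutions n)
             (*ˢ-cong {g = involutionSeries w} (∑-stretch v trees) (λ _ → refl) n)))) ⟩
    involutionSeries u (suc n) ℤ.+ S n
      ≡⟨ cong (ℤ._+ S n) (ℤ.+-identityˡ (involutionSeries u (suc n))) ⟨
    0ℤ ℤ.+ involutionSeries u (suc n) ℤ.+ S n
      ≡⟨ cong₂ (λ a b → 0ℤ ℤ.+ a ℤ.+ b) (X*-suc (involutionSeries u) (suc n)) (X²*-suc² S n) ⟨
    _ ∎
    where
    open ≡-Reasoning
    S = stretch (treeSeries v) *ˢ involutionSeries w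

  treeSeries-product : ∀ (u v w : Tree → ℤ) → w leaf ≡ 1ℤ → (∀ β γ → w (node β γ) ≡ u β ℤ.* v γ) →
    treeSeries w ≗ 1ˢ +ˢ X *ˢ (treeSeries u *ˢ treeSeries v)
  treeSeries-product u v w w-leaf w-node zero    = trans (treeSeries-zero w) (trans w-leaf refl)
  treeSeries-product u v w w-leaf w-node (suc n) = begin
    treeSeries w (suc n)
      ≡⟨ treeSeries-suc w n ⟩
    pairSeries (λ β γ → w (node β γ)) n
      ≡⟨ ∑-cong (λ (β , γ) → w-node β γ) ((trees ⊛ trees) n) ⟩
    pairSeries (λ β γ → u β ℤ.* v γ) n
      ≡⟨ ∑-⊛ u v trees trees n ⟩
    (treeSeries u *ˢ treeSeries v) n
      ≡⟨ X*-suc _ n ⟨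
    (X *ˢ (treeSeries u *ˢ treeSeries v)) (suc n)
      ≡⟨ ℤ.+-identityˡ _ ⟨
    _ ∎
    where open ≡-Reasoning

  treeSeries-inclusion-exclusion : ∀ (u v w : Tree → ℤ) → w leaf ≡ 1ℤ →
    (∀ β γ → w (node β γ) ℤ.+ u β ℤ.* v γ ≡ u β ℤ.* w γ ℤ.+ w β ℤ.* v γ) →
    treeSeries w +ˢ X *ˢ (treeSeries u *ˢ treeSeries v) ≗
      1ˢ +ˢ X *ˢ (treeSeries u *ˢ treeSeries w +ˢ treeSeries w *ˢ treeSeries v)
  treeSeries-inclusion-exclusion u v w w-leaf w-node zero =
    cong₂ ℤ._+_ (trans (treeSeries-zero w) w-leaf)
      (trans (X*-zero (treeSeries u *ˢ treeSeries v))
        (sym (X*-zero (treeSeries u *ˢ treeSeries w +ˢ treeSeries w *ˢ treeSeries v))))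
  treeSeries-inclusion-exclusion u v w w-leaf w-node (suc n) = begin
    treeSeries w (suc n) ℤ.+ (X *ˢ (U *ˢ V)) (suc n)
      ≡⟨ cong₂ ℤ._+_ (treeSeries-suc w n) (trans (X*-suc (U *ˢ V) n) (sym (∑-⊛ u v trees trees n))) ⟩
    pairSeries (λ β γ → w (node β γ)) n ℤ.+ pairSeries (λ β γ → u β ℤ.* v γ) n
      ≡⟨ ∑-+ _ _ ((trees ⊛ trees) n) ⟨
    pairSeries (λ β γ → w (node β γ) ℤ.+ u β ℤ.* v γ) n
      ≡⟨ ∑-cong (λ (β , γ) → w-node β γ) ((trees ⊛ trees) n) ⟩
    pairSeries (λ β γ → u β ℤ.* w γ ℤ.+ w β ℤ.* v γ) n
      ≡⟨ ∑-+ _ _ ((trees ⊛ trees) n) ⟩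
    pairSeries (λ β γ → u β ℤ.* w γ) n ℤ.+ pairSeries (λ β γ → w β ℤ.* v γ) n
      ≡⟨ cong₂ ℤ._+_ (∑-⊛ u w trees trees n) (∑-⊛ w v trees trees n) ⟩
    (U *ˢ W +ˢ W *ˢ V) n
      ≡⟨ X*-suc (U *ˢ W +ˢ W *ˢ V) n ⟨
    (X *ˢ (U *ˢ W +ˢ W *ˢ V)) (suc n)
      ≡⟨ ℤ.+-identityˡ _ ⟨
    _ ∎
    where
    open ≡-Reasoning
    U = treeSeries u
    V = treeSeries v
    W = treeSeries w

  -- The pigeonhole principle for an injective relation, with distinctness of the `xs` measured by
  -- `_≈_` because permutations are only listed up to pointwise equality.
  length-≤ : ∀ {A B : Set} (_≈_ : A → A → Set) (R : A → B → Set) →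
    (∀ {x x′ y} → R x y → R x′ y → x ≈ x′) → ∀ xs ys → AllPairs (λ x x′ → ¬ x ≈ x′) xs →
    All (λ x → ∃ λ y → y ∈ ys × R x y) xs → length xs ≤ length ys
  length-≤ _≈_ R inj []       ys _        _                     = z≤n
  length-≤ _≈_ R inj (x ∷ xs) ys (x≉ ∷ u) ((y , y∈ , r) ∷ rest) with ∈-∃++ y∈
  ... | as , bs , refl = subst (suc (length xs) ≤_)
    (trans (cong suc (length-++ as)) (trans (sym (ℕ.+-suc (length as) (length bs))) (sym (length-++ as))))
    (s≤s (length-≤ _≈_ R inj xs (as ++ bs) u (All.zipWith avoid-y (x≉ , rest))))
    where
    avoid-y : ∀ {x′} → (¬ x ≈ x′) × (∃ λ y′ → y′ ∈ as ++ y ∷ bs × R x′ y′) → ∃ λ y′ → y′ ∈ as ++ bs × R x′ y′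
    avoid-y (x≉x′ , y′ , y′∈ , r′) with ∈-++⁻ as y′∈
    ... | inj₁ p           = y′ , ∈-++⁺ˡ p , r′
    ... | inj₂ (here refl) = ⊥-elim (x≉x′ (inj r r′))
    ... | inj₂ (there p)   = y′ , ∈-++⁺ʳ as p , r′

open Counting

-- Trees of wedge and double-wedge patterns.

module Wedges where
  -- Appends `j` successive new maxima, as in the passage from τ to (τ, 2l+1, ..., k).
  snocs : ℕ → Tree → Tree
  snocs zero    t = t
  snocs (suc j) t = snoc (snocs j t)

  snocs-snoc : ∀ j t → snocs j (snoc t) ≡ snoc (snocs j t)
  snocs-snoc zero    t = refl
  snocs-snoc (suc j) t = cong snoc (snocs-snoc j t)

  inc : ℕ → Tree
  inc m = snocs m leaf

  size-snoc : ∀ t → size (snoc t) ≡ suc (size t)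
  size-snoc t = cong suc (ℕ.+-identityʳ (size t))

  size-snocs : ∀ j t → size (snocs j t) ≡ j + size t
  size-snocs zero    t = refl
  size-snocs (suc j) t = trans (size-snoc (snocs j t)) (cong suc (size-snocs j t))

  inv-snocs : ∀ j {t} → inv t ≡ t → inv (snocs j t) ≡ snocs j t
  inv-snocs zero    eq = eq
  inv-snocs (suc j) eq = cong snoc (inv-snocs j eq)

  -- Every entry of some τⁱ is a new maximum with all earlier entries in its left subtree. The right
  -- subtree holds the layer ρⁱ that follows it directly, empty for `t = 0`.
  data Wedge : Tree → Set where
    leafᵂ : Wedge leaf
    nodeᵂ : ∀ {w} → Wedge w → ∀ t → Wedge (node w (inc t))

  snocs-wedge : ∀ j {w} → Wedge w → Wedge (snocs j w)
  snocs-wedge zero    w = w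
  snocs-wedge (suc j) w = nodeᵂ (snocs-wedge j w) 0

  ofList-snoc′ : ∀ {t} xs m → xs ≪ [ m ] → ofList xs ≅ ⟦ t ⟧ → ofList (xs ++ [ m ]) ≅ ⟦ snoc t ⟧
  ofList-snoc′ {t} xs m p e = ≅-trans (ofList-snoc {t} xs m p e) (≅-sym (⟦snoc⟧ t))

  ofList-++-increasing : ∀ {t} xs ys → ofList xs ≅ ⟦ t ⟧ → xs ≪ ys → AllPairs _<_ ys →
                         ofList (xs ++ ys) ≅ ⟦ snocs (length ys) t ⟧
  ofList-++-increasing {t} xs []       e p _          = subst (λ l → ofList l ≅ ⟦ t ⟧) (sym (++-identityʳ xs)) e
  ofList-++-increasing {t} xs (y ∷ ys) e p (y< ∷ inc) =
    subst₂ (λ l u → ofList l ≅ ⟦ u ⟧) (++-assoc xs [ y ] ys) (snocs-snoc (length ys) t)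
      (ofList-++-increasing {snoc t} (xs ++ [ y ]) ys
        (ofList-snoc′ {t} xs y (λ { x∈ (here refl) → p x∈ (here refl) }) e) xs∷ʳy≪ys inc)
    where
    xs∷ʳy≪ys : xs ++ [ y ] ≪ ys
    xs∷ʳy≪ys x∈ y∈ with ∈-++⁻ xs x∈
    ... | inj₁ q           = p q (there y∈)
    ... | inj₂ (here refl) = All.lookup y< y∈

  ofList-increasing : ∀ xs → AllPairs _<_ xs → ofList xs ≅ ⟦ inc (length xs) ⟧
  ofList-increasing xs = ofList-++-increasing {leaf} [] xs ofList-[] (λ ())

  ≪-++ˡ : ∀ {xs ys zs} → xs ≪ zs → ys ≪ zs → xs ++ ys ≪ zs
  ≪-++ˡ {xs} p q x∈ z∈ = [ (λ r → p r z∈) , (λ r → q r z∈) ]′ (∈-++⁻ xs x∈)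

  ≪-++ʳ : ∀ {xs ys zs} → xs ≪ ys → xs ≪ zs → xs ≪ ys ++ zs
  ≪-++ʳ {ys = ys} p q x∈ z∈ = [ p x∈ , q x∈ ]′ (∈-++⁻ ys z∈)

  τs ρs : List Block → List ℕ
  τs bs = concat (map proj₁ bs)
  ρs bs = concat (map proj₂ bs)

  -- `xs` is the part already read, with tree `w`. The last three hypotheses are the invariant: what
  -- is still to come consists of entries above `xs` and entries below it, the latter also below the
  -- former.
  blocks-wedge : ∀ {w} xs bs → ofList xs ≅ ⟦ w ⟧ → Wedge w →
    All (λ b → proj₁ b ≢ []) bs → AllPairs _<_ (τs bs) →
    All (AllPairs _<_) (map proj₂ bs) → AllPairs (λ ρ ρ′ → ρ′ ≪ ρ) (map proj₂ bs) →
    xs ≪ τs bs → ρs bs ≪ xs → ρs bs ≪ τs bs →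
    Σ Tree λ w′ → Wedge w′ × ofList (xs ++ concat (map (λ b → proj₁ b ++ proj₂ b) bs)) ≅ ⟦ w′ ⟧
  blocks-wedge {w} xs [] e wedge _ _ _ _ _ _ _ =
    w , wedge , subst (λ l → ofList l ≅ ⟦ w ⟧) (sym (++-identityʳ xs)) e
  blocks-wedge {w} xs ((τ , ρ) ∷ bs) e wedge (τ≢[] ∷ ne) τs-inc (ρ-inc ∷ ρs-inc) (ρ-dec ∷ dec) xs≪τs ρs≪xs ρs≪τs
    -- Only the last entry of the nonempty τ is directly followed by ρ and gets it as right subtree;
    -- the earlier ones merely append maxima.
    with initLast τ
  ... | []       = ⊥-elim (τ≢[] refl)
  ... | τ₀ ∷ʳ′ m = proj₁ rest , proj₁ (proj₂ rest) ,
    subst (λ l → ofList l ≅ ⟦ proj₁ rest ⟧) list-eq (proj₂ (proj₂ rest))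
    where
    τ′ = τ₀ ++ [ m ]
    R  = concat (map (λ b → proj₁ b ++ proj₂ b) bs)
    parts = AllPairs-++⁻ τ′ τs-inc
    τ-parts = AllPairs-++⁻ τ₀ (proj₁ parts)
    τ≪τs′ : τ′ ≪ τs bs
    τ≪τs′ = proj₂ (proj₂ parts)
    xs≪τ : xs ≪ τ′
    xs≪τ x∈ y∈ = xs≪τs x∈ (∈-++⁺ˡ y∈)
    ρ≪τ : ρ ≪ τ′
    ρ≪τ x∈ y∈ = ρs≪τs (∈-++⁺ˡ x∈) (∈-++⁺ˡ y∈)
    w₁ = snocs (length τ₀) w
    e₁ : ofList (xs ++ τ₀) ≅ ⟦ w₁ ⟧
    e₁ = ofList-++-increasing {w} xs τ₀ e (λ x∈ y∈ → xs≪τ x∈ (∈-++⁺ˡ y∈)) (proj₁ τ-parts)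
    w₂ = node w₁ (inc (length ρ))
    e₂ : ofList (((xs ++ τ₀) ++ [ m ]) ++ ρ) ≅ ⟦ w₂ ⟧
    e₂ = ofList-node {w₁} {inc (length ρ)} (xs ++ τ₀) m ρ
      (≪-++ˡ {xs} {τ₀} (λ x∈ y∈ → xs≪τ x∈ (∈-++⁺ʳ τ₀ y∈)) (proj₂ (proj₂ τ-parts)))
      (≪-++ʳ {ρ} {xs} (λ x∈ y∈ → ρs≪xs (∈-++⁺ˡ x∈) y∈) (λ x∈ y∈ → ρ≪τ x∈ (∈-++⁺ˡ y∈)))
      (λ x∈ y∈ → ρ≪τ x∈ (∈-++⁺ʳ τ₀ y∈))
      e₁ (ofList-increasing ρ ρ-inc)
    xs′ = ((xs ++ τ₀) ++ [ m ]) ++ ρ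
    xs′-eq : xs′ ≡ (xs ++ τ′) ++ ρ
    xs′-eq = cong (_++ ρ) (++-assoc xs τ₀ [ m ])
    rest = blocks-wedge {w₂} xs′ bs e₂ (nodeᵂ (snocs-wedge (length τ₀) wedge) (length ρ)) ne
      (proj₁ (proj₂ parts)) ρs-inc dec
      (subst (_≪ τs bs) (sym xs′-eq) (≪-++ˡ {xs ++ τ′} (≪-++ˡ {xs}
        (λ x∈ y∈ → xs≪τs x∈ (∈-++⁺ʳ τ′ y∈)) τ≪τs′) (λ x∈ y∈ → ρs≪τs (∈-++⁺ˡ x∈) (∈-++⁺ʳ τ′ y∈))))
      (subst (ρs bs ≪_) (sym xs′-eq) (≪-++ʳ {ρs bs} {xs ++ τ′} (≪-++ʳ {ρs bs} {xs}
        (λ x∈ y∈ → ρs≪xs (∈-++⁺ʳ ρ x∈) y∈) (λ x∈ y∈ → ρs≪τs (∈-++⁺ʳ ρ x∈) (∈-++⁺ˡ y∈)))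
        ρs′≪ρ))
      (λ x∈ y∈ → ρs≪τs (∈-++⁺ʳ ρ x∈) (∈-++⁺ʳ τ′ y∈))
      where
      ρs′≪ρ : ρs bs ≪ ρ
      ρs′≪ρ x∈ y∈ with ∈-concat⁻′ (map proj₂ bs) x∈
      ... | ρ′ , x∈ρ′ , ρ′∈ = All.lookup ρ-dec ρ′∈ x∈ρ′ y∈
    list-eq : xs′ ++ R ≡ xs ++ ((τ′ ++ ρ) ++ R)
    list-eq = trans (cong (_++ R) (trans xs′-eq (++-assoc xs τ′ ρ))) (++-assoc xs (τ′ ++ ρ) R)

  ∈-interval⁻ : ∀ a b {x} → x ∈ interval a b → ∃ λ i → i < suc b ∸ a × x ≡ a + i
  ∈-interval⁻ a b = ∈-applyUpTo⁻ (a +_)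

  interval-increasing : ∀ a b → AllPairs _<_ (interval a b)
  interval-increasing a b = AllPairs.applyUpTo⁺₁ (a +_) (suc b ∸ a) λ i<j _ → ℕ.+-monoʳ-< a i<j

  wedge-tree : ∀ {m} (σ : Permutation′ m) → IsWedge m σ → Σ Tree λ w → Wedge w × ofPerm σ ≅ ⟦ w ⟧
  wedge-tree {m} σ (_ , s , bs , one-line , ne , τs-eq , ρs↭ , linked , decreasing) =
    proj₁ result , proj₁ (proj₂ result) ,
    ≅-trans (ofPerm≅ofList-oneLine σ)
      (subst (λ l → ofList l ≅ ⟦ proj₁ result ⟧) (sym one-line) (proj₂ (proj₂ result)))
    where
    ρs≪τs : ρs bs ≪ τs bs
    ρs≪τs x∈ y∈ with ∈-interval⁻ 1 s (∈-resp-↭ ρs↭ x∈) | ∈-interval⁻ (s + 1) m (subst (_ ∈_) τs-eq y∈)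
    ... | i , i<s , refl | j , _ , refl = ℕ.≤-trans (s≤s i<s)
      (ℕ.≤-trans (ℕ.≤-reflexive (sym (ℕ.+-comm s 1))) (ℕ.m≤m+n (s + 1) j))
    result = blocks-wedge {leaf} [] bs ofList-[] leafᵂ ne
      (subst (AllPairs _<_) (sym τs-eq) (interval-increasing (s + 1) m))
      (All.map (λ l → Linked⇒AllPairs ℕ.<-trans (Linked.map (λ { refl → ℕ.≤-refl }) l)) linked)
      (AllPairs.map (λ p {_} {_} x∈ y∈ → All.lookup (All.lookup p y∈) x∈) decreasing)
      (λ ()) (λ _ ()) ρs≪τs

  oneLine-bounds : ∀ {m x} (π : Permutation′ m) → x ∈ oneLine π → 1 ≤ x × x ≤ m
  oneLine-bounds π x∈ with ∈-tabulate⁻ x∈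
  ... | i , refl = s≤s z≤n , Fin.toℕ<n (π ⟨$⟩ʳ i)

  -- The shifted copy with `2 * suc l` forms `A ⊕ 𝟙`. The lower copy with the final entry `suc l`,
  -- which exceeds it, forms `B ⊕ 𝟙`.
  double-wedge-list : ∀ l (π ρ : Permutation′ l) A B → ofPerm π ≅ ⟦ A ⟧ → ofPerm ρ ≅ ⟦ B ⟧ →
    ofList ((oneLine π ⊹ suc l) ++ [ 2 * suc l ] ++ oneLine ρ ++ [ suc l ]) ≅ ⟦ node A (snoc B) ⟧
  double-wedge-list l π ρ A B d e =
    subst (λ xs → ofList xs ≅ ⟦ node A (snoc B) ⟧) (++-assoc (oneLine π ⊹ suc l) [ 2 * suc l ] (oneLine ρ ++ [ suc l ]))
      (ofList-node {A} {snoc B} (oneLine π ⊹ suc l) (2 * suc l) (oneLine ρ ++ [ suc l ])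
        upper< lower<upper (λ z∈ → λ { (here refl) → ℕ.<-≤-trans (s≤s (lower z∈)) 2+l≤ }) upper-tree
        (ofList-snoc′ {B} (oneLine ρ) (suc l) (λ { x∈ (here refl) → s≤s (proj₂ (oneLine-bounds ρ x∈)) })
          (≅-trans (≅-sym (ofPerm≅ofList-oneLine ρ)) e)))
    where
    value : Fin l → ℕ
    value i = suc (toℕ (π ⟨$⟩ʳ i)) + suc l
    upper-eq : oneLine π ⊹ suc l ≡ tabulate value
    upper-eq = map-tabulate (λ i → suc (toℕ (π ⟨$⟩ʳ i))) (_+ suc l)
    upper : ∀ {y} → y ∈ oneLine π ⊹ suc l → suc (suc l) ≤ y × y < 2 * suc l
    upper y∈ with ∈-tabulate⁻ (subst (_ ∈_) upper-eq y∈)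
    ... | i , refl = s≤s (ℕ.m≤n+m (suc l) _) ,
      s≤s (subst (λ z → suc (toℕ (π ⟨$⟩ʳ i)) + suc l ≤ l + z) (sym (ℕ.+-identityʳ (suc l)))
      (ℕ.+-monoˡ-≤ (suc l) (Fin.toℕ<n (π ⟨$⟩ʳ i))))
    lower : ∀ {z} → z ∈ oneLine ρ ++ [ suc l ] → z ≤ suc l
    lower z∈ with ∈-++⁻ (oneLine ρ) z∈
    ... | inj₁ p           = ℕ.m≤n⇒m≤1+n (proj₂ (oneLine-bounds ρ p))
    ... | inj₂ (here refl) = ℕ.≤-refl
    2+l≤ : suc (suc l) ≤ 2 * suc l
    2+l≤ = s≤s (subst (suc l ≤_) (cong (l +_) (sym (ℕ.+-identityʳ (suc l)))) (ℕ.m≤n+m (suc l) l))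
    upper< : oneLine π ⊹ suc l ≪ [ 2 * suc l ]
    upper< y∈ (here refl) = proj₂ (upper y∈)
    lower<upper : oneLine ρ ++ [ suc l ] ≪ oneLine π ⊹ suc l
    lower<upper z∈ y∈ = ℕ.≤-trans (s≤s (lower z∈)) (proj₁ (upper y∈))
    upper-tree : ofList (oneLine π ⊹ suc l) ≅ ⟦ A ⟧
    upper-tree = subst (λ xs → ofList xs ≅ ⟦ A ⟧) (sym upper-eq) (≅-trans (≅-sym (ofPerm≅ofList π value
      (λ r → s≤s (ℕ.+-monoˡ-< (suc l) r)) (λ r → ℕ.+-cancelʳ-< (suc l) _ _ (ℕ.s≤s⁻¹ r)))) d)

  -- The two forms of a double-wedge pattern differ by exchanging σ and its inverse, so `A` is the
  -- tree of one or the other.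
  double-wedge-tree : ∀ l (τ : Permutation′ (2 * suc l)) → IsDoubleWedge (suc l) τ →
    Σ Tree λ A → (Wedge A ⊎ Wedge (inv A)) × ofList (oneLine τ) ≅ ⟦ node A (snoc (inv A)) ⟧
  double-wedge-tree l τ (σ , wedge , form) with wedge-tree σ wedge
  ... | w , wedge′ , e with form
  ...   | inj₂ eq = w , inj₁ wedge′ ,
          subst (λ xs → ofList xs ≅ _) (sym eq) (double-wedge-list l σ (flip σ) w (inv w) e (flip-tree σ w e))
  ...   | inj₁ eq = inv w , inj₂ (subst Wedge (sym (inv-involutive w)) wedge′) ,
          subst (λ xs → ofList xs ≅ _) (sym eq) (double-wedge-list l (flip σ) σ (inv w) (inv (inv w)) (flip-tree σ w e)
            (subst (λ t → ofPerm σ ≅ ⟦ t ⟧) (sym (inv-involutive w)) e))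

open Wedges

open import Data.Integer.Base using (+_)

-- Avoidance indicators and their generating functions.

list≅ : ∀ {n} (α : Permutation′ n) t → ofPerm α ≅ ⟦ t ⟧ → ofList (oneLine α) ≅ ⟦ t ⟧
list≅ α t d = ≅-trans (≅-sym (ofPerm≅ofList-oneLine α)) d

opaque

  -- Both trees are realized as permutations, where avoidance is decided by a finite search.
  _⋠?_ : ∀ A t → Dec (¬ A ≼ t)
  A ⋠? t with realize A | realize t
  ... | α , d | π , e = map′ (_∘ ≼⇒Contains {ρ = oneLine α} {α = π} (list≅ α A d) e)
    (_∘ Contains⇒≼ {ρ = oneLine α} {α = π} (list≅ α A d) e) (avoids? (oneLine α) π)

opaque

  χ : Tree → Tree → ℤ
  χ A t = if does (A ⋠? t) then 1ℤ else 0ℤ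

  χ-avoid : ∀ A t → ¬ A ≼ t → χ A t ≡ 1ℤ
  χ-avoid A t p with A ⋠? t
  ... | yes _ = refl
  ... | no ¬p = ⊥-elim (¬p p)

  -- Only avoidance is decided, so containment is available as a double negation.
  χ-contain : ∀ A t → ¬ ¬ A ≼ t → χ A t ≡ 0ℤ
  χ-contain A t ¬p with A ⋠? t
  ... | yes p = ⊥-elim (¬p p)
  ... | no _  = refl

  ∑-χ : ∀ r xs → ∑ (χ r) xs ≡ + length (filter (r ⋠?_) xs)
  ∑-χ r []       = refl
  ∑-χ r (t ∷ xs) with r ⋠? t
  ... | yes _ = cong (λ s → 1ℤ ℤ.+ s) (∑-χ r xs)
  ... | no  _ = trans (ℤ.+-identityˡ _) (∑-χ r xs)

χ-cong : ∀ {A B t u} → (A ≼ t → B ≼ u) → (B ≼ u → A ≼ t) → χ A t ≡ χ B u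
χ-cong {A} {B} {t} {u} f g with A ⋠? t
... | yes p = trans (χ-avoid A t p) (sym (χ-avoid B u (p ∘ g)))
... | no ¬p = trans (χ-contain A t ¬p) (sym (χ-contain B u λ q → ¬p (q ∘ f)))

χ-product : ∀ {A B C t u v} → (A ≼ t → B ≼ u ⊎ C ≼ v) → (B ≼ u → A ≼ t) → (C ≼ v → A ≼ t) →
            χ A t ≡ χ B u ℤ.* χ C v
χ-product {A} {B} {C} {t} {u} {v} split f g with B ⋠? u | C ⋠? v
... | yes p | yes q = trans (χ-avoid A t ([ p , q ]′ ∘ split)) (sym (cong₂ ℤ._*_ (χ-avoid B u p) (χ-avoid C v q)))
... | yes p | no ¬q = trans (χ-contain A t λ r → ¬q (r ∘ g)) (sym (cong₂ ℤ._*_ (χ-avoid B u p) (χ-contain C v ¬q)))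
... | no ¬p | yes q = trans (χ-contain A t λ r → ¬p (r ∘ f)) (sym (cong₂ ℤ._*_ (χ-contain B u ¬p) (χ-avoid C v q)))
... | no ¬p | no ¬q = trans (χ-contain A t λ r → ¬p (r ∘ f)) (sym (cong₂ ℤ._*_ (χ-contain B u ¬p) (χ-contain C v ¬q)))

χ-leaf : ∀ {A B} → χ (node A B) leaf ≡ 1ℤ
χ-leaf {A} {B} = χ-avoid (node A B) leaf node-⋠-leaf

node-snoc-≼-nodeʳ : ∀ {A B t u} → ¬ A ≼ t → node A (snoc B) ≼ node t u → node A (snoc B) ≼ u
node-snoc-≼-nodeʳ p r with node-snoc-≼-node⁻ r
... | inj₁ s              = ⊥-elim (p (≼-trans ≼-left s))
... | inj₂ (inj₁ s)       = s
... | inj₂ (inj₂ (s , _)) = ⊥-elim (p s)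

node-snoc-≼-nodeˡ : ∀ {A B t u} → ¬ snoc B ≼ u → node A (snoc B) ≼ node t u → node A (snoc B) ≼ t
node-snoc-≼-nodeˡ p r with node-snoc-≼-node⁻ r
... | inj₁ s              = s
... | inj₂ (inj₁ s)       = ⊥-elim (p (≼-trans ≼-right s))
... | inj₂ (inj₂ (_ , s)) = ⊥-elim (p s)

-- `node t u` avoids τ = `node A (snoc B)` in two cases: `t` avoids `A` and `u` avoids τ, or `t`
-- avoids τ and `u` avoids `snoc B`. Avoiding `A` or `snoc B` implies avoiding τ, so the overlap is
-- that `t` avoids `A` and `u` avoids `snoc B`.
χ-node-snoc : ∀ A B t u →
  χ (node A (snoc B)) (node t u) ℤ.+ χ A t ℤ.* χ (snoc B) u ≡
  χ A t ℤ.* χ (node A (snoc B)) u ℤ.+ χ (node A (snoc B)) t ℤ.* χ (snoc B) u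
χ-node-snoc A B t u with A ⋠? t | snoc B ⋠? u
... | yes p | yes q
  rewrite χ-avoid A t p
        | χ-avoid (snoc B) u q
        | χ-avoid (node A (snoc B)) t (p ∘ ≼-trans ≼-left)
        | χ-avoid (node A (snoc B)) u (q ∘ ≼-trans ≼-right)
        | χ-avoid (node A (snoc B)) (node t u) (p ∘ ≼-trans ≼-left ∘ node-snoc-≼-nodeˡ q)
  = refl
... | yes p | no ¬q
  rewrite χ-avoid A t p
        | χ-contain (snoc B) u ¬q
        | χ-avoid (node A (snoc B)) t (p ∘ ≼-trans ≼-left)
        | χ-cong {node A (snoc B)} {node A (snoc B)} {node t u} {u} (node-snoc-≼-nodeʳ p) (λ r → ≼-trans r ≼-right)
  = cong (ℤ._+ 0ℤ) (sym (ℤ.*-identityˡ (χ (node A (snoc B)) u)))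
... | no ¬p | yes q
  rewrite χ-contain A t ¬p
        | χ-avoid (snoc B) u q
        | χ-cong {node A (snoc B)} {node A (snoc B)} {node t u} {t} (node-snoc-≼-nodeˡ q) (λ r → ≼-trans r ≼-left)
  = let χτt = χ (node A (snoc B)) t in
    trans (ℤ.+-identityʳ χτt) (sym (trans (ℤ.+-identityˡ (χτt ℤ.* 1ℤ)) (ℤ.*-identityʳ χτt)))
... | no ¬p | no ¬q
  rewrite χ-contain A t ¬p
        | χ-contain (snoc B) u ¬q
        | χ-contain (node A (snoc B)) (node t u) (λ r → ¬p λ a → ¬q λ b → r (node-≼-node a b))
  = sym (trans (ℤ.+-identityˡ _) (ℤ.*-zeroʳ (χ (node A (snoc B)) t)))

open CommutativeRing seriesRing using () renaming (trans to ≗-trans; sym to ≗-sym)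
open ContinuedFraction seriesRing using (double)
open ContinuedFraction.Expansion seriesRing X 1-Xw-cancel

F f i : ℕ → Series
F m = treeSeries (χ (inc m))
f m = stretch (F m)
i m = involutionSeries (χ (inc m))

∑-zero : ∀ {A : Set} {w : A → ℤ} → (∀ x → w x ≡ 0ℤ) → ∀ xs → ∑ w xs ≡ 0ℤ
∑-zero p []       = refl
∑-zero p (x ∷ xs) = cong₂ ℤ._+_ (p x) (∑-zero p xs)

χ-leaf-pattern : ∀ t → χ leaf t ≡ 0ℤ
χ-leaf-pattern t = χ-contain leaf t λ p → p (leaf-≼ t)

F-zero : F 0 ≗ 0ˢ
F-zero n = ∑-zero χ-leaf-pattern (trees n)

i-zero : i 0 ≗ 0ˢ
i-zero n = ∑-zero χ-leaf-pattern (involutions n)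

snoc-equation : ∀ A → treeSeries (χ (snoc A)) ≗ 1ˢ +ˢ X *ˢ (treeSeries (χ A) *ˢ treeSeries (χ (snoc A)))
snoc-equation A = treeSeries-product (χ A) (χ (snoc A)) (χ (snoc A)) χ-leaf λ β γ →
  χ-product {snoc A} {A} {snoc A} {node β γ} snoc-≼-node⁻ (λ p → node-≼-node p (leaf-≼ γ)) (λ p → ≼-trans p ≼-right)

F-suc : ∀ m → F (suc m) ≗ 1ˢ +ˢ X *ˢ (F m *ˢ F (suc m))
F-suc m = snoc-equation (inc m)

f-zero : f 0 ≗ 0ˢ
f-zero = ≗-trans (stretch-cong F-zero) stretch-0

f-suc : ∀ m → f (suc m) ≗ 1ˢ +ˢ X *ˢ X *ˢ (f m *ˢ f (suc m))
f-suc m n = begin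
  stretch (F (suc m)) n
    ≡⟨ stretch-cong (F-suc m) n ⟩
  stretch (1ˢ +ˢ X *ˢ (F m *ˢ F (suc m))) n
    ≡⟨ stretch-+ 1ˢ (X *ˢ (F m *ˢ F (suc m))) n ⟩
  stretch 1ˢ n ℤ.+ stretch (X *ˢ (F m *ˢ F (suc m))) n
    ≡⟨ cong₂ ℤ._+_ (stretch-1 n) (trans (stretch-* X (F m *ˢ F (suc m)) n)
         (*ˢ-cong stretch-X (stretch-* (F m) (F (suc m))) n)) ⟩
  1ˢ n ℤ.+ (X *ˢ X *ˢ (f m *ˢ f (suc m))) n ∎
  where open ≡-Reasoning

+*-congʳ : ∀ (c d g g′ h : Series) → g ≗ g′ → c +ˢ d *ˢ (g *ˢ h) ≗ c +ˢ d *ˢ (g′ *ˢ h)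
+*-congʳ c d g g′ h p n = cong (λ z → c n ℤ.+ z) (*ˢ-cong {d} (λ _ → refl) (*ˢ-cong {g} p (λ _ → refl)) n)

-- Patterns with the series of an increasing pattern.

data Good : Tree → Set where
  leafᴳ : Good leaf
  snocᴳ : ∀ {A} → Good A → Good (snoc A)
  nodeᴳ : ∀ {A B} → Good A → Good B → Good (node A (snoc B))

snoc-series : ∀ A → treeSeries (χ A) ≗ F (size A) → treeSeries (χ (snoc A)) ≗ F (size (snoc A))
snoc-series A a = subst (λ k → treeSeries (χ (snoc A)) ≗ F k) (sym (size-snoc A))
  (F-step-unique F F-zero F-suc (size A) (treeSeries (χ (snoc A)))
    (≗-trans (snoc-equation A) (+*-congʳ 1ˢ X _ _ (treeSeries (χ (snoc A))) a)))

good-series : ∀ {r} → Good r → treeSeries (χ r) ≗ F (size r)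
good-series leafᴳ         = λ _ → refl
good-series (snocᴳ {A} a) = snoc-series A (good-series a)
good-series (nodeᴳ {A} {B} a b) = F-split-unique F F-zero F-suc (size A) (size (snoc B)) S
  (λ n → trans (cong (λ z → S n ℤ.+ z) (*ˢ-cong {X} (λ _ → refl) (*ˢ-cong (≗-sym fA) (≗-sym fB)) n))
    (trans (treeSeries-inclusion-exclusion (χ A) (χ (snoc B)) (χ (node A (snoc B))) χ-leaf (χ-node-snoc A B) n)
    (cong (λ z → 1ˢ n ℤ.+ z) (*ˢ-cong {X} (λ _ → refl) (λ m → cong₂ ℤ._+_
      (*ˢ-cong {g = S} fA (λ _ → refl) m) (*ˢ-cong {S} (λ _ → refl) fB m)) n))))
  where
  S = treeSeries (χ (node A (snoc B)))
  fA = good-series a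
  fB = snoc-series B (good-series b)

involution-snoc-equation : ∀ A → inv A ≡ A → involutionSeries (χ (snoc A)) ≗
  1ˢ +ˢ X *ˢ involutionSeries (χ A) +ˢ X *ˢ X *ˢ (stretch (treeSeries (χ A)) *ˢ involutionSeries (χ (snoc A)))
involution-snoc-equation A A-inv = involutionSeries-equation (χ A) (χ A) (χ (snoc A)) χ-leaf
  (λ δ → χ-cong snoc-≼-snoc⁻ (λ p → node-≼-node p (leaf-≼ leaf)))
  (λ β δ → χ-product (snoc-≼-wrap⁻ β δ A-inv) (snoc-≼-wrap⁺ β δ) (λ p → ≼-trans p (wrap-≽ β δ)))

involution-double-equation : ∀ A → let τ = node A (snoc (inv A)) in involutionSeries (χ τ) ≗
  1ˢ +ˢ X *ˢ involutionSeries (χ τ) +ˢ X *ˢ X *ˢ (stretch (treeSeries (χ A)) *ˢ involutionSeries (χ τ))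
involution-double-equation A = involutionSeries-equation (χ τ) (χ A) (χ τ) χ-leaf
  (λ δ → χ-cong node-snoc-≼-snoc⁻ (λ p → ≼-trans p ≼-left))
  (λ β δ → χ-product (node-snoc-≼-wrap⁻ β δ) (node-snoc-≼-wrap⁺ β δ) (λ p → ≼-trans p (wrap-≽ β δ)))
  where τ = node A (snoc (inv A))

i-suc : ∀ m → i (suc m) ≗ 1ˢ +ˢ X *ˢ i m +ˢ X *ˢ X *ˢ (f m *ˢ i (suc m))
i-suc m = involution-snoc-equation (inc m) (inv-snocs m refl)

double≡+ : ∀ n → double n ≡ n + n
double≡+ zero    = refl
double≡+ (suc n) = cong suc (trans (cong suc (double≡+ n)) (sym (ℕ.+-suc n n)))

good-snocs : ∀ j {r} → Good r → Good (snocs j r)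
good-snocs zero    g = g
good-snocs (suc j) g = snocᴳ (good-snocs j g)

-- The Chebyshev identity is used for `j = 0`. Each further maximum follows the recursion that also
-- defines the next `i`, since `good-series` identifies the tree series of the pattern so far.
double-series : ∀ j A → Good A → Good (inv A) → let r = snocs j (node A (snoc (inv A))) in
  involutionSeries (χ r) ≗ i (size r)
double-series zero A a _ = subst (λ k → involutionSeries (χ τ) ≗ i k) size-eq
  (i-even-unique f f-zero f-suc i i-zero i-suc (size A) (involutionSeries (χ τ))
    (≗-trans (involution-double-equation A)
      (+*-congʳ (1ˢ +ˢ X *ˢ involutionSeries (χ τ)) (X *ˢ X) _ _ (involutionSeries (χ τ)) (stretch-cong (good-series a)))))
  where
  τ = node A (snoc (inv A))
  size-eq : suc (suc (double (size A))) ≡ size τ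
  size-eq = cong suc (trans (cong suc (double≡+ (size A))) (trans (sym (ℕ.+-suc (size A) (size A)))
    (cong (λ z → size A + z) (sym (trans (size-snoc (inv A)) (cong suc (size-inv A)))))))
double-series (suc j) A a a′ = subst (λ k → involutionSeries (χ (snoc r)) ≗ i k) (sym (size-snoc r))
  (i-step-unique f f-zero f-suc i i-zero i-suc (size r) S
    (λ n → trans (involution-snoc-equation r (inv-snocs j τ-inv) n)
      (cong₂ (λ u v → 1ˢ n ℤ.+ u ℤ.+ v)
        (*ˢ-cong {X} (λ _ → refl) (double-series j A a a′) n)
        (*ˢ-cong {X *ˢ X} (λ _ → refl) (*ˢ-cong {g = S}
          (stretch-cong (good-series (good-snocs j (nodeᴳ a a′)))) (λ _ → refl)) n))))
  where
  r = snocs j (node A (snoc (inv A)))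
  S = involutionSeries (χ (snoc r))
  τ-inv : inv (node A (snoc (inv A))) ≡ node A (snoc (inv A))
  τ-inv = cong (λ t → node t (snoc (inv A))) (inv-involutive A)

good-inc : ∀ t → Good (inc t)
good-inc t = good-snocs t leafᴳ

wedge-good : ∀ {w} → Wedge w → Good w
wedge-good leafᵂ             = leafᴳ
wedge-good (nodeᵂ w zero)    = snocᴳ (wedge-good w)
wedge-good (nodeᵂ w (suc t)) = nodeᴳ (wedge-good w) (good-inc t)

-- An increasing pattern is its own inverse, so inversion only exchanges the two skew summands: the
-- result is `node (inc t) (snoc (inv w))`.
wedge-inv-good : ∀ {w} → Wedge w → Good (inv w)
wedge-inv-good leafᵂ               = leafᴳ
wedge-inv-good (nodeᵂ {w} v zero)    = snocᴳ (wedge-inv-good v)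
wedge-inv-good (nodeᵂ {w} v (suc t)) = subst (λ u → Good (u ⊝ snoc (inv w))) (sym (inv-snocs (suc t) {leaf} refl))
  (nodeᴳ (good-inc t) (wedge-inv-good v))

-- Counting permutations by counting trees.

module _ (ρ : List ℕ) (r : Tree) (e : ofList ρ ≅ ⟦ r ⟧) (n : ℕ) where

  Counted : Permutation′ n → Set
  Counted π = Involution π × Avoids p132 π × Avoids ρ π

  opaque

    counted? : ∀ π → Dec (Counted π)
    counted? π = involution? π ×-dec avoids? p132 π ×-dec avoids? ρ π

  perms : List (Permutation′ n)
  perms = filter counted? (permutations n)

  opaque
    unfolding counted?

    I≡length-perms : I ρ n ≡ length perms
    I≡length-perms = refl

  avoiders : List Tree
  avoiders = filter (r ⋠?_) (involutions n)

  perm⇒tree : ∀ {π} → π ∈ perms → ∃ λ t → t ∈ avoiders × ofPerm π ≅ ⟦ t ⟧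
  perm⇒tree {π} π∈ = t , ∈-filter⁺ (r ⋠?_) t∈ (avoids-ρ ∘ ≼⇒Contains {ρ = ρ} {α = π} e d) , d
    where
    counted : Counted π
    counted = proj₂ (∈-filter⁻ counted? {xs = permutations n} π∈)
    avoids-ρ : Avoids ρ π
    avoids-ρ = proj₂ (proj₂ counted)
    t : Tree
    t = proj₁ (avoider⇒tree π (proj₁ (proj₂ counted)))
    d : ofPerm π ≅ ⟦ t ⟧
    d = proj₂ (avoider⇒tree π (proj₁ (proj₂ counted)))
    t∈ : t ∈ involutions n
    t∈ = subst (λ k → t ∈ involutionsBelow n k) (sym (size-≅ π t d))
      (∈-involutionsBelow⁺ n t (ℕ.≤-reflexive (sym (size-≅ π t d))) (involution⇒inv π t d (proj₁ counted)))

  -- The list `permutations n` is complete up to pointwise equality, so the realization of `t` is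
  -- replaced by its representative there.
  realize-perm : ∀ t → size t ≡ n → ∃ λ π → π ∈ permutations n × ofPerm π ≅ ⟦ t ⟧
  realize-perm t refl = π′ , proj₁ (proj₂ found) ,
    ≅-trans (≅-sym (≈⇒≅ (proj₁ (realize t)) π′ (proj₂ (proj₂ found)))) (proj₂ (realize t))
    where
    found : ∃ λ π′ → π′ ∈ permutations n × proj₁ (realize t) ≈ π′
    found = find (permutations-complete (proj₁ (realize t)))
    π′ : Permutation′ n
    π′ = proj₁ found

  tree⇒perm : ∀ {t} → t ∈ avoiders → ∃ λ π → π ∈ perms × ofPerm π ≅ ⟦ t ⟧
  tree⇒perm {t} t∈ = π , ∈-filter⁺ counted? (proj₁ (proj₂ realized))
      (inv⇒involution π t d t-inv , tree⇒avoider π t d , proj₂ t∈′ ∘ Contains⇒≼ {ρ = ρ} {α = π} e d) , d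
    where
    t∈′ : t ∈ involutions n × ¬ r ≼ t
    t∈′ = ∈-filter⁻ (r ⋠?_) {xs = involutions n} t∈
    t-inv : inv t ≡ t
    t-inv = proj₂ (∈-involutionsBelow⁻ n n (proj₁ t∈′))
    realized : ∃ λ π → π ∈ permutations n × ofPerm π ≅ ⟦ t ⟧
    realized = realize-perm t (proj₁ (∈-involutionsBelow⁻ n n (proj₁ t∈′)))
    π : Permutation′ n
    π = proj₁ realized
    d : ofPerm π ≅ ⟦ t ⟧
    d = proj₂ (proj₂ realized)

  -- The relation "this permutation has this tree" is injective in both directions, so each count
  -- bounds the other.
  I≡involutionSeries : + I ρ n ≡ involutionSeries (χ r) n
  I≡involutionSeries = trans (cong +_ (trans I≡length-perms (ℕ.≤-antisym
    (length-≤ _≈_ (λ π t → ofPerm π ≅ ⟦ t ⟧)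
      (λ {π} {π′} d d′ → ofPerm-injective π π′ (≅-trans d (≅-sym d′))) perms avoiders
      (AllPairs.filter⁺ counted? (permutations-unique n)) (All.tabulate perm⇒tree))
    (length-≤ _≡_ (λ t π → ofPerm π ≅ ⟦ t ⟧)
      (λ {t} {t′} d d′ → ≅⇒≡ t t′ (≅-trans (≅-sym d) d′)) avoiders perms
      (AllPairs.filter⁺ (r ⋠?_) (Unique-involutionsBelow n n)) (All.tabulate tree⇒perm)))))
    (sym (∑-χ r (involutions n)))

-- The extended double-wedge pattern against the increasing pattern.

interval-tree : ∀ k → ofList (interval 1 k) ≅ ⟦ inc k ⟧
interval-tree k = subst (λ m → ofList (interval 1 k) ≅ ⟦ inc m ⟧) (length-applyUpTo (λ j → 1 + j) k)
  (ofList-increasing (interval 1 k) (interval-increasing 1 k))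

module _ (l k : ℕ) (2l<k : 2 * suc l + 1 ≤ k) (τ : Permutation′ (2 * suc l)) (A : Tree)
         (wedge : Wedge A ⊎ Wedge (inv A)) (e : ofList (oneLine τ) ≅ ⟦ node A (snoc (inv A)) ⟧) where

  private
    tail : List ℕ
    tail = interval (2 * suc l + 1) k

    r : Tree
    r = snocs (length tail) (node A (snoc (inv A)))

    good : Good A
    good = [ wedge-good , (λ w → subst Good (inv-involutive A) (wedge-inv-good w)) ]′ wedge

    good-inv : Good (inv A)
    good-inv = [ wedge-inv-good , wedge-good ]′ wedge

    below : oneLine τ ≪ tail
    below x∈ y∈ with ∈-interval⁻ (2 * suc l + 1) k y∈
    ... | j , _ , refl = ℕ.≤-trans (s≤s (proj₂ (oneLine-bounds τ x∈)))
      (ℕ.≤-trans (ℕ.≤-reflexive (ℕ.+-comm 1 (2 * suc l))) (ℕ.m≤m+n (2 * suc l + 1) j))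

    pattern-tree : ofList (oneLine τ ++ tail) ≅ ⟦ r ⟧
    pattern-tree = ofList-++-increasing {node A (snoc (inv A))} (oneLine τ) tail e below
      (interval-increasing (2 * suc l + 1) k)

    size-r : size r ≡ k
    size-r = begin
      size r
        ≡⟨ size-snocs (length tail) (node A (snoc (inv A))) ⟩
      length tail + size (node A (snoc (inv A)))
        ≡⟨ cong₂ _+_ (length-applyUpTo (λ j → 2 * suc l + 1 + j) (suc k ∸ (2 * suc l + 1)))
             (sym (size-≅ τ (node A (snoc (inv A))) (≅-trans (ofPerm≅ofList-oneLine τ) e))) ⟩
      suc k ∸ (2 * suc l + 1) + 2 * suc l
        ≡⟨ cong (λ m → suc k ∸ m + 2 * suc l) (ℕ.+-comm (2 * suc l) 1) ⟩
      k ∸ 2 * suc l + 2 * suc l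
        ≡⟨ ℕ.m∸n+n≡m (ℕ.≤-trans (ℕ.m≤m+n (2 * suc l) 1) 2l<k) ⟩
      k ∎
      where open ≡-Reasoning

  I-double-wedge : ∀ n → I (oneLine τ ++ interval (2 * suc l + 1) k) n ≡ I (interval 1 k) n
  I-double-wedge n = ℤ.+-injective (trans (I≡involutionSeries (oneLine τ ++ interval (2 * suc l + 1) k) r pattern-tree n)
    (trans (double-series (length tail) A good good-inv n)
    (trans (cong (λ m → i m n) size-r)
    (sym (I≡involutionSeries (interval 1 k) (inc k) (interval-tree k) n)))))

theorem2p17 : ∀ (l k : ℕ) → 2 ≤ l → 2 * l + 1 ≤ k →
    (τ : Permutation′ (2 * l)) →
    IsDoubleWedge l τ → Involution τ → Avoids p132 τ →
    I (oneLine τ ++ interval (2 * l + 1) k) ≗ I (interval 1 k)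
theorem2p17 (suc l) k _ 2l<k τ double-wedge _ _ =
  let A , wedge , e = double-wedge-tree l τ double-wedge
  in I-double-wedge l k 2l<k τ A wedge e
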